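{- Let $\Sigma$ be a set of generators and let $r=\langle l,r'\rangle$ be a rewrite rule in $\mathbf T_\Sigma+\mathbf{CComon}$, with $l,r'\colon i\to j$. For terms $g,h\colon m\to n$ in $\mathbf T_\Sigma+\mathbf{CComon}$, we have $g\Rightarrow_rh$ if and only if $\langle\!\langle\ulcorner\lfloor g\rfloor_\Sigma\urcorner\rangle\!\rangle_\Sigma\rightsquigarrow_{\langle\!\langle\lfloor r\rfloor_\Sigma\rangle\!\rangle_\Sigma}\langle\!\langle\ulcorner\lfloor h\rfloor_\Sigma\urcorner\rangle\!\rangle_\Sigma$, where $\rightsquigarrow$ is traced comonoid double pushout (DPO) rewriting with interfaces.
   Context: Terms. A set of generators $\Sigma$ has functions $\mathrm{dom},\mathrm{cod}\colon\Sigma\to\mathbb N$. $\mathbf T_\Sigma+\mathbf{CComon}$ is the symmetric traced PROP freely generated by $\Sigma$ together with a comultiplication $1\to2$ and counit $1\to0$, modulo the equations of cocommutative comonoids (counitality, coassociativity, cocommutativity). A rewrite rule is a pair $\langle l,r'\rangle$ of terms of the same type $i\to j$. For $g,h\colon m\to n$, $g\Rightarrow_{\langle l,r'\rangle}h$ if there exists $c\colon j+m\to i+n$ in $\mathbf T_\Sigma+\mathbf{CComon}$ with $g=\mathrm{Tr}^i((l\otimes\mathrm{id}_m);c)$ and $h=\mathrm{Tr}^i((r'\otimes\mathrm{id}_m);c)$ in $\mathbf T_\Sigma+\mathbf{CComon}$. Hypergraphs. A hypergraph has vertices and hyperedges with ordered lists of sources and targets; $\mathbf{Hyp}_\Sigma$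 is the category of finite hypergraphs whose hyperedges are labelled by generators of $\Sigma$ of matching arity and coarity, with label- and source/target-preserving homomorphisms. Write $n$ also for the discrete hypergraph with vertices $0,\dots,n-1$. $\mathsf{Csp}_D(\mathbf{Hyp}_\Sigma)$ is the PROP of isomorphism classes of cospans $m\to F\leftarrow n$ in $\mathbf{Hyp}_\Sigma$, composed by pushout, tensored by coproduct; its canonical trace sends $x+m\to F\leftarrow x+n$ to $m\to F'\leftarrow n$, where $F'$ is $F$ with the $a$-th input and $a$-th output vertices merged for each $a<x$. The map $\langle\!\langle\lfloor-\rfloor_\Sigma\rangle\!\rangle_\Sigma\colon\mathbf T_\Sigma+\mathbf{CComon}\to\mathsf{Csp}_D(\mathbf{Hyp}_\Sigma)$ is the traced PROP morphism (it factors through the inclusion $\lfloor-\rfloor_\Sigma$ into $\mathbf S_\Sigma+\mathbf{Frob}$, the free hypergraph category on $\Sigma$) sending a generator $\phi\colon k\to l$ to the cospan $k\to E_\phi\leftarrow l$ with a single $\phi$-labelled hyperedge on $k+l$ distinct vertices, the sources and targets picked in order by the legs, and sending the comultiplication and counit to the single-vertex cospans $1\to1\leftarrow2$ and $1\to1\leftarrow0$. The folding $\ulcorner-\urcorner$ bends inputs to outputs: if the interpretation of $f$ is $m\xrightarrow{a}F\xleftarrow{b}n$, then $\langle\!\langle\ulcorner\lfloor f\rfloor_\Sigma\urcorner\rangle\!\rangle_\Sigma$ is $0\to F\xleftarrow{[a,b]}m+n$, regarded as a morphism $F\leftarrow m+n$. Partial left-monogamy. The degree of a vertex is (number of hyperedge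 target positions, number of hyperedge source positions) it occupies. A cospan $m\xrightarrow{f}F\xleftarrow{g}n$ is partial left-monogamous if $f$ is mono and each vertex has degree $(0,o)$ if it is in the image of $f$, and $(0,o)$ or $(1,o)$ otherwise, for some $o\in\mathbb N$. DPO rewriting. The DPO rule $\langle\!\langle\lfloor r\rfloor_\Sigma\rangle\!\rangle_\Sigma$ is the span $L\xleftarrow{[a_1,a_2]}i+j\to R$ given by $L\leftarrow i+j$ and $R\leftarrow i+j$, the folded interpretations of $l$ and $r'$. For $G\xleftarrow{[b_1,b_2]}m+n$ and $H\leftarrow m+n$, there is a traced comonoid rewrite $G\rightsquigarrow H$ if there exist a cospan $i+j\xrightarrow{[c_1,c_2]}C\xleftarrow{[d_1,d_2]}m+n$ and morphisms $L\to G\leftarrow C$ and $C\to H\leftarrow R$ such that $L\to G\leftarrow C$ is a pushout of $L\leftarrow i+j\to C$, $C\to H\leftarrow R$ is a pushout of $C\leftarrow i+j\to R$, the maps $m+n\to G$ and $m+n\to H$ factor through $[d_1,d_2]$ via $C\to G$ and $C\to H$ respectively, and $i+j\to C\to G$ is a traced left-boundary complement, meaning: $c_2$ is mono and $j+m\xrightarrow{[c_2,d_1]}C\xleftarrow{[c_1,d_2]}i+n$ is a partial left-monogamous cospan. -}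

module Defs where

open import Data.Nat.Base using (ℕ; zero; suc; _+_)
open import Data.Nat.Properties using (+-assoc; +-identityʳ)
open import Data.Nat.ListAction using (sum)
open import Data.Fin.Base as Fin
  using (Fin; zero; suc; _↑ˡ_; _↑ʳ_; splitAt; punchIn; punchOut)
open import Data.Fin.Properties as Fin
  using (_≟_; splitAt-↑ˡ; splitAt-↑ʳ; cast-is-id; cast-trans;
         punchIn-punchOut; punchOut-punchIn; punchInᵢ≢i; punchOut-cong)
import Data.List.Base as List
import Data.Vec.Base as Vec
open import Data.Product.Base using (∃-syntax; _×_; _,_)
open import Data.Sum.Base using (_⊎_; inj₁; inj₂; [_,_]′)
open import Function.Base using (id; _∘_; const)
open import Relation.Nullary using (¬_; yes; no; contradiction)
open import Relation.Binary.PropositionalEquality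
  using (_≡_; _≢_; refl; sym; trans; cong; _≗_)

private variable
  i j k l m m′ n n′ o p q r s x y z : ℕ

record Signature : Set₁ where
  field
    Gen : Set
    dom : Gen → ℕ
    cod : Gen → ℕ

------------------------------------------------------------------------
-- The symmetric traced PROP freely generated by a signature together
-- with a cocommutative comonoid: its morphisms are the terms below, and
-- its equality is _≈_.

module _ (S : Signature) where
  open Signature S

  infixr 7 _⊗_
  infixr 6 _⨾_

  data Term : ℕ → ℕ → Set where
    gen : (φ : Gen) → Term (dom φ) (cod φ)
    δ   : Term 1 2
    ε   : Term 1 0
    idₜ : ∀ n → Term n n
    σ   : ∀ m n → Term (m + n) (n + m)
    _⨾_ : Term m n → Term n p → Term m p
    _⊗_ : Term m n → Term p q → Term (m + p) (n + q)
    Tr  : ∀ x → Term (x + m) (x + n) → Term m n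

module _ {S : Signature} where

  -- The laws of a strict monoidal category hold between terms whose types
  -- are equal only up to associativity and unitality of _+_.
  cast : m ≡ m′ → n ≡ n′ → Term S m n → Term S m′ n′
  cast refl refl f = f

  infix 4 _≈_

  data _≈_ : Term S m n → Term S m n → Set where
    ≈-refl  : {f : Term S m n} → f ≈ f
    ≈-sym   : {f g : Term S m n} → f ≈ g → g ≈ f
    ≈-trans : {f g h : Term S m n} → f ≈ g → g ≈ h → f ≈ h

    ⨾-cong  : {f f′ : Term S m n} {g g′ : Term S n p} →
              f ≈ f′ → g ≈ g′ → f ⨾ g ≈ f′ ⨾ g′
    ⊗-cong  : {f f′ : Term S m n} {g g′ : Term S p q} →
              f ≈ f′ → g ≈ g′ → f ⊗ g ≈ f′ ⊗ g′
    Tr-cong : {f f′ : Term S (x + m) (x + n)} → f ≈ f′ → Tr x f ≈ Tr x f′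

    ⨾-identityˡ : (f : Term S m n) → idₜ m ⨾ f ≈ f
    ⨾-identityʳ : (f : Term S m n) → f ⨾ idₜ n ≈ f
    ⨾-assoc     : (f : Term S m n) (g : Term S n p) (h : Term S p q) →
                  (f ⨾ g) ⨾ h ≈ f ⨾ (g ⨾ h)

    ⊗-id          : ∀ m n → idₜ m ⊗ idₜ n ≈ idₜ (m + n)
    ⊗-interchange : (f : Term S m n) (g : Term S n p)
                    (h : Term S q r) (k : Term S r s) →
                    (f ⨾ g) ⊗ (h ⨾ k) ≈ (f ⊗ h) ⨾ (g ⊗ k)
    ⊗-identityˡ   : (f : Term S m n) → idₜ 0 ⊗ f ≈ f
    ⊗-identityʳ   : (f : Term S m n) →
                    cast (+-identityʳ m) (+-identityʳ n) (f ⊗ idₜ 0) ≈ f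
    ⊗-assoc       : (f : Term S m n) (g : Term S p q) (h : Term S r s) →
                    cast (+-assoc m p r) (+-assoc n q s) ((f ⊗ g) ⊗ h) ≈
                    f ⊗ (g ⊗ h)

    σ-natural    : (f : Term S m n) (g : Term S p q) →
                   (f ⊗ g) ⨾ σ n q ≈ σ m p ⨾ (g ⊗ f)
    σ-involutive : ∀ m n → σ m n ⨾ σ n m ≈ idₜ (m + n)
    σ-unit       : ∀ m → cast (+-identityʳ m) refl (σ m 0) ≈ idₜ m
    σ-hexagon    : ∀ m n p →
                   σ m (n + p) ≈
                   cast (+-assoc m n p) (+-assoc n m p) (σ m n ⊗ idₜ p) ⨾
                   cast refl (sym (+-assoc n p m)) (idₜ n ⊗ σ m p)

    Tr-tightening  : (f : Term S m n) (g : Term S (x + n) (x + p)) (h : Term S p q) →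
                     Tr x ((idₜ x ⊗ f) ⨾ g ⨾ (idₜ x ⊗ h)) ≈ f ⨾ Tr x g ⨾ h
    Tr-sliding     : (f : Term S (x + m) (y + n)) (g : Term S y x) →
                     Tr x (f ⨾ (g ⊗ idₜ n)) ≈ Tr y ((g ⊗ idₜ m) ⨾ f)
    Tr-vanishing₀  : (f : Term S m n) → Tr 0 f ≈ f
    Tr-vanishing₊  : ∀ x y (f : Term S ((x + y) + m) ((x + y) + n)) →
                     Tr (x + y) f ≈
                     Tr y (Tr x (cast (+-assoc x y m) (+-assoc x y n) f))
    Tr-superposing : (f : Term S (x + m) (x + n)) (g : Term S p q) →
                     Tr x (cast (+-assoc x m p) (+-assoc x n q) (f ⊗ g)) ≈
                     Tr x f ⊗ g
    Tr-yanking     : ∀ x → Tr x (σ x x) ≈ idₜ x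

    δ-counitˡ : δ ⨾ (ε ⊗ idₜ 1) ≈ idₜ 1
    δ-counitʳ : δ ⨾ (idₜ 1 ⊗ ε) ≈ idₜ 1
    δ-coassoc : δ ⨾ (δ ⊗ idₜ 1) ≈ δ ⨾ (idₜ 1 ⊗ δ)
    δ-cocomm  : δ ⨾ σ 1 1 ≈ δ

------------------------------------------------------------------------

record RewriteRule (S : Signature) (i j : ℕ) : Set where
  constructor ⟨_,_⟩
  field
    lhs rhs : Term S i j

module _ {S : Signature} where

  infix 4 _⇒[_]_

  _⇒[_]_ : Term S m n → RewriteRule S i j → Term S m n → Set
  _⇒[_]_ {m} {n} {i} {j} g ⟨ l , r ⟩ h =
    ∃[ c ] g ≈ Tr i ((l ⊗ idₜ m) ⨾ c) × h ≈ Tr i ((r ⊗ idₜ m) ⨾ c)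

------------------------------------------------------------------------
-- Finite labelled hypergraphs, with vertex and hyperedge sets taken in the
-- skeleton of finite sets.

module _ (S : Signature) where
  open Signature S

  record Hypergraph : Set where
    field
      #V #E  : ℕ
      label  : Fin #E → Gen
      source : ∀ e → Fin (dom (label e)) → Fin #V
      target : ∀ e → Fin (cod (label e)) → Fin #V

open Hypergraph

module _ {S : Signature} where
  open Signature S

  Vertex Edge : Hypergraph S → Set
  Vertex F = Fin (#V F)
  Edge   F = Fin (#E F)

  record Hom (F G : Hypergraph S) : Set where
    field
      onV      : Vertex F → Vertex G
      onE      : Edge F → Edge G
      onLabel  : ∀ e → label F e ≡ label G (onE e)
      onSource : ∀ e a → onV (source F e a) ≡
                         source G (onE e) (Fin.cast (cong dom (onLabel e)) a)
      onTarget : ∀ e b → onV (target F e b) ≡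
                         target G (onE e) (Fin.cast (cong cod (onLabel e)) b)

  open Hom public

  private variable
    A B C F G H L P Q R : Hypergraph S

  infix  4 _≈ₕ_
  infixr 9 _∘ₕ_

  record _≈ₕ_ (f g : Hom F G) : Set where
    constructor _,_
    field
      ≈V : onV f ≗ onV g
      ≈E : onE f ≗ onE g

  _∘ₕ_ : Hom G H → Hom F G → Hom F H
  _∘ₕ_ {G} {H} {F} g f = record
    { onV      = onV g ∘ onV f
    ; onE      = onE g ∘ onE f
    ; onLabel  = λ e → trans (onLabel f e) (onLabel g (onE f e))
    ; onSource = λ e a → trans (cong (onV g) (onSource f e a))
                        (trans (onSource g (onE f e) _)
                               (cong (source H _) (cast-trans (dom≡ f e) (dom≡ g (onE f e)) a)))
    ; onTarget = λ e b → trans (cong (onV g) (onTarget f e b))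
                        (trans (onTarget g (onE f e) _)
                               (cong (target H _) (cast-trans (cod≡ f e) (cod≡ g (onE f e)) b)))
    }
    where
    dom≡ : (h : Hom A B) (e : Edge A) → dom (label A e) ≡ dom (label B (onE h e))
    dom≡ h e = cong dom (onLabel h e)

    cod≡ : (h : Hom A B) (e : Edge A) → cod (label A e) ≡ cod (label B (onE h e))
    cod≡ h e = cong cod (onLabel h e)

  Mono : Hom F G → Set
  Mono {F} f = ∀ {A} (g h : Hom A F) → f ∘ₕ g ≈ₕ f ∘ₕ h → g ≈ₕ h

  record IsPushout (f : Hom A B) (g : Hom A C) (p : Hom B P) (q : Hom C P) : Set where
    field
      commutes  : p ∘ₕ f ≈ₕ q ∘ₕ g
      universal : ∀ {Q} (h : Hom B Q) (k : Hom C Q) → h ∘ₕ f ≈ₕ k ∘ₕ g →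
                  ∃[ u ] (u ∘ₕ p ≈ₕ h) × (u ∘ₕ q ≈ₕ k)
      unique    : ∀ {Q} (u v : Hom P Q) →
                  u ∘ₕ p ≈ₕ v ∘ₕ p → u ∘ₕ q ≈ₕ v ∘ₕ q → u ≈ₕ v

  discrete : ℕ → Hypergraph S
  discrete n = record
    { #V = n ; #E = 0 ; label = λ () ; source = λ () ; target = λ () }

  pick : (Fin n → Vertex F) → Hom (discrete n) F
  pick f = record
    { onV = f ; onE = λ () ; onLabel = λ () ; onSource = λ () ; onTarget = λ () }

  [_,_]ₕ : Hom (discrete m) F → Hom (discrete n) F → Hom (discrete (m + n)) F
  [_,_]ₕ {m} f g = pick ([ onV f , onV g ]′ ∘ splitAt m)

  module _ (F G : Hypergraph S) where
    ⊕-label : Edge F ⊎ Edge G → Gen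
    ⊕-label = [ label F , label G ]′

    ⊕-source : ∀ e → Fin (dom (⊕-label e)) → Fin (#V F + #V G)
    ⊕-source (inj₁ e) a = source F e a ↑ˡ #V G
    ⊕-source (inj₂ e) a = #V F ↑ʳ source G e a

    ⊕-target : ∀ e → Fin (cod (⊕-label e)) → Fin (#V F + #V G)
    ⊕-target (inj₁ e) b = target F e b ↑ˡ #V G
    ⊕-target (inj₂ e) b = #V F ↑ʳ target G e b

    infixr 6 _⊕_

    _⊕_ : Hypergraph S
    _⊕_ = record
      { #V     = #V F + #V G
      ; #E     = #E F + #E G
      ; label  = ⊕-label ∘ splitAt (#E F)
      ; source = ⊕-source ∘ splitAt (#E F)
      ; target = ⊕-target ∘ splitAt (#E F)
      }

------------------------------------------------------------------------
-- The fields factor and factor-proj give existence in the universal property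
-- and proj-surjective gives uniqueness.

record Coequaliser (f g : Fin k → Fin n) : Set where
  field
    size            : ℕ
    proj            : Fin n → Fin size
    commutes        : proj ∘ f ≗ proj ∘ g
    factor          : (h : Fin n → Fin p) → h ∘ f ≗ h ∘ g → Fin size → Fin p
    factor-proj     : (h : Fin n → Fin p) (eq : h ∘ f ≗ h ∘ g) →
                      factor h eq ∘ proj ≗ h
    proj-surjective : ∀ w → ∃[ v ] proj v ≡ w

open Coequaliser

private
  identify : (u v : Fin n) → Coequaliser {1} (const u) (const v)
  identify {zero} () _
  identify {suc n} u v with u ≟ v
  ... | yes u≡v = record
    { size            = suc n
    ; proj            = id
    ; commutes        = λ _ → u≡v
    ; factor          = λ h _ → h
    ; factor-proj     = λ _ _ _ → refl
    ; proj-surjective = λ w → w , refl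
    }
  ... | no u≢v = record
    { size            = n
    ; proj            = collapse
    ; commutes        = λ _ → collapse-uv
    ; factor          = λ h _ → h ∘ punchIn v
    ; factor-proj     = factor-collapse
    ; proj-surjective = λ w → punchIn v w , collapse-punchIn w
    }
    where
    v≢u : v ≢ u
    v≢u = u≢v ∘ sym

    collapse : Fin (suc n) → Fin n
    collapse w with v ≟ w
    ... | yes _   = punchOut v≢u
    ... | no  v≢w = punchOut v≢w

    collapse-uv : collapse u ≡ collapse v
    collapse-uv with v ≟ u | v ≟ v
    ... | yes v≡u | _       = contradiction v≡u v≢u
    ... | no _    | yes _   = punchOut-cong v refl
    ... | no _    | no v≢v  = contradiction refl v≢v

    factor-collapse : (h : Fin (suc n) → Fin p) → (Fin 1 → h u ≡ h v) →
                      h ∘ punchIn v ∘ collapse ≗ h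
    factor-collapse h eq w with v ≟ w
    ... | yes refl = trans (cong h (punchIn-punchOut v≢u)) (eq zero)
    ... | no  v≢w  = cong h (punchIn-punchOut v≢w)

    collapse-punchIn : ∀ w → collapse (punchIn v w) ≡ w
    collapse-punchIn w with v ≟ punchIn v w
    ... | yes v≡ = contradiction (sym v≡) (punchInᵢ≢i v w)
    ... | no  v≢ = trans (punchOut-cong v refl) (punchOut-punchIn v)

-- Identifies f 0 with g 0, then f 1 with g 1, and so on.
coequaliser : (f g : Fin k → Fin n) → Coequaliser f g
coequaliser {zero}  f g = record
  { size            = _
  ; proj            = id
  ; commutes        = λ ()
  ; factor          = λ h _ → h
  ; factor-proj     = λ _ _ _ → refl
  ; proj-surjective = λ w → w , refl
  }
coequaliser {suc k} f g = record
  { size            = size rest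
  ; proj            = proj rest ∘ proj first
  ; commutes        = λ where
      zero    → cong (proj rest) (commutes first zero)
      (suc a) → commutes rest a
  ; factor          = λ h eq → factor rest (h₁ h eq) (eq₁ h eq)
  ; factor-proj     = λ h eq v →
      trans (factor-proj rest (h₁ h eq) (eq₁ h eq) (proj first v))
            (factor-proj first h (λ _ → eq zero) v)
  ; proj-surjective = λ w →
      let (v₁ , eq₁) = proj-surjective rest w
          (v  , eq ) = proj-surjective first v₁
      in v , trans (cong (proj rest) eq) eq₁
  }
  where
  first : Coequaliser {1} (const (f zero)) (const (g zero))
  first = identify (f zero) (g zero)

  rest : Coequaliser (proj first ∘ f ∘ suc) (proj first ∘ g ∘ suc)
  rest = coequaliser (proj first ∘ f ∘ suc) (proj first ∘ g ∘ suc)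

  h₁ : (h : Fin _ → Fin p) → h ∘ f ≗ h ∘ g → Fin (size first) → Fin p
  h₁ h eq = factor first h (λ _ → eq zero)

  eq₁ : (h : Fin _ → Fin p) (eq : h ∘ f ≗ h ∘ g) →
        h₁ h eq ∘ proj first ∘ f ∘ suc ≗ h₁ h eq ∘ proj first ∘ g ∘ suc
  eq₁ h eq a = trans (factor-proj first h _ (f (suc a)))
              (trans (eq (suc a)) (sym (factor-proj first h _ (g (suc a)))))

------------------------------------------------------------------------
-- The operations on cospans act on representatives of isomorphism classes.

module _ {S : Signature} where

  infix 7 _/_

  _/_ : (F : Hypergraph S) {f g : Fin k → Vertex F} → Coequaliser f g → Hypergraph S
  F / Q = record
    { #V     = size Q
    ; #E     = #E F
    ; label  = label F
    ; source = λ e → proj Q ∘ source F e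
    ; target = λ e → proj Q ∘ target F e
    }

record Cospan (S : Signature) (m n : ℕ) : Set where
  constructor cospan
  field
    {apex}  : Hypergraph S
    inputs  : Hom (discrete m) apex
    outputs : Hom (discrete n) apex

module _ {S : Signature} where
  open Signature S

  private variable
    F : Hypergraph S

  edge : (φ : Gen) → Cospan S (dom φ) (cod φ)
  edge φ = cospan {apex = E} (pick (_↑ˡ cod φ)) (pick (dom φ ↑ʳ_))
    where
    E : Hypergraph S
    E = record
      { #V     = dom φ + cod φ
      ; #E     = 1
      ; label  = λ _ → φ
      ; source = λ _ → _↑ˡ cod φ
      ; target = λ _ → dom φ ↑ʳ_
      }

  vertex : ∀ m n → Cospan S m n
  vertex m n = cospan {apex = discrete 1} (pick (λ _ → zero)) (pick (λ _ → zero))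

  idᶜ : ∀ n → Cospan S n n
  idᶜ n = cospan {apex = discrete n} (pick id) (pick id)

  σᶜ : ∀ m n → Cospan S (m + n) (n + m)
  σᶜ m n = cospan {apex = discrete (m + n)} (pick id)
                  [ pick (m ↑ʳ_) , pick (_↑ˡ n) ]ₕ

  -- The pushout of F ← n → G is F ⊕ G with the two images of each element
  -- of n identified; no hyperedges are identified, as n is discrete.
  _⨾ᶜ_ : Cospan S m n → Cospan S n p → Cospan S m p
  cospan {F} a b ⨾ᶜ cospan {G} c d =
    cospan {apex = (F ⊕ G) / Q} (pick (proj Q ∘ inl ∘ onV a)) (pick (proj Q ∘ inr ∘ onV d))
    where
    inl : Vertex F → Vertex (F ⊕ G)
    inl = _↑ˡ #V G

    inr : Vertex G → Vertex (F ⊕ G)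
    inr = #V F ↑ʳ_

    Q : Coequaliser (inl ∘ onV b) (inr ∘ onV c)
    Q = coequaliser (inl ∘ onV b) (inr ∘ onV c)

  _⊗ᶜ_ : Cospan S m n → Cospan S p q → Cospan S (m + p) (n + q)
  cospan {F} a b ⊗ᶜ cospan {G} c d =
    cospan {apex = F ⊕ G}
           [ pick ((_↑ˡ #V G) ∘ onV a) , pick ((#V F ↑ʳ_) ∘ onV c) ]ₕ
           [ pick ((_↑ˡ #V G) ∘ onV b) , pick ((#V F ↑ʳ_) ∘ onV d) ]ₕ

  Trᶜ : ∀ x → Cospan S (x + m) (x + n) → Cospan S m n
  Trᶜ {m} {n} x (cospan {F} a b) =
    cospan {apex = F / Q} (pick (proj Q ∘ onV a ∘ (x ↑ʳ_))) (pick (proj Q ∘ onV b ∘ (x ↑ʳ_)))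
    where
    Q : Coequaliser (onV a ∘ (_↑ˡ m)) (onV b ∘ (_↑ˡ n))
    Q = coequaliser (onV a ∘ (_↑ˡ m)) (onV b ∘ (_↑ˡ n))

  ⟦_⟧ : Term S m n → Cospan S m n
  ⟦ gen φ ⟧  = edge φ
  ⟦ δ ⟧      = vertex 1 2
  ⟦ ε ⟧      = vertex 1 0
  ⟦ idₜ n ⟧  = idᶜ n
  ⟦ σ m n ⟧  = σᶜ m n
  ⟦ f ⨾ g ⟧  = ⟦ f ⟧ ⨾ᶜ ⟦ g ⟧
  ⟦ f ⊗ g ⟧  = ⟦ f ⟧ ⊗ᶜ ⟦ g ⟧
  ⟦ Tr x f ⟧ = Trᶜ x ⟦ f ⟧

  inDegree outDegree : (F : Hypergraph S) → Vertex F → ℕ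
  inDegree  F v =
    sum (List.map (λ e → Vec.count (v ≟_) (Vec.tabulate (target F e))) (List.allFin (#E F)))
  outDegree F v =
    sum (List.map (λ e → Vec.count (v ≟_) (Vec.tabulate (source F e))) (List.allFin (#E F)))

  degree : (F : Hypergraph S) → Vertex F → ℕ × ℕ
  degree F v = inDegree F v , outDegree F v

  Image : Hom (discrete n) F → Vertex F → Set
  Image f v = ∃[ a ] onV f a ≡ v

  record PartialLeftMonogamous (c : Cospan S m n) : Set where
    open Cospan c
    field
      inputs-mono : Mono inputs
      degree-in   : ∀ v → Image inputs v → ∃[ o ] degree apex v ≡ (0 , o)
      degree-out  : ∀ v → ¬ Image inputs v →
                    ∃[ o ] (degree apex v ≡ (0 , o) ⊎ degree apex v ≡ (1 , o))

------------------------------------------------------------------------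
-- F ← m + n.  The two summands are kept apart as indices because m and n
-- cannot be recovered from m + n.

record Interfaced (S : Signature) (m n : ℕ) : Set where
  constructor interfaced
  field
    {carrier} : Hypergraph S
    leg       : Hom (discrete (m + n)) carrier

record DPORule (S : Signature) (i j : ℕ) : Set where
  constructor span
  field
    left right : Interfaced S i j

module _ {S : Signature} where
  open Interfaced

  ⌜_⌝ : Cospan S m n → Interfaced S m n
  ⌜ cospan a b ⌝ = interfaced [ a , b ]ₕ

  ⟪_⟫ : RewriteRule S i j → DPORule S i j
  ⟪ ⟨ l , r ⟩ ⟫ = span ⌜ ⟦ l ⟧ ⌝ ⌜ ⟦ r ⟧ ⌝

  record TracedLeftBoundaryComplement {C : Hypergraph S}
    (c₁ : Hom (discrete i) C) (c₂ : Hom (discrete j) C)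
    (d₁ : Hom (discrete m) C) (d₂ : Hom (discrete n) C) : Set where
    field
      c₂-mono : Mono c₂
      partialLeftMonogamous :
        PartialLeftMonogamous (cospan [ c₂ , d₁ ]ₕ [ c₁ , d₂ ]ₕ)

  infix 4 _⇝[_]_

  record _⇝[_]_ (G : Interfaced S m n) (ρ : DPORule S i j) (H : Interfaced S m n) : Set where
    open DPORule ρ renaming (left to L; right to R)
    field
      {C} : Hypergraph S
      c₁  : Hom (discrete i) C
      c₂  : Hom (discrete j) C
      d₁  : Hom (discrete m) C
      d₂  : Hom (discrete n) C
      L→G : Hom (carrier L) (carrier G)
      C→G : Hom C (carrier G)
      C→H : Hom C (carrier H)
      R→H : Hom (carrier R) (carrier H)
      pushout-G  : IsPushout (leg L) [ c₁ , c₂ ]ₕ L→G C→G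
      pushout-H  : IsPushout [ c₁ , c₂ ]ₕ (leg R) C→H R→H
      factor-G   : leg G ≈ₕ C→G ∘ₕ [ d₁ , d₂ ]ₕ
      factor-H   : leg H ≈ₕ C→H ∘ₕ [ d₁ , d₂ ]ₕ
      complement : TracedLeftBoundaryComplement c₁ c₂ d₁ d₂

{-# OPTIONS --safe #-}

-- The interpretation is shown to be a faithful map from terms onto the partial
-- left-monogamous cospans; rewriting then corresponds to DPO rewriting because
-- Trⁱ ((l ⊗ id) ⨾ c) is interpreted by the pushout of ⟦ l ⟧ and ⟦ c ⟧ along i + j.
--
-- Faithfulness and fullness: the comonoid makes the trace-free wirings into the
-- functions between finite sets, read contravariantly (fan).  Every term can be
-- rewritten so that its generators are pulled out through traces one at a time,
-- leaving a fan and some closed loops Tr 1 δ.  These are exactly the readings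
-- (reify) of partial left-monogamous hypergraphs, and by sliding a reading does
-- not depend on the enumeration of the hyperedges and vertices.
--
-- Soundness: the homomorphisms ⟦ f ⟧ → H with prescribed values on the legs are
-- given by recursion on f (Φ), and every axiom induces maps between these sets in
-- both directions that preserve surjectivity.
module Submission where

open import Data.Bool.Base using (if_then_else_)
open import Data.Nat.Base using (ℕ; zero; suc; _+_; _≤_; z≤n; s≤s)
open import Data.Nat.ListAction using (sum)
open import Data.Nat.Properties as ℕ using (+-assoc; +-identityʳ)
open import Data.Fin.Base as Fin
  using (Fin; zero; suc; _↑ˡ_; _↑ʳ_; splitAt; toℕ; punchIn; punchOut)
open import Data.Fin.Properties as Fin
  using (_≟_; any?; suc-injective; injective⇒≤; splitAt-↑ˡ; splitAt-↑ʳ; join-splitAt; ↑ˡ-injective;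
         toℕ-cast; toℕ-↑ˡ; toℕ-↑ʳ; toℕ-injective; cast-is-id; cast-involutive;
         punchIn-punchOut; punchIn-injective; punchInᵢ≢i; punchOut-injective)
import Data.List.Base as List
open import Data.List.Properties using (map-tabulate)
open import Data.Product.Base using (Σ; Σ-syntax; ∃-syntax; _×_; _,_; proj₁; proj₂)
open import Data.Sum.Base using (_⊎_; inj₁; inj₂; [_,_]′)
open import Data.Unit.Base using (⊤; tt)
import Data.Vec.Base as Vec
open import Function.Base using (id; _∘_)
open import Function.Bundles using (_⇔_; mk⇔)
open import Function.Definitions using (Injective)
open import Relation.Binary.Bundles using (Setoid)
open import Relation.Binary.PropositionalEquality
  using (_≡_; _≢_; refl; sym; trans; cong; cong₂; subst; subst₂; _≗_)
import Relation.Binary.Reasoning.Setoid as SetoidReasoning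
open import Relation.Nullary using (¬_; Dec; does; yes; no; contradiction; ¬?)
open import Defs

private variable
  a a′ b b′ c c′ d i j k k′ m m′ n n′ p q r s s′ t t′ x y V V′ : ℕ
  A B : Set

-- Fans

module _ {S : Signature} where

  private variable
    f g : Term S m n

  Term-setoid : ℕ → ℕ → Setoid _ _
  Term-setoid m n = record
    { Carrier = Term S m n
    ; _≈_ = _≈_
    ; isEquivalence = record { refl = ≈-refl ; sym = ≈-sym ; trans = ≈-trans }
    }

  module ≈-Reasoning {m n : ℕ} = SetoidReasoning (Term-setoid m n)
  open ≈-Reasoning

  ≡⇒≈ : f ≡ g → f ≈ g
  ≡⇒≈ refl = ≈-refl

  infixr 6 _⨾⟩_
  infixl 6 _⟨⨾_
  infixr 7 _⊗⟩_
  infixl 7 _⟨⊗_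

  _⨾⟩_ : (f : Term S m n) {g g′ : Term S n p} → g ≈ g′ → f ⨾ g ≈ f ⨾ g′
  f ⨾⟩ eq = ⨾-cong ≈-refl eq

  _⟨⨾_ : {f f′ : Term S m n} → f ≈ f′ → (g : Term S n p) → f ⨾ g ≈ f′ ⨾ g
  eq ⟨⨾ g = ⨾-cong eq ≈-refl

  _⊗⟩_ : (f : Term S m n) {g g′ : Term S p q} → g ≈ g′ → f ⊗ g ≈ f ⊗ g′
  f ⊗⟩ eq = ⊗-cong ≈-refl eq

  _⟨⊗_ : {f f′ : Term S m n} → f ≈ f′ → (g : Term S p q) → f ⊗ g ≈ f′ ⊗ g
  eq ⟨⊗ g = ⊗-cong eq ≈-refl

  ⨾-assoc′ : {f : Term S m n} {g : Term S n p} {h : Term S p q} →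
             (f ⨾ g) ⨾ h ≈ f ⨾ g ⨾ h
  ⨾-assoc′ = ⨾-assoc _ _ _

  pullˡ : {f : Term S m n} {g : Term S n p} {h : Term S m p} {k : Term S p q} →
          f ⨾ g ≈ h → f ⨾ g ⨾ k ≈ h ⨾ k
  pullˡ eq = ≈-trans (≈-sym ⨾-assoc′) (eq ⟨⨾ _)

  pushˡ : {f : Term S m n} {g : Term S n p} {h : Term S m p} {k : Term S p q} →
          h ≈ f ⨾ g → h ⨾ k ≈ f ⨾ g ⨾ k
  pushˡ eq = ≈-trans (eq ⟨⨾ _) ⨾-assoc′

  extend : {f : Term S m n} {g : Term S n p} {f′ : Term S m r} {g′ : Term S r p} {k : Term S p q} →
           f ⨾ g ≈ f′ ⨾ g′ → f ⨾ g ⨾ k ≈ f′ ⨾ g′ ⨾ k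
  extend eq = ≈-trans (pullˡ eq) ⨾-assoc′

  cancelˡ : {f : Term S m n} {g : Term S n m} {k : Term S m q} →
            f ⨾ g ≈ idₜ m → f ⨾ g ⨾ k ≈ k
  cancelˡ eq = ≈-trans (pullˡ eq) (⨾-identityˡ _)

  id⊗⨾ : {f : Term S m n} {g : Term S n p} →
         (idₜ x ⊗ f) ⨾ (idₜ x ⊗ g) ≈ idₜ x ⊗ (f ⨾ g)
  id⊗⨾ = ≈-sym (≈-trans (≈-sym (⨾-identityˡ _) ⟨⊗ _) (⊗-interchange _ _ _ _))

  ⊗id⨾ : {f : Term S m n} {g : Term S n p} →
         (f ⊗ idₜ x) ⨾ (g ⊗ idₜ x) ≈ (f ⨾ g) ⊗ idₜ x
  ⊗id⨾ = ≈-sym (≈-trans (_ ⊗⟩ ≈-sym (⨾-identityˡ _)) (⊗-interchange _ _ _ _))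

  exchangeˡ : {f : Term S m n} {g : Term S p q} → (f ⊗ idₜ p) ⨾ (idₜ n ⊗ g) ≈ f ⊗ g
  exchangeˡ = ≈-trans (≈-sym (⊗-interchange _ _ _ _)) (⊗-cong (⨾-identityʳ _) (⨾-identityˡ _))

  exchangeʳ : {f : Term S m n} {g : Term S p q} → (idₜ m ⊗ g) ⨾ (f ⊗ idₜ q) ≈ f ⊗ g
  exchangeʳ = ≈-trans (≈-sym (⊗-interchange _ _ _ _)) (⊗-cong (⨾-identityˡ _) (⨾-identityʳ _))

  exchange : {f : Term S m n} {g : Term S p q} →
             (f ⊗ idₜ p) ⨾ (idₜ n ⊗ g) ≈ (idₜ m ⊗ g) ⨾ (f ⊗ idₜ q)
  exchange = ≈-trans exchangeˡ (≈-sym exchangeʳ)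

  -- Associativity with a summand 1 in front holds without a cast.
  id₁⊗id₁⊗ : (f : Term S m n) → idₜ 1 ⊗ (idₜ 1 ⊗ f) ≈ idₜ 2 ⊗ f
  id₁⊗id₁⊗ f = ≈-trans (≈-sym (⊗-assoc (idₜ 1) (idₜ 1) f)) (⊗-id 1 1 ⟨⊗ f)

  σ₁₂ : σ {S} 1 2 ≈ (σ 1 1 ⊗ idₜ 1) ⨾ (idₜ 1 ⊗ σ 1 1)
  σ₁₂ = σ-hexagon 1 1 1

  σ₂₁ : σ {S} 2 1 ≈ (idₜ 1 ⊗ σ 1 1) ⨾ (σ 1 1 ⊗ idₜ 1)
  σ₂₁ = begin
    σ 2 1                                     ≈⟨ ⨾-identityʳ _ ⟨
    σ 2 1 ⨾ idₜ 3                             ≈⟨ _ ⨾⟩ inverse ⟨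
    σ 2 1 ⨾ σ 1 2 ⨾ (idₜ 1 ⊗ σ 1 1) ⨾ (σ 1 1 ⊗ idₜ 1) ≈⟨ cancelˡ (σ-involutive 2 1) ⟩
    (idₜ 1 ⊗ σ 1 1) ⨾ (σ 1 1 ⊗ idₜ 1)         ∎
    where
    inverse : σ 1 2 ⨾ (idₜ 1 ⊗ σ 1 1) ⨾ (σ 1 1 ⊗ idₜ 1) ≈ idₜ 3
    inverse = begin
      σ 1 2 ⨾ (idₜ 1 ⊗ σ 1 1) ⨾ (σ 1 1 ⊗ idₜ 1)
        ≈⟨ pushˡ σ₁₂ ⟩
      (σ 1 1 ⊗ idₜ 1) ⨾ (idₜ 1 ⊗ σ 1 1) ⨾ (idₜ 1 ⊗ σ 1 1) ⨾ (σ 1 1 ⊗ idₜ 1)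
        ≈⟨ _ ⨾⟩ cancelˡ (≈-trans id⊗⨾ (≈-trans (_ ⊗⟩ σ-involutive 1 1) (⊗-id 1 2))) ⟩
      (σ 1 1 ⊗ idₜ 1) ⨾ (σ 1 1 ⊗ idₜ 1)
        ≈⟨ ≈-trans ⊗id⨾ (≈-trans (σ-involutive 1 1 ⟨⊗ _) (⊗-id 2 1)) ⟩
      idₜ 3 ∎

  discard : ∀ m → Term S m 0
  discard zero    = idₜ 0
  discard (suc m) = ε ⊗ discard m

  swap₂ : ∀ m → Term S (2 + m) (2 + m)
  swap₂ m = σ 1 1 ⊗ idₜ m

  -- Copying one wire at a time avoids the associativity casts of a copy m → m + m.
  dup : Fin m → Term S m (suc m)
  dup {suc m} zero    = δ ⊗ idₜ m
  dup {suc m} (suc a) = (idₜ 1 ⊗ dup a) ⨾ swap₂ m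

  swap₂-natural : (f : Term S m n) →
                  swap₂ m ⨾ (idₜ 1 ⊗ (idₜ 1 ⊗ f)) ≈ (idₜ 1 ⊗ (idₜ 1 ⊗ f)) ⨾ swap₂ n
  swap₂-natural f = begin
    _ ≈⟨ _ ⨾⟩ id₁⊗id₁⊗ f ⟩
    _ ≈⟨ exchange ⟩
    _ ≈⟨ id₁⊗id₁⊗ f ⟨⨾ _ ⟨
    _ ∎

  swap₂-involutive : ∀ m → swap₂ m ⨾ swap₂ m ≈ idₜ (2 + m)
  swap₂-involutive m = ≈-trans ⊗id⨾ (≈-trans (σ-involutive 1 1 ⟨⊗ _) (⊗-id 2 m))

  private
    id₁⊗swap₂ : idₜ 1 ⊗ swap₂ m ≈ (idₜ 1 ⊗ σ 1 1) ⊗ idₜ m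
    id₁⊗swap₂ {m} = ≈-sym (⊗-assoc (idₜ 1) (σ 1 1) (idₜ m))

    δ⊗id : δ {S} ⊗ idₜ (suc m) ≈ (δ ⊗ idₜ 1) ⊗ idₜ m
    δ⊗id {m} = ≈-trans (_ ⊗⟩ ≈-sym (⊗-id 1 m)) (≈-sym (⊗-assoc δ (idₜ 1) (idₜ m)))

    id₁⊗δ : idₜ {S} 1 ⊗ (δ ⊗ idₜ m) ≈ (idₜ 1 ⊗ δ) ⊗ idₜ m
    id₁⊗δ {m} = ≈-sym (⊗-assoc (idₜ 1) δ (idₜ m))

    swap₂-suc : swap₂ (suc m) ≈ (σ 1 1 ⊗ idₜ 1) ⊗ idₜ m
    swap₂-suc {m} = ≈-trans (_ ⊗⟩ ≈-sym (⊗-id 1 m)) (≈-sym (⊗-assoc (σ 1 1) (idₜ 1) (idₜ m)))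

    σ₁₂⊗id : σ 1 2 ⊗ idₜ m ≈ swap₂ (suc m) ⨾ (idₜ 1 ⊗ swap₂ m)
    σ₁₂⊗id = ≈-trans (σ₁₂ ⟨⊗ _) (≈-trans (≈-sym ⊗id⨾) (⨾-cong (≈-sym swap₂-suc) (≈-sym id₁⊗swap₂)))

    σ₂₁⊗id : σ 2 1 ⊗ idₜ m ≈ (idₜ 1 ⊗ swap₂ m) ⨾ swap₂ (suc m)
    σ₂₁⊗id = ≈-trans (σ₂₁ ⟨⊗ _) (≈-trans (≈-sym ⊗id⨾) (⨾-cong (≈-sym id₁⊗swap₂) (≈-sym swap₂-suc)))

    dup-suc-suc : (b c : Fin m) →
                  dup (suc c) ⨾ (idₜ 1 ⊗ dup (suc b)) ≈
                  (idₜ 1 ⊗ (dup c ⨾ (idₜ 1 ⊗ dup b))) ⨾ (σ 1 2 ⊗ idₜ m)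
    dup-suc-suc {m} b c = begin
      ((idₜ 1 ⊗ dup c) ⨾ swap₂ m) ⨾ (idₜ 1 ⊗ ((idₜ 1 ⊗ dup b) ⨾ swap₂ m))
        ≈⟨ ⨾-assoc′ ⟩
      _ ≈⟨ _ ⨾⟩ _ ⨾⟩ id⊗⨾ ⟨
      (idₜ 1 ⊗ dup c) ⨾ swap₂ m ⨾ (idₜ 1 ⊗ (idₜ 1 ⊗ dup b)) ⨾ (idₜ 1 ⊗ swap₂ m)
        ≈⟨ _ ⨾⟩ extend (swap₂-natural (dup b)) ⟩
      (idₜ 1 ⊗ dup c) ⨾ (idₜ 1 ⊗ (idₜ 1 ⊗ dup b)) ⨾ swap₂ (suc m) ⨾ (idₜ 1 ⊗ swap₂ m)
        ≈⟨ pullˡ id⊗⨾ ⟩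
      _ ≈⟨ _ ⨾⟩ σ₁₂⊗id ⟨
      _ ∎

  dup-coassoc : (b : Fin m) → dup b ⨾ (δ ⊗ idₜ m) ≈ dup b ⨾ (idₜ 1 ⊗ dup b)
  dup-coassoc {suc m} zero = begin
    (δ ⊗ idₜ m) ⨾ (δ ⊗ idₜ (suc m))         ≈⟨ _ ⨾⟩ δ⊗id ⟩
    (δ ⊗ idₜ m) ⨾ ((δ ⊗ idₜ 1) ⊗ idₜ m)     ≈⟨ ⊗id⨾ ⟩
    (δ ⨾ (δ ⊗ idₜ 1)) ⊗ idₜ m               ≈⟨ δ-coassoc ⟨⊗ _ ⟩
    (δ ⨾ (idₜ 1 ⊗ δ)) ⊗ idₜ m               ≈⟨ ⊗id⨾ ⟨
    (δ ⊗ idₜ m) ⨾ ((idₜ 1 ⊗ δ) ⊗ idₜ m)     ≈⟨ _ ⨾⟩ id₁⊗δ ⟨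
    _ ∎
  dup-coassoc {suc m} (suc b) = begin
    ((idₜ 1 ⊗ dup b) ⨾ swap₂ m) ⨾ (δ ⊗ idₜ (suc m))
      ≈⟨ ⨾-assoc′ ⟩
    _ ≈⟨ _ ⨾⟩ _ ⨾⟩ δ⊗id ⟩
    (idₜ 1 ⊗ dup b) ⨾ swap₂ m ⨾ ((δ ⊗ idₜ 1) ⊗ idₜ m)
      ≈⟨ _ ⨾⟩ ≈-trans ⊗id⨾ (≈-trans (≈-sym (σ-natural (idₜ 1) δ) ⟨⊗ _) (≈-sym ⊗id⨾)) ⟩
    (idₜ 1 ⊗ dup b) ⨾ ((idₜ 1 ⊗ δ) ⊗ idₜ m) ⨾ (σ 1 2 ⊗ idₜ m)
      ≈⟨ pullˡ (≈-trans (_ ⨾⟩ ≈-sym id₁⊗δ) id⊗⨾) ⟩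
    (idₜ 1 ⊗ (dup b ⨾ (δ ⊗ idₜ m))) ⨾ (σ 1 2 ⊗ idₜ m)
      ≈⟨ (_ ⊗⟩ dup-coassoc b) ⟨⨾ _ ⟩
    (idₜ 1 ⊗ (dup b ⨾ (idₜ 1 ⊗ dup b))) ⨾ (σ 1 2 ⊗ idₜ m)
      ≈⟨ dup-suc-suc b b ⟨
    _ ∎

  private
    dup-comm-zero-suc : (b : Fin m) → dup zero ⨾ (idₜ 1 ⊗ dup (suc b)) ⨾ swap₂ (suc m) ≈
                                      dup (suc b) ⨾ (idₜ 1 ⊗ dup zero)
    dup-comm-zero-suc {m} b = begin
      (δ ⊗ idₜ m) ⨾ (idₜ 1 ⊗ ((idₜ 1 ⊗ dup b) ⨾ swap₂ m)) ⨾ swap₂ (suc m)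
        ≈⟨ _ ⨾⟩ pushˡ (≈-sym id⊗⨾) ⟩
      (δ ⊗ idₜ m) ⨾ (idₜ 1 ⊗ (idₜ 1 ⊗ dup b)) ⨾ (idₜ 1 ⊗ swap₂ m) ⨾ swap₂ (suc m)
        ≈⟨ _ ⨾⟩ ⨾-cong (id₁⊗id₁⊗ (dup b)) (≈-sym σ₂₁⊗id) ⟩
      (δ ⊗ idₜ m) ⨾ (idₜ 2 ⊗ dup b) ⨾ (σ 2 1 ⊗ idₜ m)
        ≈⟨ extend exchange ⟩
      (idₜ 1 ⊗ dup b) ⨾ (δ ⊗ idₜ (suc m)) ⨾ (σ 2 1 ⊗ idₜ m)
        ≈⟨ _ ⨾⟩ (δ⊗id ⟨⨾ _) ⟩
      (idₜ 1 ⊗ dup b) ⨾ ((δ ⊗ idₜ 1) ⊗ idₜ m) ⨾ (σ 2 1 ⊗ idₜ m)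
        ≈⟨ _ ⨾⟩ ≈-trans ⊗id⨾ (≈-trans (σ-natural δ (idₜ 1) ⟨⊗ _) (≈-sym ⊗id⨾)) ⟩
      (idₜ 1 ⊗ dup b) ⨾ swap₂ m ⨾ ((idₜ 1 ⊗ δ) ⊗ idₜ m)
        ≈⟨ _ ⨾⟩ _ ⨾⟩ id₁⊗δ ⟨
      _ ≈⟨ ⨾-assoc′ ⟨
      _ ∎

    dup-comm-flip : (b c : Fin m) →
                    dup c ⨾ (idₜ 1 ⊗ dup b) ⨾ swap₂ m ≈ dup b ⨾ (idₜ 1 ⊗ dup c) →
                    dup b ⨾ (idₜ 1 ⊗ dup c) ⨾ swap₂ m ≈ dup c ⨾ (idₜ 1 ⊗ dup b)
    dup-comm-flip {m} b c eq = begin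
      dup b ⨾ (idₜ 1 ⊗ dup c) ⨾ swap₂ m ≈⟨ pullˡ (≈-sym eq) ⟩
      (dup c ⨾ (idₜ 1 ⊗ dup b) ⨾ swap₂ m) ⨾ swap₂ m ≈⟨ ⨾-assoc′ ⟩
      _ ≈⟨ _ ⨾⟩ ⨾-assoc′ ⟩
      dup c ⨾ (idₜ 1 ⊗ dup b) ⨾ swap₂ m ⨾ swap₂ m
        ≈⟨ _ ⨾⟩ ≈-trans (_ ⨾⟩ swap₂-involutive m) (⨾-identityʳ _) ⟩
      _ ∎

  dup-comm : (b c : Fin m) →
             dup c ⨾ (idₜ 1 ⊗ dup b) ⨾ swap₂ m ≈ dup b ⨾ (idₜ 1 ⊗ dup c)
  dup-comm {suc m} zero zero = begin
    (δ ⊗ idₜ m) ⨾ (idₜ 1 ⊗ (δ ⊗ idₜ m)) ⨾ swap₂ (suc m)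
      ≈⟨ extend (≈-sym (dup-coassoc zero)) ⟩
    (δ ⊗ idₜ m) ⨾ (δ ⊗ idₜ (suc m)) ⨾ swap₂ (suc m)
      ≈⟨ _ ⨾⟩ ≈-trans ⊗id⨾ (δ-cocomm ⟨⊗ _) ⟩
    (δ ⊗ idₜ m) ⨾ (δ ⊗ idₜ (suc m))
      ≈⟨ dup-coassoc zero ⟩
    _ ∎
  dup-comm zero    (suc c) = dup-comm-flip (suc c) zero (dup-comm-zero-suc c) 
  dup-comm (suc b) zero    = dup-comm-zero-suc b
  dup-comm {suc m} (suc b) (suc c) = begin
    dup (suc c) ⨾ (idₜ 1 ⊗ dup (suc b)) ⨾ swap₂ (suc m)
      ≈⟨ pullˡ (dup-suc-suc b c) ⟩
    _ ≈⟨ ⨾-assoc′ ⟩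
    (idₜ 1 ⊗ (dup c ⨾ (idₜ 1 ⊗ dup b))) ⨾ (σ 1 2 ⊗ idₜ m) ⨾ swap₂ (suc m)
      ≈⟨ _ ⨾⟩ ≈-trans (_ ⨾⟩ swap₂-suc)
           (≈-trans ⊗id⨾ (≈-trans (≈-sym (σ-natural (idₜ 1) (σ 1 1)) ⟨⊗ _) (≈-trans (≈-sym ⊗id⨾) (≈-sym id₁⊗swap₂ ⟨⨾ _)))) ⟩
    (idₜ 1 ⊗ (dup c ⨾ (idₜ 1 ⊗ dup b))) ⨾ (idₜ 1 ⊗ swap₂ m) ⨾ (σ 1 2 ⊗ idₜ m)
      ≈⟨ pullˡ (≈-trans id⊗⨾ (_ ⊗⟩ ≈-trans ⨾-assoc′ (dup-comm b c))) ⟩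
    (idₜ 1 ⊗ (dup b ⨾ (idₜ 1 ⊗ dup c))) ⨾ (σ 1 2 ⊗ idₜ m)
      ≈⟨ dup-suc-suc c b ⟨
    _ ∎

  swap₂-ε : (f : Term S m n) → swap₂ m ⨾ (ε ⊗ (idₜ 1 ⊗ f)) ≈ idₜ 1 ⊗ (ε ⊗ f)
  swap₂-ε {m} {n} f = begin
    swap₂ m ⨾ (ε ⊗ (idₜ 1 ⊗ f))   ≈⟨ _ ⨾⟩ ⊗-assoc ε (idₜ 1) f ⟨
    swap₂ m ⨾ ((ε ⊗ idₜ 1) ⊗ f)   ≈⟨ ⊗-interchange _ _ _ _ ⟨
    (σ 1 1 ⨾ (ε ⊗ idₜ 1)) ⊗ (idₜ m ⨾ f) ≈⟨ ⊗-cong σε (⨾-identityˡ f) ⟩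
    (idₜ 1 ⊗ ε) ⊗ f ≈⟨ ⊗-assoc (idₜ 1) ε f ⟩
    idₜ 1 ⊗ (ε ⊗ f) ∎
    where
    σε : σ 1 1 ⨾ (ε ⊗ idₜ 1) ≈ idₜ 1 ⊗ ε
    σε = begin
      σ 1 1 ⨾ (ε ⊗ idₜ 1) ≈⟨ σ-natural (idₜ 1) ε ⟨
      (idₜ 1 ⊗ ε) ⨾ σ 1 0 ≈⟨ _ ⨾⟩ σ-unit 1 ⟩
      (idₜ 1 ⊗ ε) ⨾ idₜ 1 ≈⟨ ⨾-identityʳ _ ⟩
      idₜ 1 ⊗ ε ∎

  dup-discard : (b : Fin m) → dup b ⨾ (ε ⊗ idₜ m) ≈ idₜ m
  dup-discard {suc m} zero = begin
    (δ ⊗ idₜ m) ⨾ (ε ⊗ idₜ (suc m))   ≈⟨ _ ⨾⟩ _ ⊗⟩ ⊗-id 1 m ⟨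
    (δ ⊗ idₜ m) ⨾ (ε ⊗ (idₜ 1 ⊗ idₜ m)) ≈⟨ _ ⨾⟩ ⊗-assoc ε (idₜ 1) (idₜ m) ⟨
    (δ ⊗ idₜ m) ⨾ ((ε ⊗ idₜ 1) ⊗ idₜ m) ≈⟨ ⊗id⨾ ⟩
    (δ ⨾ (ε ⊗ idₜ 1)) ⊗ idₜ m ≈⟨ δ-counitˡ ⟨⊗ _ ⟩
    idₜ 1 ⊗ idₜ m ≈⟨ ⊗-id 1 m ⟩
    idₜ (suc m) ∎
  dup-discard {suc m} (suc b) = begin
    ((idₜ 1 ⊗ dup b) ⨾ swap₂ m) ⨾ (ε ⊗ idₜ (suc m)) ≈⟨ ⨾-assoc′ ⟩
    _ ≈⟨ _ ⨾⟩ _ ⨾⟩ _ ⊗⟩ ⊗-id 1 m ⟨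
    (idₜ 1 ⊗ dup b) ⨾ swap₂ m ⨾ (ε ⊗ (idₜ 1 ⊗ idₜ m)) ≈⟨ _ ⨾⟩ swap₂-ε (idₜ m) ⟩
    (idₜ 1 ⊗ dup b) ⨾ (idₜ 1 ⊗ (ε ⊗ idₜ m)) ≈⟨ id⊗⨾ ⟩
    idₜ 1 ⊗ (dup b ⨾ (ε ⊗ idₜ m)) ≈⟨ _ ⊗⟩ dup-discard b ⟩
    idₜ 1 ⊗ idₜ m ≈⟨ ⊗-id 1 m ⟩
    idₜ (suc m) ∎

  opaque
    -- Contravariant: output b is a copy of input φ b.
    fan : (Fin n → Fin m) → Term S m n
    fan {zero}  φ = discard _
    fan {suc n} φ = dup (φ zero) ⨾ (idₜ 1 ⊗ fan (φ ∘ suc))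

    fan-cong : {φ ψ : Fin n → Fin m} → φ ≗ ψ → fan φ ≈ fan ψ
    fan-cong {zero}  eq = ≈-refl
    fan-cong {suc n} eq = ⨾-cong (≡⇒≈ (cong dup (eq zero))) (_ ⊗⟩ fan-cong (eq ∘ suc))

    fan-suc : (φ : Fin n → Fin m) → fan (suc ∘ φ) ≈ ε ⊗ fan φ
    fan-suc {zero}  φ = ≈-refl
    fan-suc {suc n} {m} φ = begin
      ((idₜ 1 ⊗ dup (φ zero)) ⨾ swap₂ m) ⨾ (idₜ 1 ⊗ fan (suc ∘ φ ∘ suc))
        ≈⟨ _ ⨾⟩ _ ⊗⟩ fan-suc (φ ∘ suc) ⟩
      ((idₜ 1 ⊗ dup (φ zero)) ⨾ swap₂ m) ⨾ (idₜ 1 ⊗ (ε ⊗ fan (φ ∘ suc)))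
        ≈⟨ _ ⨾⟩ swap₂-ε _ ⟨
      ((idₜ 1 ⊗ dup (φ zero)) ⨾ swap₂ m) ⨾ swap₂ m ⨾ (ε ⊗ (idₜ 1 ⊗ fan (φ ∘ suc)))
        ≈⟨ ⨾-assoc′ ⟩
      _ ≈⟨ _ ⨾⟩ cancelˡ (swap₂-involutive m) ⟩
      (idₜ 1 ⊗ dup (φ zero)) ⨾ (ε ⊗ (idₜ 1 ⊗ fan (φ ∘ suc)))
        ≈⟨ ⊗-interchange _ _ _ _ ⟨
      (idₜ 1 ⨾ ε) ⊗ (dup (φ zero) ⨾ (idₜ 1 ⊗ fan (φ ∘ suc)))
        ≈⟨ ⨾-identityˡ _ ⟨⊗ _ ⟩
      _ ∎

    fan-id : fan {n} id ≈ idₜ n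
    fan-id {zero}  = ≈-refl
    fan-id {suc n} = begin
      (δ ⊗ idₜ n) ⨾ (idₜ 1 ⊗ fan suc)       ≈⟨ _ ⨾⟩ _ ⊗⟩ ≈-trans (fan-suc id) (_ ⊗⟩ fan-id) ⟩
      (δ ⊗ idₜ n) ⨾ (idₜ 1 ⊗ (ε ⊗ idₜ n))   ≈⟨ _ ⨾⟩ ⊗-assoc (idₜ 1) ε (idₜ n) ⟨
      (δ ⊗ idₜ n) ⨾ ((idₜ 1 ⊗ ε) ⊗ idₜ n)   ≈⟨ ⊗id⨾ ⟩
      (δ ⨾ (idₜ 1 ⊗ ε)) ⊗ idₜ n             ≈⟨ δ-counitʳ ⟨⊗ _ ⟩
      idₜ 1 ⊗ idₜ n                         ≈⟨ ⊗-id 1 n ⟩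
      idₜ (suc n) ∎

    fan-dup : (φ : Fin n → Fin m) (a : Fin n) → fan φ ⨾ dup a ≈ dup (φ a) ⨾ (idₜ 1 ⊗ fan φ)
    fan-dup {suc n} {m} φ zero = begin
      (dup (φ zero) ⨾ (idₜ 1 ⊗ fan (φ ∘ suc))) ⨾ (δ ⊗ idₜ n) ≈⟨ ⨾-assoc′ ⟩
      _ ≈⟨ _ ⨾⟩ exchange ⟨
      dup (φ zero) ⨾ (δ ⊗ idₜ m) ⨾ (idₜ 2 ⊗ fan (φ ∘ suc)) ≈⟨ extend (dup-coassoc (φ zero)) ⟩
      _ ≈⟨ _ ⨾⟩ _ ⨾⟩ id₁⊗id₁⊗ _ ⟨
      dup (φ zero) ⨾ (idₜ 1 ⊗ dup (φ zero)) ⨾ (idₜ 1 ⊗ (idₜ 1 ⊗ fan (φ ∘ suc))) ≈⟨ _ ⨾⟩ id⊗⨾ ⟩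
      _ ∎
    fan-dup {suc n} {m} φ (suc a) = begin
      (dup (φ zero) ⨾ (idₜ 1 ⊗ fan (φ ∘ suc))) ⨾ (idₜ 1 ⊗ dup a) ⨾ swap₂ n ≈⟨ ⨾-assoc′ ⟩
      _ ≈⟨ _ ⨾⟩ pullˡ (≈-trans id⊗⨾ (≈-trans (_ ⊗⟩ fan-dup (φ ∘ suc) a) (≈-sym id⊗⨾))) ⟩
      dup (φ zero) ⨾ ((idₜ 1 ⊗ dup (φ (suc a))) ⨾ (idₜ 1 ⊗ (idₜ 1 ⊗ fan (φ ∘ suc)))) ⨾ swap₂ n
        ≈⟨ _ ⨾⟩ ≈-trans ⨾-assoc′ (_ ⨾⟩ ≈-sym (swap₂-natural _)) ⟩
      dup (φ zero) ⨾ (idₜ 1 ⊗ dup (φ (suc a))) ⨾ swap₂ m ⨾ (idₜ 1 ⊗ (idₜ 1 ⊗ fan (φ ∘ suc)))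
        ≈⟨ _ ⨾⟩ ⨾-assoc′ ⟨
      _ ≈⟨ extend (dup-comm (φ (suc a)) (φ zero)) ⟩
      dup (φ (suc a)) ⨾ (idₜ 1 ⊗ dup (φ zero)) ⨾ (idₜ 1 ⊗ (idₜ 1 ⊗ fan (φ ∘ suc))) ≈⟨ _ ⨾⟩ id⊗⨾ ⟩
      _ ∎

    fan-discard : (φ : Fin n → Fin m) → fan φ ⨾ discard n ≈ discard m
    fan-discard {zero}  φ = ⨾-identityʳ _
    fan-discard {suc n} {m} φ = begin
      (dup (φ zero) ⨾ (idₜ 1 ⊗ fan (φ ∘ suc))) ⨾ (ε ⊗ discard n) ≈⟨ ⨾-assoc′ ⟩
      _ ≈⟨ _ ⨾⟩ ≈-trans (≈-sym (⊗-interchange _ _ _ _)) (⊗-cong (⨾-identityˡ _) (fan-discard (φ ∘ suc))) ⟩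
      dup (φ zero) ⨾ (ε ⊗ discard m) ≈⟨ _ ⨾⟩ exchangeˡ ⟨
      dup (φ zero) ⨾ (ε ⊗ idₜ m) ⨾ (idₜ 0 ⊗ discard m) ≈⟨ cancelˡ (dup-discard (φ zero)) ⟩
      idₜ 0 ⊗ discard m ≈⟨ ⊗-identityˡ _ ⟩
      _ ∎

    fan-⨾ : (φ : Fin n → Fin m) (ψ : Fin p → Fin n) → fan φ ⨾ fan ψ ≈ fan (φ ∘ ψ)
    fan-⨾ {p = zero}  φ ψ = fan-discard φ
    fan-⨾ {p = suc p} φ ψ = begin
      fan φ ⨾ dup (ψ zero) ⨾ (idₜ 1 ⊗ fan (ψ ∘ suc)) ≈⟨ extend (fan-dup φ (ψ zero)) ⟩
      dup (φ (ψ zero)) ⨾ (idₜ 1 ⊗ fan φ) ⨾ (idₜ 1 ⊗ fan (ψ ∘ suc)) ≈⟨ _ ⨾⟩ ≈-trans id⊗⨾ (_ ⊗⟩ fan-⨾ φ (ψ ∘ suc)) ⟩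
      _ ∎

    fan-zero : (φ : Fin 0 → Fin m) → fan φ ≈ discard m
    fan-zero φ = ≈-refl

    fan-step : (φ : Fin (suc n) → Fin m) → fan φ ≈ dup (φ zero) ⨾ (idₜ 1 ⊗ fan (φ ∘ suc))
    fan-step φ = ≈-refl

  dup-fan : (a : Fin m) → dup a ≈ fan (λ { zero → a ; (suc b) → b })
  dup-fan a = ≈-sym (≈-trans (fan-step _) (≈-trans (_ ⨾⟩ ≈-trans (_ ⊗⟩ fan-id) (⊗-id 1 _)) (⨾-identityʳ _)))

infixr 5 _++_

_++_ : (Fin m → A) → (Fin n → A) → Fin (m + n) → A
(f ++ g) i = [ f , g ]′ (splitAt _ i)

++-↑ˡ : (f : Fin m → A) (g : Fin n → A) (i : Fin m) → (f ++ g) (i ↑ˡ n) ≡ f i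
++-↑ˡ f g i = cong [ f , g ]′ (splitAt-↑ˡ _ i _)

++-↑ʳ : (f : Fin m → A) (g : Fin n → A) (i : Fin n) → (f ++ g) (m ↑ʳ i) ≡ g i
++-↑ʳ f g i = cong [ f , g ]′ (splitAt-↑ʳ _ _ i)

split-∀ : ∀ m {n} {P : Fin (m + n) → Set} → (∀ i → P (i ↑ˡ n)) → (∀ i → P (m ↑ʳ i)) → ∀ i → P i
split-∀ m {n} {P} l r i = go (splitAt m i) (join-splitAt m n i)
  where
  go : (s : Fin m ⊎ Fin n) → Fin.join m n s ≡ i → P i
  go (inj₁ i) refl = l i
  go (inj₂ i) refl = r i

++-unique : {f : Fin m → A} {g : Fin n → A} {h : Fin (m + n) → A} →
            (∀ i → f i ≡ h (i ↑ˡ n)) → (∀ i → g i ≡ h (m ↑ʳ i)) → f ++ g ≗ h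
++-unique {f = f} {g} l r =
  split-∀ _ (λ i → trans (++-↑ˡ f g i) (l i)) (λ i → trans (++-↑ʳ f g i) (r i))

++-cong : {f f′ : Fin m → A} {g g′ : Fin n → A} → f ≗ f′ → g ≗ g′ → f ++ g ≗ f′ ++ g′
++-cong {f′ = f′} {g′ = g′} eq eq′ =
  ++-unique (λ i → trans (eq i) (sym (++-↑ˡ f′ g′ i))) (λ i → trans (eq′ i) (sym (++-↑ʳ f′ g′ i)))

++-∘ : (h : A → B) (f : Fin m → A) (g : Fin n → A) → (h ∘ f) ++ (h ∘ g) ≗ h ∘ (f ++ g)
++-∘ h f g = ++-unique (λ i → cong h (sym (++-↑ˡ f g i))) (λ i → cong h (sym (++-↑ʳ f g i)))

++-η : ∀ {m n} (h : Fin (m + n) → A) → (h ∘ (_↑ˡ n)) ++ (h ∘ (m ↑ʳ_)) ≗ h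
++-η {m = m} {n = n} h = ++-unique {f = h ∘ (_↑ˡ n)} {g = h ∘ (m ↑ʳ_)} (λ _ → refl) (λ _ → refl)

assoc-↑ˡ↑ˡ : ∀ n p (i : Fin m) → Fin.cast (+-assoc m n p) ((i ↑ˡ n) ↑ˡ p) ≡ i ↑ˡ (n + p)
assoc-↑ˡ↑ˡ n p i = toℕ-injective
  (trans (toℕ-cast _ _) (trans (toℕ-↑ˡ (i ↑ˡ n) p) (trans (toℕ-↑ˡ i n) (sym (toℕ-↑ˡ i (n + p))))))

assoc-↑ʳ↑ˡ : ∀ m p (i : Fin n) → Fin.cast (+-assoc m n p) ((m ↑ʳ i) ↑ˡ p) ≡ m ↑ʳ (i ↑ˡ p)
assoc-↑ʳ↑ˡ m p i = toℕ-injective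
  (trans (toℕ-cast _ _) (trans (toℕ-↑ˡ (m ↑ʳ i) p) (trans (toℕ-↑ʳ m i)
    (sym (trans (toℕ-↑ʳ m (i ↑ˡ p)) (cong (m +_) (toℕ-↑ˡ i p)))))))

assoc-↑ʳ : ∀ m n (i : Fin p) → Fin.cast (+-assoc m n p) ((m + n) ↑ʳ i) ≡ m ↑ʳ (n ↑ʳ i)
assoc-↑ʳ m n i = toℕ-injective
  (trans (toℕ-cast _ _) (trans (toℕ-↑ʳ (m + n) i) (trans (+-assoc m n (toℕ i))
    (sym (trans (toℕ-↑ʳ m (n ↑ʳ i)) (cong (m +_) (toℕ-↑ʳ n i)))))))

cast-flip : (eq : m ≡ n) {i : Fin m} {j : Fin n} → Fin.cast eq i ≡ j → i ≡ Fin.cast (sym eq) j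
cast-flip eq refl = sym (cast-involutive (sym eq) eq _)

infixr 7 _⊞_

_⊞_ : (Fin n → Fin m) → (Fin q → Fin p) → Fin (n + q) → Fin (m + p)
_⊞_ {m = m} {p = p} φ ψ = (_↑ˡ p) ∘ φ ++ (m ↑ʳ_) ∘ ψ

⊞-id : id {A = Fin m} ⊞ id {A = Fin n} ≗ id
⊞-id {m} {n} = ++-η {m = m} {n} id

⊞-inverse : (φ : Fin n → Fin m) (φ′ : Fin m → Fin n) (ψ : Fin q → Fin p) (ψ′ : Fin p → Fin q) →
            φ ∘ φ′ ≗ id → ψ ∘ ψ′ ≗ id → (φ ⊞ ψ) ∘ (φ′ ⊞ ψ′) ≗ id
⊞-inverse {n} {m} {q} {p} φ φ′ ψ ψ′ eq eq′ = split-∀ m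
  (λ i → trans (cong (φ ⊞ ψ) (++-↑ˡ _ _ i)) (trans (++-↑ˡ _ _ (φ′ i)) (cong (_↑ˡ p) (eq i))))
  (λ i → trans (cong (φ ⊞ ψ) (++-↑ʳ {m = m} _ _ i)) (trans (++-↑ʳ {m = n} _ _ (ψ′ i)) (cong (m ↑ʳ_) (eq′ i))))

swap : ∀ m n → Fin (n + m) → Fin (m + n)
swap m n = (m ↑ʳ_) ++ (_↑ˡ n)

swap-swap : ∀ m n → swap m n ∘ swap n m ≗ id
swap-swap m n = split-∀ m
  (λ i → trans (cong (swap m n) (++-↑ˡ (n ↑ʳ_) (_↑ˡ m) i)) (++-↑ʳ (m ↑ʳ_) (_↑ˡ n) i))
  (λ i → trans (cong (swap m n) (++-↑ʳ (n ↑ʳ_) (_↑ˡ m) i)) (++-↑ˡ (m ↑ʳ_) (_↑ˡ n) i))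

swapˡ : ∀ x y m → Fin (x + (y + m)) → Fin (y + (x + m))
swapˡ x y m = (λ i → y ↑ʳ (i ↑ˡ m)) ++ ((_↑ˡ (x + m)) ++ (λ i → y ↑ʳ (x ↑ʳ i)))

module _ (x y m : ℕ) where

  swapˡ₁ : ∀ i → swapˡ x y m (i ↑ˡ (y + m)) ≡ y ↑ʳ (i ↑ˡ m)
  swapˡ₁ i = ++-↑ˡ _ _ i

  swapˡ₂ : ∀ i → swapˡ x y m (x ↑ʳ (i ↑ˡ m)) ≡ i ↑ˡ (x + m)
  swapˡ₂ i = trans (++-↑ʳ {m = x} _ _ (i ↑ˡ m)) (++-↑ˡ _ _ i)

  swapˡ₃ : ∀ i → swapˡ x y m (x ↑ʳ (y ↑ʳ i)) ≡ y ↑ʳ (x ↑ʳ i)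
  swapˡ₃ i = trans (++-↑ʳ {m = x} _ _ (y ↑ʳ i)) (++-↑ʳ {m = y} _ _ i)

split₃-∀ : ∀ x y {m} {P : Fin (x + (y + m)) → Set} →
           (∀ i → P (i ↑ˡ (y + m))) → (∀ i → P (x ↑ʳ (i ↑ˡ m))) → (∀ i → P (x ↑ʳ (y ↑ʳ i))) → ∀ i → P i
split₃-∀ x y p q r = split-∀ x p (split-∀ y q r)

swapˡ-swapˡ : ∀ x y m → swapˡ y x m ∘ swapˡ x y m ≗ id
swapˡ-swapˡ x y m = split₃-∀ x y
  (λ i → trans (cong (swapˡ y x m) (swapˡ₁ x y m i)) (swapˡ₂ y x m i))
  (λ i → trans (cong (swapˡ y x m) (swapˡ₂ x y m i)) (swapˡ₁ y x m i))
  (λ i → trans (cong (swapˡ y x m) (swapˡ₃ x y m i)) (swapˡ₃ y x m i))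

hexagon : ∀ m n p → swap m (n + p) ≗
          (Fin.cast (+-assoc m n p) ∘ (swap m n ⊞ id {A = Fin p}) ∘ Fin.cast (sym (+-assoc n m p))) ∘
          (Fin.cast refl ∘ (id {A = Fin n} ⊞ swap m p) ∘ Fin.cast (sym (sym (+-assoc n p m))))
hexagon m n p = λ i → sym (trans (cong θ (at i)) (on (Fin.cast (+-assoc n p m) i) i (cast-flip (+-assoc n p m) refl)))
  where
  θ : Fin (n + (m + p)) → Fin (m + (n + p))
  θ = Fin.cast (+-assoc m n p) ∘ (swap m n ⊞ id {A = Fin p}) ∘ Fin.cast (sym (+-assoc n m p))

  at : ∀ i → Fin.cast refl ((id {A = Fin n} ⊞ swap m p) (Fin.cast (sym (sym (+-assoc n p m))) i)) ≡
             (id {A = Fin n} ⊞ swap m p) (Fin.cast (+-assoc n p m) i)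
  at i = cast-is-id refl _

  Goal : Fin (n + (p + m)) → Set
  Goal j = ∀ i → i ≡ Fin.cast (sym (+-assoc n p m)) j → θ ((id {A = Fin n} ⊞ swap m p) j) ≡ swap m (n + p) i

  on : ∀ j → Goal j
  on = split₃-∀ n p
    (λ a i eq → trans (cong θ (++-↑ˡ _ _ a))
      (trans (cong (Fin.cast (+-assoc m n p) ∘ (swap m n ⊞ id {A = Fin p})) (sym (cast-flip (+-assoc n m p) (assoc-↑ˡ↑ˡ m p a))))
      (trans (cong (Fin.cast (+-assoc m n p)) (trans (++-↑ˡ _ _ (a ↑ˡ m)) (cong (_↑ˡ p) (++-↑ˡ (m ↑ʳ_) (_↑ˡ n) a))))
      (trans (assoc-↑ʳ↑ˡ m p a)
      (sym (trans (cong (swap m (n + p)) (trans eq (sym (cast-flip (+-assoc n p m) (assoc-↑ˡ↑ˡ p m a)))))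
                  (++-↑ˡ (m ↑ʳ_) (_↑ˡ (n + p)) (a ↑ˡ p))))))))
    (λ b i eq → trans (cong θ (trans (++-↑ʳ {m = n} _ _ (b ↑ˡ m)) (cong (n ↑ʳ_) (++-↑ˡ (m ↑ʳ_) (_↑ˡ p) b))))
      (trans (cong (Fin.cast (+-assoc m n p) ∘ (swap m n ⊞ id {A = Fin p})) (sym (cast-flip (+-assoc n m p) (assoc-↑ʳ n m b))))
      (trans (cong (Fin.cast (+-assoc m n p)) (++-↑ʳ {m = n + m} _ _ b))
      (trans (assoc-↑ʳ m n b)
      (sym (trans (cong (swap m (n + p)) (trans eq (sym (cast-flip (+-assoc n p m) (assoc-↑ʳ↑ˡ n m b)))))
                  (++-↑ˡ (m ↑ʳ_) (_↑ˡ (n + p)) (n ↑ʳ b))))))))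
    (λ c i eq → trans (cong θ (trans (++-↑ʳ {m = n} _ _ (p ↑ʳ c)) (cong (n ↑ʳ_) (++-↑ʳ (m ↑ʳ_) (_↑ˡ p) c))))
      (trans (cong (Fin.cast (+-assoc m n p) ∘ (swap m n ⊞ id {A = Fin p})) (sym (cast-flip (+-assoc n m p) (assoc-↑ʳ↑ˡ n p c))))
      (trans (cong (Fin.cast (+-assoc m n p)) (trans (++-↑ˡ _ _ (n ↑ʳ c)) (cong (_↑ˡ p) (++-↑ʳ (m ↑ʳ_) (_↑ˡ n) c))))
      (trans (assoc-↑ˡ↑ˡ n p c)
      (sym (trans (cong (swap m (n + p)) (trans eq (sym (cast-flip (+-assoc n p m) (assoc-↑ʳ n p c)))))
                  (++-↑ʳ (m ↑ʳ_) (_↑ˡ (n + p)) c)))))))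

module _ {S : Signature} where
  open ≈-Reasoning {S}

  private
    discard⊗fan : (ψ : Fin q → Fin p) → discard {S} m ⊗ fan ψ ≈ fan ((m ↑ʳ_) ∘ ψ)
    discard⊗fan {m = zero}  ψ = ⊗-identityˡ _
    discard⊗fan {m = suc m} ψ = begin
      (ε ⊗ discard m) ⊗ fan ψ   ≈⟨ ⊗-assoc ε (discard m) (fan ψ) ⟩
      ε ⊗ (discard m ⊗ fan ψ)   ≈⟨ _ ⊗⟩ discard⊗fan ψ ⟩
      ε ⊗ fan ((m ↑ʳ_) ∘ ψ)     ≈⟨ fan-suc _ ⟨
      _ ∎

    dup⊗id : (a : Fin m) → dup {S} a ⊗ idₜ p ≈ dup (a ↑ˡ p)
    dup⊗id {suc m} {p} zero = ≈-trans (⊗-assoc δ (idₜ m) (idₜ p)) (_ ⊗⟩ ⊗-id m p)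
    dup⊗id {suc m} {p} (suc a) = begin
      ((idₜ 1 ⊗ dup a) ⨾ swap₂ m) ⊗ idₜ p ≈⟨ ⊗id⨾ ⟨
      ((idₜ 1 ⊗ dup a) ⊗ idₜ p) ⨾ (swap₂ m ⊗ idₜ p)
        ≈⟨ ⨾-cong (≈-trans (⊗-assoc (idₜ 1) (dup a) (idₜ p)) (_ ⊗⟩ dup⊗id a))
                  (≈-trans (⊗-assoc (σ 1 1) (idₜ m) (idₜ p)) (_ ⊗⟩ ⊗-id m p)) ⟩
      _ ∎

  fan-⊗ : (φ : Fin n → Fin m) (ψ : Fin q → Fin p) → fan {S} φ ⊗ fan ψ ≈ fan (φ ⊞ ψ)
  fan-⊗ {zero} φ ψ = ≈-trans (fan-zero φ ⟨⊗ _) (≈-trans (discard⊗fan ψ) (fan-cong λ _ → refl))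
  fan-⊗ {suc n} {m} {q} {p} φ ψ = begin
    fan φ ⊗ fan ψ ≈⟨ ⊗-cong (fan-step φ) (≈-sym (⨾-identityˡ _)) ⟩
    _ ≈⟨ ⊗-interchange _ _ _ _ ⟩
    (dup (φ zero) ⊗ idₜ p) ⨾ ((idₜ 1 ⊗ fan (φ ∘ suc)) ⊗ fan ψ)
      ≈⟨ ⨾-cong (dup⊗id (φ zero)) (≈-trans (⊗-assoc (idₜ 1) (fan (φ ∘ suc)) (fan ψ)) (_ ⊗⟩ fan-⊗ (φ ∘ suc) ψ)) ⟩
    dup (φ zero ↑ˡ p) ⨾ (idₜ 1 ⊗ fan ((φ ∘ suc) ⊞ ψ))
      ≈⟨ _ ⨾⟩ _ ⊗⟩ fan-cong {φ = (φ ∘ suc) ⊞ ψ} {ψ = (φ ⊞ ψ) ∘ suc} (++-unique (λ i → sym (++-↑ˡ _ _ (suc i))) (λ i → sym (++-↑ʳ {m = suc n} _ _ i))) ⟩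
    _ ≈⟨ fan-step (φ ⊞ ψ) ⟨
    _ ∎

  id⊗fan : (ψ : Fin q → Fin p) → idₜ {S} x ⊗ fan ψ ≈ fan (id {A = Fin x} ⊞ ψ)
  id⊗fan ψ = ≈-trans (≈-sym fan-id ⟨⊗ _) (fan-⊗ id ψ)

  fan⊗id : (φ : Fin q → Fin p) → fan {S} φ ⊗ idₜ x ≈ fan (φ ⊞ id {A = Fin x})
  fan⊗id φ = ≈-trans (_ ⊗⟩ ≈-sym fan-id) (fan-⊗ φ id)

  fan-inverse : {φ : Fin n → Fin m} {ψ : Fin m → Fin n} → φ ∘ ψ ≗ id → fan {S} φ ⨾ fan ψ ≈ idₜ m
  fan-inverse eq = ≈-trans (fan-⨾ _ _) (≈-trans (fan-cong eq) fan-id)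

  cast-fan : (eq : m ≡ m′) (eq′ : n ≡ n′) (f : Term S m n) →
             cast eq eq′ f ≈ fan (Fin.cast eq) ⨾ f ⨾ fan (Fin.cast (sym eq′))
  cast-fan refl refl f = ≈-sym (≈-trans
    (⨾-cong (≈-trans (fan-cong (cast-is-id refl)) fan-id)
            (≈-trans (_ ⨾⟩ ≈-trans (fan-cong (cast-is-id refl)) fan-id) (⨾-identityʳ f)))
    (⨾-identityˡ f))

  cast-cong : (eq : m ≡ m′) (eq′ : n ≡ n′) {f g : Term S m n} → f ≈ g → cast eq eq′ f ≈ cast eq eq′ g
  cast-cong refl refl f≈g = f≈g

  cast-sym : (eq : m ≡ m′) (eq′ : n ≡ n′) {f : Term S m n} {g : Term S m′ n′} →
             cast eq eq′ f ≈ g → f ≈ cast (sym eq) (sym eq′) g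
  cast-sym refl refl f≈g = f≈g

  cast-≈-fan : (eq : m ≡ m′) (eq′ : n ≡ n′) (φ : Fin n → Fin m) →
               cast {S = S} eq eq′ (fan φ) ≈ fan (Fin.cast eq ∘ φ ∘ Fin.cast (sym eq′))
  cast-≈-fan eq eq′ φ = ≈-trans (cast-fan eq eq′ (fan φ)) (≈-trans (_ ⨾⟩ fan-⨾ _ _) (fan-⨾ _ _))

  private
    fan-head : fan {S} {1} {suc m} (λ _ → zero) ≈ idₜ 1 ⊗ discard m
    fan-head {m} = begin
      _ ≈⟨ fan-cong (λ { zero → refl }) ⟩
      fan {n = 1} (id {A = Fin 1} ⊞ λ ()) ≈⟨ id⊗fan _ ⟨
      idₜ 1 ⊗ fan {n = 0} {m} (λ ()) ≈⟨ _ ⊗⟩ fan-zero _ ⟩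
      idₜ 1 ⊗ discard m ∎

    σ₁₁-fan : σ {S} 1 1 ≈ fan (swap 1 1)
    σ₁₁-fan = ≈-sym (begin
      fan (swap 1 1) ≈⟨ fan-step _ ⟩
      ((idₜ 1 ⊗ dup zero) ⨾ swap₂ 1) ⨾ (idₜ 1 ⊗ fan {n = 1} (swap 1 1 ∘ suc)) ≈⟨ ⨾-assoc′ ⟩
      _ ≈⟨ _ ⨾⟩ _ ⨾⟩ _ ⊗⟩ ≈-trans (fan-cong (λ { zero → refl })) fan-head ⟩
      (idₜ 1 ⊗ dup zero) ⨾ swap₂ 1 ⨾ (idₜ 1 ⊗ (idₜ 1 ⊗ discard 1)) ≈⟨ _ ⨾⟩ swap₂-natural _ ⟩
      (idₜ 1 ⊗ dup zero) ⨾ (idₜ 1 ⊗ (idₜ 1 ⊗ discard 1)) ⨾ swap₂ 0 ≈⟨ pullˡ id⊗⨾ ⟩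
      (idₜ 1 ⊗ (dup zero ⨾ (idₜ 1 ⊗ discard 1))) ⨾ swap₂ 0 ≈⟨ (_ ⊗⟩ copy-discard) ⟨⨾ _ ⟩
      (idₜ 1 ⊗ idₜ 1) ⨾ swap₂ 0 ≈⟨ ⊗-id 1 1 ⟨⨾ _ ⟩
      idₜ 2 ⨾ swap₂ 0 ≈⟨ ⨾-identityˡ _ ⟩
      σ 1 1 ⊗ idₜ 0 ≈⟨ ⊗-identityʳ (σ 1 1) ⟩
      σ 1 1 ∎)
      where
      copy-discard : dup zero ⨾ (idₜ 1 ⊗ discard 1) ≈ idₜ {S} 1
      copy-discard = begin
        dup zero ⨾ (idₜ 1 ⊗ discard 1) ≈⟨ _ ⨾⟩ _ ⊗⟩ fan-zero (λ ()) ⟨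
        dup zero ⨾ (idₜ 1 ⊗ fan (λ ())) ≈⟨ _ ⨾⟩ _ ⊗⟩ fan-cong (λ ()) ⟩
        dup zero ⨾ (idₜ 1 ⊗ fan (id ∘ suc)) ≈⟨ fan-step id ⟨
        fan id ≈⟨ fan-id ⟩
        idₜ 1 ∎

    σ-fan-+ : ∀ m n p → σ {S} m n ≈ fan (swap m n) → σ {S} m p ≈ fan (swap m p) →
              σ {S} m (n + p) ≈ fan (swap m (n + p))
    σ-fan-+ m n p eqₙ eqₚ = begin
      σ m (n + p) ≈⟨ σ-hexagon m n p ⟩
      _ ≈⟨ ⨾-cong
             (≈-trans (cast-cong (+-assoc m n p) (+-assoc n m p) (≈-trans (eqₙ ⟨⊗ _) (fan⊗id _)))
                      (cast-≈-fan (+-assoc m n p) (+-assoc n m p) _))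
             (≈-trans (cast-cong refl (sym (+-assoc n p m)) (≈-trans (_ ⊗⟩ eqₚ) (id⊗fan _)))
                      (cast-≈-fan refl (sym (+-assoc n p m)) _)) ⟩
      _ ≈⟨ fan-⨾ _ _ ⟩
      _ ≈⟨ fan-cong (λ i → sym (hexagon m n p i)) ⟩
      fan (swap m (n + p)) ∎

    σ-fan-zero : ∀ m → σ {S} m 0 ≈ fan (swap m 0)
    σ-fan-zero m = begin
      σ m 0 ≈⟨ cast-sym (+-identityʳ m) refl (≈-trans (σ-unit m) (≈-sym fan-id)) ⟩
      _ ≈⟨ cast-≈-fan _ refl id ⟩
      _ ≈⟨ fan-cong (λ i → toℕ-injective (trans (toℕ-cast (sym (+-identityʳ m)) (Fin.cast refl i))
                       (trans (cong toℕ (cast-is-id refl i)) (sym (toℕ-↑ˡ i 0))))) ⟩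
      fan (swap m 0) ∎

    σ₁-fan : ∀ m → σ {S} 1 m ≈ fan (swap 1 m)
    σ₁-fan zero    = σ-fan-zero 1
    σ₁-fan (suc m) = σ-fan-+ 1 1 m σ₁₁-fan (σ₁-fan m)

    σ-fan₁ : ∀ m → σ {S} m 1 ≈ fan (swap m 1)
    σ-fan₁ m = begin
      σ m 1 ≈⟨ ⨾-identityʳ _ ⟨
      σ m 1 ⨾ idₜ _ ≈⟨ _ ⨾⟩ fan-inverse (swap-swap 1 m) ⟨
      σ m 1 ⨾ fan (swap 1 m) ⨾ fan (swap m 1) ≈⟨ _ ⨾⟩ (σ₁-fan m ⟨⨾ _) ⟨
      σ m 1 ⨾ σ 1 m ⨾ fan (swap m 1) ≈⟨ cancelˡ (σ-involutive m 1) ⟩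
      _ ∎

  σ-fan : ∀ m n → σ {S} m n ≈ fan (swap m n)
  σ-fan m zero    = σ-fan-zero m
  σ-fan m (suc n) = σ-fan-+ m 1 n (σ-fan₁ m) (σ-fan m n)

-- Traces

swapˡ-cast : ∀ x y m → Fin.cast (+-assoc y x m) ∘ (swap y x ⊞ id {A = Fin m}) ∘ Fin.cast (sym (+-assoc x y m)) ≗ swapˡ x y m
swapˡ-cast x y m = split₃-∀ x y
  (λ i → trans (cong θ (sym (cast-flip (+-assoc x y m) (assoc-↑ˡ↑ˡ y m i))))
        (trans (cong (Fin.cast _) (trans (++-↑ˡ {m = x + y} _ _ (i ↑ˡ y)) (cong (_↑ˡ m) (++-↑ˡ _ _ i))))
        (trans (assoc-↑ʳ↑ˡ y m i) (sym (swapˡ₁ x y m i)))))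
  (λ i → trans (cong θ (sym (cast-flip (+-assoc x y m) (assoc-↑ʳ↑ˡ x m i))))
        (trans (cong (Fin.cast _) (trans (++-↑ˡ {m = x + y} _ _ (x ↑ʳ i)) (cong (_↑ˡ m) (++-↑ʳ {m = x} _ _ i))))
        (trans (assoc-↑ˡ↑ˡ x m i) (sym (swapˡ₂ x y m i)))))
  (λ i → trans (cong θ (sym (cast-flip (+-assoc x y m) (assoc-↑ʳ x y i))))
        (trans (cong (Fin.cast _) (++-↑ʳ {m = x + y} _ _ i))
        (trans (assoc-↑ʳ y x i) (sym (swapˡ₃ x y m i)))))
  where
  θ : Fin ((x + y) + m) → Fin (y + (x + m))
  θ = Fin.cast (+-assoc y x m) ∘ (swap y x ⊞ id {A = Fin m})

swapˡ-zeroʳ : ∀ x m → swapˡ x 0 m ≗ id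
swapˡ-zeroʳ x m = split-∀ x (λ i → ++-↑ˡ _ _ i) (λ i → ++-↑ʳ {m = x} _ _ i)

module _ {S : Signature} where
  open ≈-Reasoning {S}

  α : ∀ m n p → Term S (m + (n + p)) ((m + n) + p)
  α m n p = fan (Fin.cast (+-assoc m n p))

  α⁻¹ : ∀ m n p → Term S ((m + n) + p) (m + (n + p))
  α⁻¹ m n p = fan (Fin.cast (sym (+-assoc m n p)))

  α-inverseˡ : ∀ m n p → α⁻¹ m n p ⨾ α m n p ≈ idₜ _
  α-inverseˡ m n p = fan-inverse (cast-involutive (sym (+-assoc m n p)) (+-assoc m n p))

  ⊗-assoc-α : (f : Term S m n) (g : Term S p q) (h : Term S r s) →
              f ⊗ (g ⊗ h) ≈ α m p r ⨾ ((f ⊗ g) ⊗ h) ⨾ α⁻¹ n q s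
  ⊗-assoc-α f g h = ≈-trans (≈-sym (⊗-assoc f g h)) (cast-fan _ _ _)

  σ⊗id : ∀ x y m → σ {S} y x ⊗ idₜ m ≈ fan (swap y x ⊞ id {A = Fin m})
  σ⊗id x y m = ≈-trans (σ-fan y x ⟨⊗ _) (fan⊗id _)

  swapˡ-fan : ∀ x y m → fan {S} (swapˡ x y m) ≈ α y x m ⨾ (σ y x ⊗ idₜ m) ⨾ α⁻¹ x y m
  swapˡ-fan x y m = ≈-sym (≈-trans (_ ⨾⟩ ≈-trans (σ⊗id x y m ⟨⨾ _) (fan-⨾ _ _))
    (≈-trans (fan-⨾ _ _) (fan-cong (swapˡ-cast x y m))))

  swapˡ-inverse : ∀ x y m → fan {S} (swapˡ x y m) ⨾ fan (swapˡ y x m) ≈ idₜ (y + (x + m))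
  swapˡ-inverse x y m = fan-inverse (swapˡ-swapˡ y x m)

  swapˡ-natural : (f : Term S a a′) (g : Term S b b′) (h : Term S c c′) →
                  (g ⊗ (f ⊗ h)) ⨾ fan (swapˡ a′ b′ c′) ≈ fan (swapˡ a b c) ⨾ (f ⊗ (g ⊗ h))
  swapˡ-natural {a = a} {a′} {b} {b′} {c} {c′} f g h = begin
    (g ⊗ (f ⊗ h)) ⨾ fan (swapˡ a′ b′ c′)
      ≈⟨ ⨾-cong (⊗-assoc-α g f h) (swapˡ-fan a′ b′ c′) ⟩
    (α b a c ⨾ ((g ⊗ f) ⊗ h) ⨾ α⁻¹ b′ a′ c′) ⨾ α b′ a′ c′ ⨾ (σ b′ a′ ⊗ idₜ c′) ⨾ α⁻¹ a′ b′ c′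
      ≈⟨ ≈-trans ⨾-assoc′ (_ ⨾⟩ ≈-trans ⨾-assoc′ (_ ⨾⟩ cancelˡ (α-inverseˡ b′ a′ c′))) ⟩
    α b a c ⨾ ((g ⊗ f) ⊗ h) ⨾ (σ b′ a′ ⊗ idₜ c′) ⨾ α⁻¹ a′ b′ c′
      ≈⟨ _ ⨾⟩ extend middle ⟩
    α b a c ⨾ (σ b a ⊗ idₜ c) ⨾ ((f ⊗ g) ⊗ h) ⨾ α⁻¹ a′ b′ c′
      ≈⟨ _ ⨾⟩ _ ⨾⟩ cancelˡ (α-inverseˡ a b c) ⟨
    α b a c ⨾ (σ b a ⊗ idₜ c) ⨾ α⁻¹ a b c ⨾ α a b c ⨾ ((f ⊗ g) ⊗ h) ⨾ α⁻¹ a′ b′ c′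
      ≈⟨ ≈-trans ⨾-assoc′ (_ ⨾⟩ ⨾-assoc′) ⟨
    (α b a c ⨾ (σ b a ⊗ idₜ c) ⨾ α⁻¹ a b c) ⨾ α a b c ⨾ ((f ⊗ g) ⊗ h) ⨾ α⁻¹ a′ b′ c′
      ≈⟨ ⨾-cong (swapˡ-fan a b c) (⊗-assoc-α f g h) ⟨
    fan (swapˡ a b c) ⨾ (f ⊗ (g ⊗ h)) ∎
    where
    middle : ((g ⊗ f) ⊗ h) ⨾ (σ b′ a′ ⊗ idₜ c′) ≈ (σ b a ⊗ idₜ c) ⨾ ((f ⊗ g) ⊗ h)
    middle = begin
      _ ≈⟨ ⊗-interchange _ _ _ _ ⟨
      _ ≈⟨ ⊗-cong (σ-natural g f) (≈-trans (⨾-identityʳ h) (≈-sym (⨾-identityˡ h))) ⟩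
      _ ≈⟨ ⊗-interchange _ _ _ _ ⟩
      _ ∎

  Tr-pre : (f : Term S m n) (g : Term S (x + n) (x + p)) → Tr x ((idₜ x ⊗ f) ⨾ g) ≈ f ⨾ Tr x g
  Tr-pre {x = x} {p = p} f g = begin
    Tr x ((idₜ x ⊗ f) ⨾ g) ≈⟨ Tr-cong (_ ⨾⟩ ≈-trans (_ ⨾⟩ ⊗-id x p) (⨾-identityʳ g)) ⟨
    Tr x ((idₜ x ⊗ f) ⨾ g ⨾ (idₜ x ⊗ idₜ p)) ≈⟨ Tr-tightening f g (idₜ p) ⟩
    f ⨾ Tr x g ⨾ idₜ p ≈⟨ _ ⨾⟩ ⨾-identityʳ _ ⟩
    f ⨾ Tr x g ∎

  Tr-post : (g : Term S (x + n) (x + p)) (h : Term S p q) → Tr x (g ⨾ (idₜ x ⊗ h)) ≈ Tr x g ⨾ h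
  Tr-post {x = x} {n} g h = begin
    Tr x (g ⨾ (idₜ x ⊗ h)) ≈⟨ Tr-cong (≈-trans (⊗-id x n ⟨⨾ _) (⨾-identityˡ _)) ⟨
    Tr x ((idₜ x ⊗ idₜ n) ⨾ g ⨾ (idₜ x ⊗ h)) ≈⟨ Tr-tightening (idₜ n) g h ⟩
    idₜ n ⨾ Tr x g ⨾ h ≈⟨ ⨾-identityˡ _ ⟩
    Tr x g ⨾ h ∎

  Tr-Tr : ∀ x y (f : Term S (x + (y + m)) (x + (y + n))) →
          Tr y (Tr x f) ≈ Tr (x + y) (α⁻¹ x y m ⨾ f ⨾ α x y n)
  Tr-Tr {m} {n} x y f = begin
    Tr y (Tr x f)
      ≈⟨ Tr-cong (Tr-cong (cast-sym (sym (+-assoc x y m)) (sym (+-assoc x y n)) ≈-refl)) ⟩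
    Tr y (Tr x (cast (sym (sym (+-assoc x y m))) (sym (sym (+-assoc x y n))) F))
      ≈⟨ Tr-cong (Tr-cong (≈-trans (cast-fan (sym (sym (+-assoc x y m))) (sym (sym (+-assoc x y n))) F) (≈-sym (cast-fan (+-assoc x y m) (+-assoc x y n) F)))) ⟩
    Tr y (Tr x (cast (+-assoc x y m) (+-assoc x y n) F))
      ≈⟨ Tr-vanishing₊ x y F ⟨
    Tr (x + y) F ≈⟨ Tr-cong (cast-fan _ _ f) ⟩
    Tr (x + y) (α⁻¹ x y m ⨾ f ⨾ α x y n) ∎
    where
    F : Term S ((x + y) + m) ((x + y) + n)
    F = cast (sym (+-assoc x y m)) (sym (+-assoc x y n)) f

  Tr-swap : ∀ x y (f : Term S (x + (y + m)) (x + (y + n))) →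
            Tr y (Tr x f) ≈ Tr x (Tr y (fan (swapˡ x y m) ⨾ f ⨾ fan (swapˡ y x n)))
  Tr-swap {m} {n} x y f = begin
    Tr y (Tr x f) ≈⟨ Tr-Tr x y f ⟩
    Tr (x + y) F ≈⟨ Tr-cong (≈-trans ⨾-assoc′ (≈-trans (_ ⨾⟩ ≈-trans ⊗id⨾ (≈-trans (σ-involutive x y ⟨⊗ _) (⊗-id _ _))) (⨾-identityʳ _))) ⟨
    Tr (x + y) ((F ⨾ (σ x y ⊗ idₜ n)) ⨾ (σ y x ⊗ idₜ n)) ≈⟨ Tr-sliding _ _ ⟩
    Tr (y + x) ((σ y x ⊗ idₜ m) ⨾ (α⁻¹ x y m ⨾ f ⨾ α x y n) ⨾ (σ x y ⊗ idₜ n))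
      ≈⟨ Tr-cong (_ ⨾⟩ ≈-trans ⨾-assoc′ (_ ⨾⟩ ⨾-assoc′)) ⟩
    Tr (y + x) ((σ y x ⊗ idₜ m) ⨾ α⁻¹ x y m ⨾ f ⨾ α x y n ⨾ (σ x y ⊗ idₜ n))
      ≈⟨ Tr-cong (≈-trans (extend left) (_ ⨾⟩ _ ⨾⟩ _ ⨾⟩ right)) ⟩
    Tr (y + x) (α⁻¹ y x m ⨾ fan (swapˡ x y m) ⨾ f ⨾ fan (swapˡ y x n) ⨾ α y x n)
      ≈⟨ Tr-cong (_ ⨾⟩ ≈-trans ⨾-assoc′ (_ ⨾⟩ ⨾-assoc′)) ⟨
    Tr (y + x) (α⁻¹ y x m ⨾ (fan (swapˡ x y m) ⨾ f ⨾ fan (swapˡ y x n)) ⨾ α y x n) ≈⟨ Tr-Tr y x _ ⟨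
    Tr x (Tr y (fan (swapˡ x y m) ⨾ f ⨾ fan (swapˡ y x n))) ∎
    where
    F : Term S ((x + y) + m) ((x + y) + n)
    F = α⁻¹ x y m ⨾ f ⨾ α x y n

    left : (σ y x ⊗ idₜ m) ⨾ α⁻¹ x y m ≈ α⁻¹ y x m ⨾ fan (swapˡ x y m)
    left = ≈-sym (≈-trans (_ ⨾⟩ swapˡ-fan x y m) (cancelˡ (α-inverseˡ y x m)))

    right : α x y n ⨾ (σ x y ⊗ idₜ n) ≈ fan (swapˡ y x n) ⨾ α y x n
    right = ≈-sym (≈-trans (swapˡ-fan y x n ⟨⨾ _) (≈-trans ⨾-assoc′ (_ ⨾⟩
      ≈-trans ⨾-assoc′ (≈-trans (_ ⨾⟩ α-inverseˡ y x n) (⨾-identityʳ _)))))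

  Tr-⊗ : ∀ x (f : Term S (x + m) (x + n)) (g : Term S p q) →
         Tr x f ⊗ g ≈ Tr x (α x m p ⨾ (f ⊗ g) ⨾ α⁻¹ x n q)
  Tr-⊗ x f g = ≈-trans (≈-sym (Tr-superposing f g)) (Tr-cong (cast-fan _ _ _))

  -- Any occurrence of a generator in a term can be moved to the position of B.
  pull : Term S s t → Term S (t + m) (s + n) → Term S m n
  pull {t = t} {n = n} B f = Tr t (f ⨾ (B ⊗ idₜ n))

  pull-cong : {B : Term S s t} {f g : Term S (t + m) (s + n)} → f ≈ g → pull B f ≈ pull B g
  pull-cong eq = Tr-cong (eq ⟨⨾ _)

  pull-pre : (B : Term S s t) (g : Term S m n) (f : Term S (t + n) (s + p)) →
             g ⨾ pull B f ≈ pull B ((idₜ t ⊗ g) ⨾ f)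
  pull-pre B g f = ≈-sym (≈-trans (Tr-cong ⨾-assoc′) (Tr-pre g _))

  pull-post : (B : Term S s t) (f : Term S (t + m) (s + n)) (h : Term S n p) →
              pull B f ⨾ h ≈ pull B (f ⨾ (idₜ s ⊗ h))
  pull-post B f h = ≈-sym (≈-trans (Tr-cong (≈-trans ⨾-assoc′ (≈-trans (_ ⨾⟩ ≈-sym exchange) (≈-sym ⨾-assoc′)))) (Tr-post _ h))

  pull-⊗ : (B : Term S s t) (f : Term S (t + m) (s + n)) (g : Term S p q) →
           pull B f ⊗ g ≈ pull B (α t m p ⨾ (f ⊗ g) ⨾ α⁻¹ s n q)
  pull-⊗ {s} {t} {m} {n} {p} {q} B f g = begin
    Tr t (f ⨾ (B ⊗ idₜ n)) ⊗ g ≈⟨ Tr-⊗ t _ g ⟩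
    Tr t (α t m p ⨾ ((f ⨾ (B ⊗ idₜ n)) ⊗ g) ⨾ α⁻¹ t n q)
      ≈⟨ Tr-cong (_ ⨾⟩ ≈-trans ((_ ⊗⟩ ≈-sym (⨾-identityʳ g)) ⟨⨾ _) (≈-trans (⊗-interchange _ _ _ _ ⟨⨾ _) ⨾-assoc′)) ⟩
    Tr t (α t m p ⨾ (f ⊗ g) ⨾ ((B ⊗ idₜ n) ⊗ idₜ q) ⨾ α⁻¹ t n q)
      ≈⟨ Tr-cong (_ ⨾⟩ _ ⨾⟩ cancelˡ (α-inverseˡ s n q)) ⟨
    Tr t (α t m p ⨾ (f ⊗ g) ⨾ α⁻¹ s n q ⨾ α s n q ⨾ ((B ⊗ idₜ n) ⊗ idₜ q) ⨾ α⁻¹ t n q)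
      ≈⟨ Tr-cong (_ ⨾⟩ _ ⨾⟩ _ ⨾⟩ ≈-trans (_ ⊗⟩ ≈-sym (⊗-id n q)) (⊗-assoc-α _ _ _)) ⟨
    Tr t (α t m p ⨾ (f ⊗ g) ⨾ α⁻¹ s n q ⨾ (B ⊗ idₜ (n + q)))
      ≈⟨ Tr-cong (≈-trans ⨾-assoc′ (_ ⨾⟩ ⨾-assoc′)) ⟨
    pull B (α t m p ⨾ (f ⊗ g) ⨾ α⁻¹ s n q) ∎

  private
    regroup : {e : Term S a b} {f : Term S b c} {g : Term S c d} {h : Term S d k} {i : Term S k p} →
              e ⨾ (f ⨾ g) ⨾ h ≈ e ⨾ f ⨾ g ⨾ h
    regroup = _ ⨾⟩ ⨾-assoc′

  Tr-pull : ∀ x (B : Term S s t) (f : Term S (t + (x + m)) (s + (x + n))) →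
            Tr x (pull B f) ≈ pull B (Tr x (fan (swapˡ t x m) ⨾ f ⨾ fan (swapˡ x s n)))
  Tr-pull {s} {t} {m} {n} x B f = begin
    Tr x (Tr t (f ⨾ (B ⊗ idₜ (x + n)))) ≈⟨ Tr-swap t x _ ⟩
    Tr t (Tr x (fan (swapˡ t x m) ⨾ (f ⨾ (B ⊗ idₜ (x + n))) ⨾ fan (swapˡ x t n)))
      ≈⟨ Tr-cong (Tr-cong (_ ⨾⟩ ≈-trans ⨾-assoc′ (_ ⨾⟩ ≈-trans ((_ ⊗⟩ ≈-sym (⊗-id x n)) ⟨⨾ _) (swapˡ-natural (idₜ x) B (idₜ n))))) ⟩
    Tr t (Tr x (fan (swapˡ t x m) ⨾ f ⨾ fan (swapˡ x s n) ⨾ (idₜ x ⊗ (B ⊗ idₜ n))))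
      ≈⟨ Tr-cong (Tr-cong (≈-trans ⨾-assoc′ (_ ⨾⟩ ⨾-assoc′))) ⟨
    Tr t (Tr x ((fan (swapˡ t x m) ⨾ f ⨾ fan (swapˡ x s n)) ⨾ (idₜ x ⊗ (B ⊗ idₜ n))))
      ≈⟨ Tr-cong (Tr-post _ _) ⟩
    pull B (Tr x (fan (swapˡ t x m) ⨾ f ⨾ fan (swapˡ x s n))) ∎

  private
    pull-pull-⊗ : (B : Term S s t) (B′ : Term S s′ t′) (f : Term S (t + (t′ + m)) (s + (s′ + n))) →
                  pull B′ (pull B f) ≈ Tr t′ (Tr t (f ⨾ (B ⊗ (B′ ⊗ idₜ n))))
    pull-pull-⊗ {n = n} B B′ f = Tr-cong (≈-trans (≈-sym (Tr-post _ _)) (Tr-cong (≈-trans ⨾-assoc′ (_ ⨾⟩ exchangeˡ))))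

  pull-pull : (B : Term S s t) (B′ : Term S s′ t′) (f : Term S (t + (t′ + m)) (s + (s′ + n))) →
              pull B′ (pull B f) ≈ pull B (pull B′ (fan (swapˡ t t′ m) ⨾ f ⨾ fan (swapˡ s′ s n)))
  pull-pull {s} {t} {s′} {t′} {m} {n} B B′ f = begin
    pull B′ (pull B f) ≈⟨ pull-pull-⊗ B B′ f ⟩
    Tr t′ (Tr t (f ⨾ (B ⊗ (B′ ⊗ idₜ n)))) ≈⟨ Tr-swap t t′ _ ⟩
    Tr t (Tr t′ (fan (swapˡ t t′ m) ⨾ (f ⨾ (B ⊗ (B′ ⊗ idₜ n))) ⨾ fan (swapˡ t′ t n)))
      ≈⟨ Tr-cong (Tr-cong (_ ⨾⟩ ≈-trans ⨾-assoc′ (_ ⨾⟩ swapˡ-natural B′ B (idₜ n)))) ⟩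
    Tr t (Tr t′ (fan (swapˡ t t′ m) ⨾ f ⨾ fan (swapˡ s′ s n) ⨾ (B′ ⊗ (B ⊗ idₜ n))))
      ≈⟨ Tr-cong (Tr-cong (≈-trans ⨾-assoc′ (_ ⨾⟩ ⨾-assoc′))) ⟨
    Tr t (Tr t′ ((fan (swapˡ t t′ m) ⨾ f ⨾ fan (swapˡ s′ s n)) ⨾ (B′ ⊗ (B ⊗ idₜ n))))
      ≈⟨ pull-pull-⊗ B′ B _ ⟨
    pull B (pull B′ (fan (swapˡ t t′ m) ⨾ f ⨾ fan (swapˡ s′ s n))) ∎

  pull-σ : (B : Term S s t) → B ≈ pull B (σ t s)
  pull-σ {s} {t} B = begin
    B ≈⟨ ⨾-identityʳ B ⟨
    B ⨾ idₜ t ≈⟨ _ ⨾⟩ Tr-yanking t ⟨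
    B ⨾ Tr t (σ t t) ≈⟨ Tr-pre B (σ t t) ⟨
    Tr t ((idₜ t ⊗ B) ⨾ σ t t) ≈⟨ Tr-cong (σ-natural (idₜ t) B) ⟩
    Tr t (σ t s ⨾ (B ⊗ idₜ t)) ∎

  ⋆ : Term S 0 1
  ⋆ = Tr 1 δ

  ⋆⊗-shift : ∀ x m → ⋆ ⊗ idₜ (x + m) ≈ (idₜ x ⊗ (⋆ ⊗ idₜ m)) ⨾ fan (swapˡ 1 x m)
  ⋆⊗-shift x m = begin
    ⋆ ⊗ idₜ (x + m) ≈⟨ _ ⊗⟩ ⊗-id x m ⟨
    ⋆ ⊗ (idₜ x ⊗ idₜ m) ≈⟨ ⨾-identityʳ _ ⟨
    (⋆ ⊗ (idₜ x ⊗ idₜ m)) ⨾ idₜ _ ≈⟨ _ ⨾⟩ swapˡ-inverse x 1 m ⟨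
    (⋆ ⊗ (idₜ x ⊗ idₜ m)) ⨾ fan (swapˡ x 1 m) ⨾ fan (swapˡ 1 x m) ≈⟨ extend (swapˡ-natural (idₜ x) ⋆ (idₜ m)) ⟩
    fan (swapˡ x 0 m) ⨾ (idₜ x ⊗ (⋆ ⊗ idₜ m)) ⨾ fan (swapˡ 1 x m)
      ≈⟨ ≈-trans (fan-cong (swapˡ-zeroʳ x m)) fan-id ⟨⨾ _ ⟩
    idₜ (x + m) ⨾ (idₜ x ⊗ (⋆ ⊗ idₜ m)) ⨾ fan (swapˡ 1 x m) ≈⟨ ⨾-identityˡ _ ⟩
    _ ∎

  ⋆⊗-natural : (f : Term S m n) → f ⨾ (⋆ ⊗ idₜ n) ≈ (⋆ ⊗ idₜ m) ⨾ (idₜ 1 ⊗ f)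
  ⋆⊗-natural f = ≈-trans (≈-sym (⊗-identityˡ f) ⟨⨾ _) (≈-sym exchange)

  Tr-⋆ : ∀ x (f : Term S (1 + (x + m)) (x + n)) →
         Tr x ((⋆ ⊗ idₜ (x + m)) ⨾ f) ≈ (⋆ ⊗ idₜ m) ⨾ Tr x (fan (swapˡ 1 x m) ⨾ f)
  Tr-⋆ {m} x f = ≈-trans (Tr-cong (pushˡ (⋆⊗-shift x m))) (Tr-pre _ _)

  Tr₁-fan-zero : (ψ : Fin (suc n) → Fin (suc m)) → ψ zero ≡ zero →
                 Tr 1 (fan ψ) ≈ (⋆ ⊗ idₜ m) ⨾ fan (ψ ∘ suc)
  Tr₁-fan-zero {m = m} ψ eq = begin
    Tr 1 (fan ψ) ≈⟨ Tr-cong (≈-trans (fan-step ψ) (≡⇒≈ (cong dup eq) ⟨⨾ _)) ⟩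
    Tr 1 ((δ ⊗ idₜ m) ⨾ (idₜ 1 ⊗ fan (ψ ∘ suc))) ≈⟨ Tr-post _ _ ⟩
    Tr 1 (δ ⊗ idₜ m) ⨾ fan (ψ ∘ suc) ≈⟨ Tr-superposing δ (idₜ m) ⟨⨾ _ ⟩
    (⋆ ⊗ idₜ m) ⨾ fan (ψ ∘ suc) ∎

  Tr₁-fan-suc : (ψ : Fin (suc n) → Fin (suc m)) (v : Fin m) → ψ zero ≡ suc v →
                Tr 1 (fan ψ) ≈ dup v ⨾ fan (ψ ∘ suc)
  Tr₁-fan-suc {m = m} ψ v eq = begin
    Tr 1 (fan ψ) ≈⟨ Tr-cong (≈-trans (fan-step ψ) (≈-trans (≡⇒≈ (cong dup eq) ⟨⨾ _) ⨾-assoc′)) ⟩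
    Tr 1 ((idₜ 1 ⊗ dup v) ⨾ swap₂ m ⨾ (idₜ 1 ⊗ fan (ψ ∘ suc))) ≈⟨ Tr-pre _ _ ⟩
    dup v ⨾ Tr 1 (swap₂ m ⨾ (idₜ 1 ⊗ fan (ψ ∘ suc))) ≈⟨ _ ⨾⟩ Tr-post _ _ ⟩
    dup v ⨾ Tr 1 (swap₂ m) ⨾ fan (ψ ∘ suc) ≈⟨ _ ⨾⟩ (≈-trans (Tr-superposing (σ 1 1) (idₜ m)) (≈-trans (Tr-yanking 1 ⟨⊗ _) (⊗-id 1 m)) ⟨⨾ _) ⟩
    dup v ⨾ idₜ _ ⨾ fan (ψ ∘ suc) ≈⟨ _ ⨾⟩ ⨾-identityˡ _ ⟩
    dup v ⨾ fan (ψ ∘ suc) ∎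

  data Form {m n} (f : Term S m n) : Set where
    fan-form  : (ψ : Fin n → Fin m) → f ≈ fan ψ → Form f
    loop-form : {g : Term S (suc m) n} → Form g → f ≈ (⋆ ⊗ idₜ m) ⨾ g → Form f
    pull-form : ∀ φ {g : Term S (Signature.cod S φ + m) (Signature.dom S φ + n)} →
                Form g → f ≈ pull (gen φ) g → Form f

  Form-≈ : {f g : Term S m n} → f ≈ g → Form g → Form f
  Form-≈ eq (fan-form ψ eq′)    = fan-form ψ (≈-trans eq eq′)
  Form-≈ eq (loop-form F eq′)   = loop-form F (≈-trans eq eq′)
  Form-≈ eq (pull-form φ F eq′) = pull-form φ F (≈-trans eq eq′)

  Form-fan-pre : {f : Term S n p} (ψ : Fin n → Fin m) → Form f → Form (fan ψ ⨾ f)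
  Form-fan-pre ψ (fan-form χ eq) = fan-form (ψ ∘ χ) (≈-trans (_ ⨾⟩ eq) (fan-⨾ ψ χ))
  Form-fan-pre ψ (loop-form F eq) = loop-form
    (Form-≈ (id⊗fan ψ ⟨⨾ _) (Form-fan-pre (id {A = Fin 1} ⊞ ψ) F))
    (≈-trans (_ ⨾⟩ eq) (extend (⋆⊗-natural (fan ψ))))
  Form-fan-pre ψ (pull-form φ F eq) = pull-form φ
    (Form-≈ (id⊗fan ψ ⟨⨾ _) (Form-fan-pre (id ⊞ ψ) F))
    (≈-trans (_ ⨾⟩ eq) (pull-pre (gen φ) _ _))

  Form-fan-post : {f : Term S m n} (ψ : Fin p → Fin n) → Form f → Form (f ⨾ fan ψ)
  Form-fan-post ψ (fan-form χ eq) = fan-form (χ ∘ ψ) (≈-trans (eq ⟨⨾ _) (fan-⨾ χ ψ))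
  Form-fan-post ψ (loop-form F eq) = loop-form (Form-fan-post ψ F) (pushˡ eq)
  Form-fan-post ψ (pull-form φ F eq) = pull-form φ
    (Form-≈ (_ ⨾⟩ id⊗fan ψ) (Form-fan-post (id ⊞ ψ) F))
    (≈-trans (eq ⟨⨾ _) (pull-post (gen φ) _ _))

  Form-⊗id : ∀ x {f : Term S m n} → Form f → Form (f ⊗ idₜ x)
  Form-⊗id x (fan-form ψ eq) = fan-form (ψ ⊞ id) (≈-trans (eq ⟨⊗ _) (fan⊗id ψ))
  Form-⊗id {m} x (loop-form F eq) = loop-form (Form-⊗id x F)
    (≈-trans (≈-trans (eq ⟨⊗ _) (≈-sym ⊗id⨾))
             (≈-trans (⊗-assoc ⋆ (idₜ m) (idₜ x)) (_ ⊗⟩ ⊗-id m x) ⟨⨾ _))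
  Form-⊗id x (pull-form φ F eq) = pull-form φ
    (Form-fan-pre _ (Form-fan-post _ (Form-⊗id x F)))
    (≈-trans (eq ⟨⊗ _) (pull-⊗ (gen φ) _ (idₜ x)))

  Form-id⊗ : ∀ x {f : Term S m n} → Form f → Form (idₜ x ⊗ f)
  Form-id⊗ {m} {n} x {f} F = Form-≈ conjugate (Form-fan-pre (swap x m) (Form-fan-post (swap n x) (Form-⊗id x F)))
    where
    conjugate : idₜ x ⊗ f ≈ fan (swap x m) ⨾ (f ⊗ idₜ x) ⨾ fan (swap n x)
    conjugate = begin
      idₜ x ⊗ f ≈⟨ ⨾-identityʳ _ ⟨
      (idₜ x ⊗ f) ⨾ idₜ _ ≈⟨ _ ⨾⟩ σ-involutive x n ⟨
      (idₜ x ⊗ f) ⨾ σ x n ⨾ σ n x ≈⟨ extend (σ-natural (idₜ x) f) ⟩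
      σ x m ⨾ (f ⊗ idₜ x) ⨾ σ n x ≈⟨ ⨾-cong (σ-fan x m) (_ ⨾⟩ σ-fan n x) ⟩
      _ ∎

  Form-⨾ : {f : Term S m n} {g : Term S n p} → Form f → Form g → Form (f ⨾ g)
  Form-⨾ (fan-form ψ eq) G = Form-≈ (eq ⟨⨾ _) (Form-fan-pre ψ G)
  Form-⨾ (loop-form F eq) G = loop-form (Form-⨾ F G) (pushˡ eq)
  Form-⨾ (pull-form φ F eq) G = pull-form φ
    (Form-⨾ F (Form-id⊗ _ G)) (≈-trans (eq ⟨⨾ _) (pull-post (gen φ) _ _))

  private
    Form-Tr-fan : ∀ x (ψ : Fin (x + n) → Fin (x + m)) → Form (Tr x (fan ψ))
    Form-Tr-fan zero ψ = fan-form ψ (Tr-vanishing₀ _)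
    Form-Tr-fan {n} {m} (suc x) ψ = Form-≈ (Tr-vanishing₊ 1 x (fan ψ)) (go (ψ zero) refl)
      where
      go : ∀ v → ψ zero ≡ v → Form (Tr x (Tr 1 (fan ψ)))
      go zero eq = loop-form
        (Form-≈ (Tr-cong (fan-⨾ _ _)) (Form-Tr-fan x (swapˡ 1 x m ∘ ψ ∘ suc)))
        (≈-trans (Tr-cong (Tr₁-fan-zero ψ eq)) (Tr-⋆ x _))
      go (suc v) eq = Form-≈
        (Tr-cong (≈-trans (Tr₁-fan-suc ψ v eq) (≈-trans (dup-fan v ⟨⨾ _) (fan-⨾ _ _))))
        (Form-Tr-fan x _)

    Form-Tr-fans : ∀ x {f : Term S a b} → Form f →
                   (π : Fin a → Fin (x + m)) (ρ : Fin (x + n) → Fin b) → Form (Tr x (fan π ⨾ f ⨾ fan ρ))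
    Form-Tr-fans x (fan-form ψ eq) π ρ = Form-≈
      (Tr-cong (≈-trans (_ ⨾⟩ ≈-trans (eq ⟨⨾ _) (fan-⨾ _ _)) (fan-⨾ _ _)))
      (Form-Tr-fan x _)
    Form-Tr-fans {a = a} {m = m} x (loop-form {g = g} F eq) π ρ = loop-form
      (Form-Tr-fans x F (swapˡ 1 x m ∘ (id {A = Fin 1} ⊞ π)) ρ)
      (begin
        Tr x (fan π ⨾ _ ⨾ fan ρ) ≈⟨ Tr-cong (_ ⨾⟩ pushˡ eq) ⟩
        Tr x (fan π ⨾ (⋆ ⊗ idₜ a) ⨾ g ⨾ fan ρ) ≈⟨ Tr-cong (extend (⋆⊗-natural (fan π))) ⟩
        Tr x ((⋆ ⊗ idₜ (x + m)) ⨾ (idₜ 1 ⊗ fan π) ⨾ g ⨾ fan ρ) ≈⟨ Tr-⋆ x _ ⟩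
        (⋆ ⊗ idₜ m) ⨾ Tr x (fan (swapˡ 1 x m) ⨾ (idₜ 1 ⊗ fan π) ⨾ g ⨾ fan ρ)
          ≈⟨ _ ⨾⟩ Tr-cong (pullˡ (≈-trans (_ ⨾⟩ id⊗fan π) (fan-⨾ _ _))) ⟩
        _ ∎)
    Form-Tr-fans {m = m} {n = n} x (pull-form φ {g} F eq) π ρ = pull-form φ
      (Form-Tr-fans x F (swapˡ _ x m ∘ (id ⊞ π)) ((id ⊞ ρ) ∘ swapˡ x _ n))
      (begin
        Tr x (fan π ⨾ _ ⨾ fan ρ) ≈⟨ Tr-cong (_ ⨾⟩ ≈-trans (eq ⟨⨾ _) (pull-post (gen φ) _ _)) ⟩
        Tr x (fan π ⨾ pull (gen φ) (g ⨾ (idₜ _ ⊗ fan ρ))) ≈⟨ Tr-cong (pull-pre (gen φ) _ _) ⟩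
        Tr x (pull (gen φ) ((idₜ _ ⊗ fan π) ⨾ g ⨾ (idₜ _ ⊗ fan ρ)))
          ≈⟨ Tr-pull x (gen φ) _ ⟩
        pull (gen φ) (Tr x (fan (swapˡ _ x m) ⨾ ((idₜ _ ⊗ fan π) ⨾ g ⨾ (idₜ _ ⊗ fan ρ)) ⨾ fan (swapˡ x _ n)))
          ≈⟨ pull-cong (Tr-cong (≈-trans (_ ⨾⟩ ≈-trans ⨾-assoc′ (_ ⨾⟩ ⨾-assoc′)) (≈-trans (pullˡ (≈-trans (_ ⨾⟩ id⊗fan π) (fan-⨾ _ _)))
               (_ ⨾⟩ _ ⨾⟩ ≈-trans (id⊗fan ρ ⟨⨾ _) (fan-⨾ _ _))))) ⟩
        _ ∎)

  Form-Tr : ∀ x {f : Term S (x + m) (x + n)} → Form f → Form (Tr x f)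
  Form-Tr x F = Form-≈
    (Tr-cong (≈-sym (≈-trans (⨾-cong fan-id (≈-trans (_ ⨾⟩ fan-id) (⨾-identityʳ _))) (⨾-identityˡ _))))
    (Form-Tr-fans x F id id)

  form : (f : Term S m n) → Form f
  form (gen φ)  = pull-form φ (fan-form _ (σ-fan _ _)) (pull-σ (gen φ))
  form δ        = fan-form _ (≈-trans (≈-sym (⊗-identityʳ δ)) (dup-fan zero))
  form ε        = fan-form _ (≈-trans (≈-sym (⊗-identityʳ ε)) (≈-sym (fan-zero λ ())))
  form (idₜ n)  = fan-form id (≈-sym fan-id)
  form (σ m n)  = fan-form _ (σ-fan m n)
  form (f ⨾ g)  = Form-⨾ (form f) (form g)
  form (f ⊗ g)  = Form-≈ (≈-sym exchangeˡ) (Form-⨾ (Form-⊗id _ (form f)) (Form-id⊗ _ (form g)))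
  form (Tr x f) = Form-Tr x (form f)

-- Reading a hypergraph as a term

Inj : {A B : Set} → (A → B) → Set
Inj = Injective _≡_ _≡_

↑ˡ≢↑ʳ : (i : Fin m) (j : Fin n) → i ↑ˡ n ≢ m ↑ʳ j
↑ˡ≢↑ʳ zero    j ()
↑ˡ≢↑ʳ (suc i) j eq = ↑ˡ≢↑ʳ i j (suc-injective eq)

++-injective : {A : Set} {f : Fin m → A} {g : Fin n → A} → Inj f → Inj g → (∀ i j → f i ≢ g j) → Inj (f ++ g)
++-injective {m} {n} {f = f} {g} f-inj g-inj f≢g {x} {y} = split-∀ m
  {P = λ x → ∀ y → (f ++ g) x ≡ (f ++ g) y → x ≡ y}
  (λ i → split-∀ m
    (λ j eq → cong (_↑ˡ n) (f-inj (trans (sym (++-↑ˡ f g i)) (trans eq (++-↑ˡ f g j)))))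
    (λ j eq → contradiction (trans (sym (++-↑ˡ f g i)) (trans eq (++-↑ʳ f g j))) (f≢g i j)))
  (λ i → split-∀ m
    (λ j eq → contradiction (trans (sym (++-↑ˡ f g j)) (trans (sym eq) (++-↑ʳ f g i))) (f≢g j i))
    (λ j eq → cong (m ↑ʳ_) (g-inj (trans (sym (++-↑ʳ f g i)) (trans eq (++-↑ʳ f g j)))))) x y

enumerate : ∀ {V} {P : Fin V → Set} → (∀ v → Dec (P v)) →
            ∃[ z ] Σ (Fin z → Fin V) λ lone →
              Inj lone × (∀ i → P (lone i)) × (∀ v → P v → ∃[ i ] lone i ≡ v)
enumerate {zero}  P? = 0 , (λ ()) , (λ { {()} }) , (λ ()) , λ ()
enumerate {suc V} {P} P? with P? zero | enumerate (P? ∘ suc)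
... | no ¬p | z , lone , inj , ∈P , covers = z , suc ∘ lone , inj ∘ suc-injective , ∈P , covers′
  where
  covers′ : ∀ v → P v → ∃[ i ] suc (lone i) ≡ v
  covers′ zero    p = contradiction p ¬p
  covers′ (suc v) p = let i , eq = covers v p in i , cong suc eq
... | yes p | z , lone , inj , ∈P , covers = suc z , lone′ , lone′-inj , ∈P′ , covers′
  where
  lone′ : Fin (suc z) → Fin (suc V)
  lone′ zero    = zero
  lone′ (suc i) = suc (lone i)

  lone′-inj : Inj lone′
  lone′-inj {zero}  {zero}  _  = refl
  lone′-inj {suc i} {suc j} eq = cong suc (inj (suc-injective eq))

  ∈P′ : ∀ i → P (lone′ i)
  ∈P′ zero    = p
  ∈P′ (suc i) = ∈P i

  covers′ : ∀ v → P v → ∃[ i ] lone′ i ≡ v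
  covers′ zero    p = zero , refl
  covers′ (suc v) p = let i , eq = covers v p in suc i , cong suc eq

record Complement {m V} (inp : Fin m → Fin V) : Set where
  field
    size       : ℕ
    lone       : Fin size → Fin V
    index      : Fin V → Fin (size + m)
    at-index   : ∀ v → (lone ++ inp) (index v) ≡ v
    index-lone : ∀ i → index (lone i) ≡ i ↑ˡ m
    index-inp  : ∀ a → index (inp a) ≡ size ↑ʳ a

  lone-injective : Inj lone
  lone-injective eq = ↑ˡ-injective m _ _ (trans (sym (index-lone _)) (trans (cong index eq) (index-lone _)))

  lone≢inp : ∀ i a → lone i ≢ inp a
  lone≢inp i a eq = ↑ˡ≢↑ʳ i a (trans (sym (index-lone i)) (trans (cong index eq) (index-inp a)))

  lone-covers : ∀ v → (∀ a → v ≢ inp a) → ∃[ i ] lone i ≡ v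
  lone-covers v v≢ = split-∀ size {P = λ w → (lone ++ inp) w ≡ v → ∃[ i ] lone i ≡ v}
    (λ i eq → i , trans (sym (++-↑ˡ lone inp i)) eq)
    (λ a eq → contradiction (trans (sym eq) (++-↑ʳ lone inp a)) (v≢ a))
    (index v) (at-index v)

complementOf : {inp : Fin m → Fin V} → Inj inp → Complement inp
complementOf {m} {V} {inp} inp-inj = build (enumerate λ v → ¬? (any? λ a → inp a ≟ v))
  where
  build : (∃[ z ] Σ (Fin z → Fin V) λ lone → Inj lone × (∀ i → ¬ (∃[ a ] inp a ≡ lone i)) ×
            (∀ v → ¬ (∃[ a ] inp a ≡ v) → ∃[ i ] lone i ≡ v)) → Complement inp
  build (z , lone , inj , ∉ , covers) = record
    { size = z ; lone = lone ; index = λ v → proj₁ (find v) ; at-index = λ v → proj₂ (find v)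
    ; index-lone = λ i → both-inj (trans (proj₂ (find (lone i))) (sym (++-↑ˡ lone inp i)))
    ; index-inp = λ a → both-inj (trans (proj₂ (find (inp a))) (sym (++-↑ʳ lone inp a)))
    }
    where
    both-inj : Inj (lone ++ inp)
    both-inj = ++-injective inj inp-inj (λ i a eq → ∉ i (a , sym eq))

    find : ∀ v → ∃[ w ] (lone ++ inp) w ≡ v
    find v with any? (λ a → inp a ≟ v)
    ... | yes (a , eq) = z ↑ʳ a , trans (++-↑ʳ lone inp a) eq
    ... | no ∄         = let i , eq = covers v ∄ in i ↑ˡ m , trans (++-↑ˡ lone inp i) eq

module _ (S : Signature) where
  open Signature S

  record Net (k V m n : ℕ) : Set where
    field
      lab : Fin k → Gen
      src : ∀ e → Fin (dom (lab e)) → Fin V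
      tgt : ∀ e → Fin (cod (lab e)) → Fin V
      inp : Fin m → Fin V
      out : Fin n → Fin V

module _ {S : Signature} where
  open Signature S
  open ≈-Reasoning {S}
  open Net

  -- Partial left-monogamy, elementwise.
  record SingleSource (N : Net S k V m n) : Set where
    field
      inp-inj  : Inj (inp N)
      tgt-inj  : ∀ e → Inj (tgt N e)
      tgt-edge : ∀ {e e′ b b′} → tgt N e b ≡ tgt N e′ b′ → e ≡ e′
      inp≢tgt  : ∀ a e b → inp N a ≢ tgt N e b

  open SingleSource

  cut : (p : Fin (suc k)) (N : Net S (suc k) V m n) →
        Net S k V (cod (lab N p) + m) (dom (lab N p) + n)
  cut p N = record
    { lab = lab N ∘ punchIn p
    ; src = src N ∘ punchIn p
    ; tgt = tgt N ∘ punchIn p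
    ; inp = tgt N p ++ inp N
    ; out = src N p ++ out N
    }

  opaque
    cut-single : (p : Fin (suc k)) {N : Net S (suc k) V m n} → SingleSource N → SingleSource (cut p N)
    cut-single p {N} ss = record
      { inp-inj  = ++-injective (tgt-inj ss p) (inp-inj ss) (λ b a → inp≢tgt ss a p b ∘ sym)
      ; tgt-inj  = tgt-inj ss ∘ punchIn p
      ; tgt-edge = punchIn-injective p _ _ ∘ tgt-edge ss
      ; inp≢tgt  = λ a e b → split-∀ (cod (lab N p)) {P = λ a → (tgt N p ++ inp N) a ≢ tgt N (punchIn p e) b}
          (λ a eq → punchInᵢ≢i p e (sym (tgt-edge ss (trans (sym (++-↑ˡ _ _ a)) eq))))
          (λ a eq → inp≢tgt ss a _ b (trans (sym (++-↑ʳ (tgt N p) _ a)) eq)) a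
      }

  module _ {inp : Fin m → Fin V} (c : Complement inp) where
    open Complement c

    knot-wiring : (Fin n → Fin V) → Fin (size + n) → Fin (size + m)
    knot-wiring out = (_↑ˡ m) ++ index ∘ out

    -- Each vertex that is not an input is read as a loop.
    knot : (Fin n → Fin V) → Term S m n
    knot out = Tr size (fan (knot-wiring out))

  reify : (N : Net S k V m n) → SingleSource N → Term S m n
  reify {zero}  N ss = knot (complementOf (inp-inj ss)) (out N)
  reify {suc k} N ss = pull (gen (lab N zero)) (reify (cut zero N) (cut-single zero ss))

  module _ {inp : Fin m → Fin V} {inp′ : Fin m′ → Fin V′} {out : Fin n → Fin V} {out′ : Fin n′ → Fin V′}
           (c : Complement inp) (c′ : Complement inp′)
           (θ : Fin V → Fin V′) (θ⁻¹ : Fin V′ → Fin V) (θ⁻¹-θ : θ⁻¹ ∘ θ ≗ id) (θ-θ⁻¹ : θ ∘ θ⁻¹ ≗ id)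
           (π : Fin m′ → Fin m) (π⁻¹ : Fin m → Fin m′) (π⁻¹-π : π⁻¹ ∘ π ≗ id) (π-π⁻¹ : π ∘ π⁻¹ ≗ id)
           (ρ : Fin n′ → Fin n)
           (inp-eq : inp′ ≗ θ ∘ inp ∘ π) (out-eq : out′ ≗ θ ∘ out ∘ ρ) where
    private
      module C = Complement c
      module C′ = Complement c′

      θ-inp : ∀ a → θ (inp a) ≡ inp′ (π⁻¹ a)
      θ-inp a = sym (trans (inp-eq (π⁻¹ a)) (cong (θ ∘ inp) (π-π⁻¹ a)))

      τ∃ : ∀ i → ∃[ j ] C′.lone j ≡ θ (C.lone i)
      τ∃ i = C′.lone-covers (θ (C.lone i)) λ a eq → C.lone≢inp i (π a)
        (trans (sym (θ⁻¹-θ _)) (trans (cong θ⁻¹ (trans eq (inp-eq a))) (θ⁻¹-θ _)))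

      τ⁻¹∃ : ∀ j → ∃[ i ] C.lone i ≡ θ⁻¹ (C′.lone j)
      τ⁻¹∃ j = C.lone-covers (θ⁻¹ (C′.lone j)) λ a eq → C′.lone≢inp j (π⁻¹ a)
        (trans (sym (θ-θ⁻¹ _)) (trans (cong θ eq) (θ-inp a)))

      τ : Fin C.size → Fin C′.size
      τ i = proj₁ (τ∃ i)

      τ⁻¹ : Fin C′.size → Fin C.size
      τ⁻¹ j = proj₁ (τ⁻¹∃ j)

      τ⁻¹-τ : τ⁻¹ ∘ τ ≗ id
      τ⁻¹-τ i = C.lone-injective (trans (proj₂ (τ⁻¹∃ (τ i))) (trans (cong θ⁻¹ (proj₂ (τ∃ i))) (θ⁻¹-θ _)))

      τ-τ⁻¹ : τ ∘ τ⁻¹ ≗ id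
      τ-τ⁻¹ j = C′.lone-injective (trans (proj₂ (τ∃ (τ⁻¹ j))) (trans (cong θ (proj₂ (τ⁻¹∃ j))) (θ-θ⁻¹ _)))

      τ⁺ : Fin (C.size + n′) → Fin (C′.size + n′)
      τ⁺ = τ ⊞ id

      τ⁻ : Fin (C′.size + m′) → Fin (C.size + m′)
      τ⁻ = τ⁻¹ ⊞ id

      π⁻ : Fin (C.size + m) → Fin (C.size + m′)
      π⁻ = id ⊞ π⁻¹

      transfer : ∀ v → τ⁻ (C′.index (θ v)) ≡ π⁻ (C.index v)
      transfer v = subst (λ w → τ⁻ (C′.index (θ w)) ≡ π⁻ (C.index v))
        (C.at-index v) (on-index (C.index v))
        where
        on-index : ∀ u → τ⁻ (C′.index (θ ((C.lone ++ inp) u))) ≡ π⁻ u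
        on-index = split-∀ C.size
          (λ i → trans (cong (λ w → τ⁻ (C′.index w)) (trans (cong θ (++-↑ˡ C.lone inp i)) (sym (proj₂ (τ∃ i)))))
                (trans (cong τ⁻ (C′.index-lone (τ i)))
                (trans (++-↑ˡ _ _ (τ i)) (trans (cong (_↑ˡ m′) (τ⁻¹-τ i)) (sym (++-↑ˡ _ _ i))))))
          (λ a → trans (cong (λ w → τ⁻ (C′.index w)) (trans (cong θ (++-↑ʳ C.lone inp a)) (θ-inp a)))
                (trans (cong τ⁻ (C′.index-inp (π⁻¹ a)))
                (trans (++-↑ʳ {m = C′.size} _ _ (π⁻¹ a)) (sym (++-↑ʳ {m = C.size} _ _ a)))))

      χ : Fin (C.size + n) → Fin (C.size + m)
      χ = knot-wiring c out

      χ′ : Fin (C′.size + n′) → Fin (C′.size + m′)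
      χ′ = knot-wiring c′ out′

      slid : τ⁻ ∘ χ′ ∘ τ⁺ ≗ π⁻ ∘ χ ∘ (id {A = Fin C.size} ⊞ ρ)
      slid = split-∀ C.size
        (λ i → trans (cong (τ⁻ ∘ χ′) (++-↑ˡ _ _ i))
              (trans (cong τ⁻ (++-↑ˡ _ _ (τ i)))
              (trans (++-↑ˡ _ _ (τ i)) (trans (cong (_↑ˡ m′) (τ⁻¹-τ i))
              (sym (trans (cong (π⁻ ∘ χ) (++-↑ˡ _ _ i))
              (trans (cong π⁻ (++-↑ˡ _ _ i)) (++-↑ˡ _ _ i))))))))
        (λ b → trans (cong (τ⁻ ∘ χ′) (++-↑ʳ {m = C.size} _ _ b))
              (trans (cong τ⁻ (trans (++-↑ʳ {m = C′.size} _ _ b) (cong C′.index (out-eq b))))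
              (trans (transfer (out (ρ b)))
              (sym (trans (cong (π⁻ ∘ χ) (++-↑ʳ {m = C.size} _ _ b))
              (cong π⁻ (++-↑ʳ {m = C.size} _ _ (ρ b))))))))

      cancelled : τ⁺ ∘ (τ⁻¹ ⊞ id {A = Fin n′}) ≗ id
      cancelled = ⊞-inverse τ τ⁻¹ id id τ-τ⁻¹ λ _ → refl

    knot-rewire : knot c′ out′ ≈ fan π⁻¹ ⨾ knot c out ⨾ fan ρ
    knot-rewire = begin
      Tr C′.size (fan χ′)
        ≈⟨ Tr-cong (≈-trans (fan-cong (λ i → cong χ′ (sym (cancelled i)))) (≈-sym (≈-trans (_ ⨾⟩ fan⊗id τ⁻¹) (fan-⨾ _ _)))) ⟩
      Tr C′.size (fan (χ′ ∘ τ⁺) ⨾ (fan τ⁻¹ ⊗ idₜ n′)) ≈⟨ Tr-sliding _ _ ⟩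
      Tr C.size ((fan τ⁻¹ ⊗ idₜ m′) ⨾ fan (χ′ ∘ τ⁺))
        ≈⟨ Tr-cong (≈-trans (fan⊗id τ⁻¹ ⟨⨾ _) (≈-trans (fan-⨾ _ _) (fan-cong slid))) ⟩
      Tr C.size (fan (π⁻ ∘ χ ∘ (id {A = Fin C.size} ⊞ ρ)))
        ≈⟨ Tr-cong (≈-trans (⨾-cong (id⊗fan π⁻¹) (≈-trans (_ ⨾⟩ id⊗fan ρ) (fan-⨾ _ _))) (fan-⨾ _ _)) ⟨
      Tr C.size ((idₜ _ ⊗ fan π⁻¹) ⨾ fan χ ⨾ (idₜ _ ⊗ fan ρ)) ≈⟨ Tr-tightening _ _ _ ⟩
      fan π⁻¹ ⨾ knot c out ⨾ fan ρ ∎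

  record Rewiring (η : Fin k → Fin k′) (N : Net S k V m n) (N′ : Net S k′ V′ m′ n′) : Set where
    field
      θ      : Fin V → Fin V′
      θ⁻¹    : Fin V′ → Fin V
      θ⁻¹-θ  : θ⁻¹ ∘ θ ≗ id
      θ-θ⁻¹  : θ ∘ θ⁻¹ ≗ id
      π      : Fin m′ → Fin m
      π⁻¹    : Fin m → Fin m′
      π⁻¹-π  : π⁻¹ ∘ π ≗ id
      π-π⁻¹  : π ∘ π⁻¹ ≗ id
      ρ      : Fin n′ → Fin n
      lab-eq : ∀ {e e′} → η e ≡ e′ → lab N′ e′ ≡ lab N e
      src-eq : ∀ {e e′} (eq : η e ≡ e′) a →
               src N′ e′ a ≡ θ (src N e (Fin.cast (cong dom (lab-eq eq)) a))
      tgt-eq : ∀ {e e′} (eq : η e ≡ e′) b →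
               tgt N′ e′ b ≡ θ (tgt N e (Fin.cast (cong cod (lab-eq eq)) b))
      inp-eq : ∀ a → inp N′ a ≡ θ (inp N (π a))
      out-eq : ∀ b → out N′ b ≡ θ (out N (ρ b))

  cut-rewiring : {η : Fin (suc k) → Fin (suc k′)} {N : Net S (suc k) V m n} {N′ : Net S (suc k′) V′ m′ n′} →
                 (R : Rewiring η N N′) {p : Fin (suc k′)} → η zero ≡ p →
                 (η′ : Fin k → Fin k′) → (∀ e → punchIn p (η′ e) ≡ η (suc e)) →
                 Rewiring η′ (cut zero N) (cut p N′)
  cut-rewiring {m = m} {n} {m′ = m′} {n′} {η = η} {N} {N′} R {p} p-eq η′ η-eq = record
    { θ = θ ; θ⁻¹ = θ⁻¹ ; θ⁻¹-θ = θ⁻¹-θ ; θ-θ⁻¹ = θ-θ⁻¹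
    ; π = cod→ ⊞ π ; π⁻¹ = cod← ⊞ π⁻¹
    ; π⁻¹-π = ⊞-inverse cod← cod→ π⁻¹ π (cast-involutive (sym cod-eq) cod-eq) π⁻¹-π
    ; π-π⁻¹ = ⊞-inverse cod→ cod← π π⁻¹ (cast-involutive cod-eq (sym cod-eq)) π-π⁻¹
    ; ρ = dom→ ⊞ ρ
    ; lab-eq = λ {e} eq → lab-eq (edge-eq eq)
    ; src-eq = λ {e} eq → src-eq (edge-eq eq)
    ; tgt-eq = λ {e} eq → tgt-eq (edge-eq eq)
    ; inp-eq = ++-unique
        (λ i → trans (tgt-eq p-eq i) (cong θ (sym (trans (cong (tgt N zero ++ inp N) (++-↑ˡ _ _ i)) (++-↑ˡ _ _ (cod→ i))))))
        (λ i → trans (inp-eq i) (cong θ (sym (trans (cong (tgt N zero ++ inp N) (++-↑ʳ {m = cod (lab N′ p)} _ _ i)) (++-↑ʳ (tgt N zero) _ (π i))))))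
    ; out-eq = ++-unique
        (λ i → trans (src-eq p-eq i) (cong θ (sym (trans (cong (src N zero ++ out N) (++-↑ˡ _ _ i)) (++-↑ˡ _ _ (dom→ i))))))
        (λ i → trans (out-eq i) (cong θ (sym (trans (cong (src N zero ++ out N) (++-↑ʳ {m = dom (lab N′ p)} _ _ i)) (++-↑ʳ (src N zero) _ (ρ i))))))
    }
    where
    open Rewiring R

    cod-eq : cod (lab N′ p) ≡ cod (lab N zero)
    cod-eq = cong cod (lab-eq p-eq)

    cod→ : Fin (cod (lab N′ p)) → Fin (cod (lab N zero))
    cod→ = Fin.cast cod-eq

    cod← : Fin (cod (lab N zero)) → Fin (cod (lab N′ p))
    cod← = Fin.cast (sym cod-eq)

    dom→ : Fin (dom (lab N′ p)) → Fin (dom (lab N zero))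
    dom→ = Fin.cast (cong dom (lab-eq p-eq))

    edge-eq : ∀ {e e′} → η′ e ≡ e′ → η (suc e) ≡ punchIn p e′
    edge-eq {e} eq = trans (sym (η-eq e)) (cong (punchIn p) eq)

  private
    pull-relabel : {φ φ′ : Gen} (eq : φ′ ≡ φ) (π⁻¹ : Fin m → Fin m′) (ρ : Fin n′ → Fin n)
                   (f : Term S (cod φ + m) (dom φ + n)) →
                   pull (gen φ′) (fan (Fin.cast (sym (cong cod eq)) ⊞ π⁻¹) ⨾ f ⨾ fan (Fin.cast (cong dom eq) ⊞ ρ)) ≈
                   fan π⁻¹ ⨾ pull (gen φ) f ⨾ fan ρ
    pull-relabel {m} {m′} {n′} {n} {φ} refl π⁻¹ ρ f = begin
      pull (gen φ) (fan (Fin.cast refl ⊞ π⁻¹) ⨾ f ⨾ fan (Fin.cast refl ⊞ ρ))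
        ≈⟨ pull-cong (⨾-cong (plain π⁻¹) (_ ⨾⟩ plain ρ)) ⟩
      pull (gen φ) ((idₜ _ ⊗ fan π⁻¹) ⨾ f ⨾ (idₜ _ ⊗ fan ρ)) ≈⟨ pull-pre _ _ _ ⟨
      fan π⁻¹ ⨾ pull (gen φ) (f ⨾ (idₜ _ ⊗ fan ρ)) ≈⟨ _ ⨾⟩ pull-post _ _ _ ⟨
      fan π⁻¹ ⨾ pull (gen φ) f ⨾ fan ρ ∎
      where
      plain : ∀ {x p q} (ψ : Fin q → Fin p) → fan {S} (Fin.cast (refl {x = x}) ⊞ ψ) ≈ idₜ x ⊗ fan ψ
      plain {x} {p} ψ = ≈-trans (fan-cong (++-cong (λ i → cong (_↑ˡ p) (cast-is-id refl i)) (λ _ → refl))) (≈-sym (id⊗fan ψ))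

  reify-rewire : {N : Net S k V m n} {N′ : Net S k V′ m′ n′} (R : Rewiring id N N′)
                 (ss : SingleSource N) (ss′ : SingleSource N′) →
                 reify N′ ss′ ≈ fan (Rewiring.π⁻¹ R) ⨾ reify N ss ⨾ fan (Rewiring.ρ R)
  reify-rewire {zero} R ss ss′ =
    knot-rewire (complementOf (inp-inj ss)) (complementOf (inp-inj ss′)) θ θ⁻¹ θ⁻¹-θ θ-θ⁻¹ π π⁻¹ π⁻¹-π π-π⁻¹ ρ inp-eq out-eq
    where open Rewiring R
  reify-rewire {suc k} {N = N} {N′} R ss ss′ = begin
    pull (gen (lab N′ zero)) (reify (cut zero N′) _)
      ≈⟨ pull-cong (reify-rewire (cut-rewiring R refl id λ _ → refl) (cut-single zero ss) (cut-single zero ss′)) ⟩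
    pull (gen (lab N′ zero)) (_ ⨾ reify (cut zero N) _ ⨾ _) ≈⟨ pull-relabel (Rewiring.lab-eq R refl) _ _ _ ⟩
    _ ∎

  reify-cong : {N N′ : Net S k V m n} (R : Rewiring id N N′) → Rewiring.π⁻¹ R ≗ id → Rewiring.ρ R ≗ id →
               (ss : SingleSource N) (ss′ : SingleSource N′) → reify N ss ≈ reify N′ ss′
  reify-cong R π-id ρ-id ss ss′ = ≈-sym (≈-trans (reify-rewire R ss ss′)
    (≈-trans (⨾-cong (≈-trans (fan-cong π-id) fan-id) (≈-trans (_ ⨾⟩ ≈-trans (fan-cong ρ-id) fan-id) (⨾-identityʳ _)))
             (⨾-identityˡ _)))

  legs-rewiring : (N : Net S k V m n) {inp′ : Fin m′ → Fin V} {out′ : Fin n′ → Fin V}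
                  (π : Fin m′ → Fin m) (π⁻¹ : Fin m → Fin m′) → π⁻¹ ∘ π ≗ id → π ∘ π⁻¹ ≗ id →
                  (ρ : Fin n′ → Fin n) → inp′ ≗ inp N ∘ π → out′ ≗ out N ∘ ρ →
                  Rewiring id N record { lab = lab N ; src = src N ; tgt = tgt N ; inp = inp′ ; out = out′ }
  legs-rewiring N π π⁻¹ π⁻¹-π π-π⁻¹ ρ inp-eq out-eq = record
    { θ = id ; θ⁻¹ = id ; θ⁻¹-θ = λ _ → refl ; θ-θ⁻¹ = λ _ → refl
    ; π = π ; π⁻¹ = π⁻¹ ; π⁻¹-π = π⁻¹-π ; π-π⁻¹ = π-π⁻¹ ; ρ = ρ
    ; lab-eq = λ { refl → refl }
    ; src-eq = λ { refl a → cong (src N _) (sym (cast-is-id refl a)) }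
    ; tgt-eq = λ { refl b → cong (tgt N _) (sym (cast-is-id refl b)) }
    ; inp-eq = inp-eq ; out-eq = out-eq
    }

  reify-legs : (N : Net S k V m n) {inp′ : Fin m → Fin V} {out′ : Fin n → Fin V} →
               inp′ ≗ inp N → out′ ≗ out N → (ss : SingleSource N) →
               (ss′ : SingleSource record { lab = lab N ; src = src N ; tgt = tgt N ; inp = inp′ ; out = out′ }) →
               reify N ss ≈ reify _ ss′
  reify-legs N inp-eq out-eq = reify-cong
    (legs-rewiring N id id (λ _ → refl) (λ _ → refl) id inp-eq out-eq) (λ _ → refl) (λ _ → refl)

  reify-cut : (p : Fin (suc k)) (N : Net S (suc k) V m n) (ss : SingleSource N) (ss′ : SingleSource (cut p N)) →
              reify N ss ≈ pull (gen (lab N p)) (reify (cut p N) ss′)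
  reify-cut zero N ss ss′ =
    pull-cong (reify-legs (cut zero N) (λ _ → refl) (λ _ → refl) (cut-single zero ss) ss′)
  reify-cut {suc k} {m = m} {n} (suc p) N ss ss′ = begin
    pull (gen φ₀) (reify (cut zero N) (cut-single zero ss))
      ≈⟨ pull-cong (reify-cut p (cut zero N) (cut-single zero ss) (cut-single p (cut-single zero ss))) ⟩
    pull (gen φ₀) (pull (gen φ) (reify (cut p (cut zero N)) (cut-single p (cut-single zero ss)))) ≈⟨ pull-pull (gen φ) (gen φ₀) _ ⟩
    pull (gen φ) (pull (gen φ₀) (fan (swapˡ c₁ c₀ m) ⨾ reify (cut p (cut zero N)) (cut-single p (cut-single zero ss)) ⨾ fan (swapˡ d₀ d₁ n)))
      ≈⟨ pull-cong (pull-cong (reify-rewire R (cut-single p (cut-single zero ss)) (cut-single zero ss′))) ⟨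
    pull (gen φ) (pull (gen φ₀) (reify (cut zero (cut (suc p) N)) (cut-single zero ss′))) ∎
    where
    φ₀ φ : Gen
    φ₀ = lab N zero
    φ = lab N (suc p)

    d₁ d₀ c₁ c₀ : ℕ
    d₁ = dom φ
    d₀ = dom φ₀
    c₁ = cod φ
    c₀ = cod φ₀

    swapped : ∀ {x y z} (f : Fin x → Fin _) (g : Fin y → Fin _) (h : Fin z → Fin _) →
              g ++ (f ++ h) ≗ (f ++ (g ++ h)) ∘ swapˡ y x z
    swapped {x} {y} {z} f g h = split₃-∀ y x
      (λ i → trans (++-↑ˡ _ _ i) (sym (trans (cong (f ++ (g ++ h)) (swapˡ₁ y x z i))
               (trans (++-↑ʳ f _ (i ↑ˡ z)) (++-↑ˡ _ _ i)))))
      (λ i → trans (++-↑ʳ g _ (i ↑ˡ z)) (trans (++-↑ˡ _ _ i)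
               (sym (trans (cong (f ++ (g ++ h)) (swapˡ₂ y x z i)) (++-↑ˡ _ _ i)))))
      (λ i → trans (++-↑ʳ g _ (x ↑ʳ i)) (trans (++-↑ʳ f _ i)
               (sym (trans (cong (f ++ (g ++ h)) (swapˡ₃ y x z i)) (trans (++-↑ʳ f _ (y ↑ʳ i)) (++-↑ʳ g _ i))))))

    R : Rewiring id (cut p (cut zero N)) (cut zero (cut (suc p) N))
    R = legs-rewiring (cut p (cut zero N)) (swapˡ c₀ c₁ m) (swapˡ c₁ c₀ m)
      (swapˡ-swapˡ c₀ c₁ m) (swapˡ-swapˡ c₁ c₀ m) (swapˡ d₀ d₁ n)
      (swapped (tgt N (suc p)) (tgt N zero) (inp N)) (swapped (src N (suc p)) (src N zero) (out N))

  reify-iso : {η : Fin k → Fin k} {N : Net S k V m n} {N′ : Net S k V′ m′ n′} → Inj η →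
              (R : Rewiring η N N′) (ss : SingleSource N) (ss′ : SingleSource N′) →
              reify N′ ss′ ≈ fan (Rewiring.π⁻¹ R) ⨾ reify N ss ⨾ fan (Rewiring.ρ R)
  reify-iso {zero} η-inj R ss ss′ =
    knot-rewire (complementOf (inp-inj ss)) (complementOf (inp-inj ss′)) θ θ⁻¹ θ⁻¹-θ θ-θ⁻¹ π π⁻¹ π⁻¹-π π-π⁻¹ ρ inp-eq out-eq
    where open Rewiring R
  reify-iso {suc k} {η = η} {N = N} {N′} η-inj R ss ss′ = begin
    reify N′ ss′ ≈⟨ reify-cut e₀ N′ ss′ (cut-single e₀ ss′) ⟩
    pull (gen (lab N′ e₀)) (reify (cut e₀ N′) _)
      ≈⟨ pull-cong (reify-iso η′-inj (cut-rewiring R refl η′ (λ e → punchIn-punchOut (e₀≢ e))) (cut-single zero ss) (cut-single e₀ ss′)) ⟩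
    pull (gen (lab N′ e₀)) (_ ⨾ reify (cut zero N) _ ⨾ _) ≈⟨ pull-relabel (Rewiring.lab-eq R refl) _ _ _ ⟩
    _ ∎
    where
    e₀ : Fin (suc k)
    e₀ = η zero

    e₀≢ : ∀ e → e₀ ≢ η (suc e)
    e₀≢ e eq with () ← η-inj eq

    η′ : Fin k → Fin k
    η′ e = punchOut (e₀≢ e)

    η′-inj : Inj η′
    η′-inj eq = suc-injective (η-inj (punchOut-injective (e₀≢ _) (e₀≢ _) eq))

module _ {S : Signature} where
  open Signature S
  open ≈-Reasoning {S}
  open Net
  open SingleSource

  knot-irrelevant : {inp : Fin m → Fin V} (c c′ : Complement inp) (out : Fin n → Fin V) →
                    knot {S} c out ≈ knot c′ out
  knot-irrelevant c c′ out = ≈-sym (≈-trans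
    (knot-rewire c c′ id id (λ _ → refl) (λ _ → refl) id id (λ _ → refl) (λ _ → refl) id (λ _ → refl) (λ _ → refl))
    (≈-trans (⨾-cong fan-id (≈-trans (_ ⨾⟩ fan-id) (⨾-identityʳ _))) (⨾-identityˡ _)))

  dropInput : Net S k V (suc m) n → Net S k V m n
  dropInput N = record { lab = lab N ; src = src N ; tgt = tgt N ; inp = inp N ∘ suc ; out = out N }

  dropInput-single : {N : Net S k V (suc m) n} → SingleSource N → SingleSource (dropInput N)
  dropInput-single ss = record
    { inp-inj  = suc-injective ∘ inp-inj ss
    ; tgt-inj  = tgt-inj ss
    ; tgt-edge = tgt-edge ss
    ; inp≢tgt  = inp≢tgt ss ∘ suc
    }

  private
    module _ {inp : Fin (suc m) → Fin V} (c : Complement inp) where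
      open Complement c

      lone⁺ : Fin (suc size) → Fin V
      lone⁺ zero    = inp zero
      lone⁺ (suc i) = lone i

      dropComplement : Complement (inp ∘ suc)
      dropComplement = record
        { size       = suc size
        ; lone       = lone⁺
        ; index      = swapˡ size 1 m ∘ index
        ; at-index   = λ v → trans (at (index v)) (at-index v)
        ; index-lone = λ where
            zero    → trans (cong (swapˡ size 1 m) (index-inp zero)) (swapˡ₂ size 1 m zero)
            (suc i) → trans (cong (swapˡ size 1 m) (index-lone i)) (swapˡ₁ size 1 m i)
        ; index-inp  = λ a → trans (cong (swapˡ size 1 m) (index-inp (suc a))) (swapˡ₃ size 1 m a)
        }
        where
        lone⁺++ : Fin (suc (size + m)) → Fin V
        lone⁺++ = lone⁺ ++ (inp ∘ suc)

        at : ∀ w → lone⁺++ (swapˡ size 1 m w) ≡ (lone ++ inp) w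
        at = split-∀ size
          (λ i → trans (cong lone⁺++ (swapˡ₁ size 1 m i)) (trans (++-↑ˡ lone⁺ _ (suc i)) (sym (++-↑ˡ lone _ i))))
          λ where
            zero    → trans (cong lone⁺++ (swapˡ₂ size 1 m zero)) (sym (++-↑ʳ lone inp zero))
            (suc a) → trans (cong lone⁺++ (swapˡ₃ size 1 m a)) (trans (++-↑ʳ lone⁺ _ a) (sym (++-↑ʳ lone inp (suc a))))

      knot-drop : (out : Fin n → Fin V) → (⋆ ⊗ idₜ m) ⨾ knot {S} c out ≈ knot dropComplement out
      knot-drop out = begin
        (⋆ ⊗ idₜ m) ⨾ Tr size (fan (knot-wiring {S} c out))
          ≈⟨ _ ⨾⟩ Tr-cong (cancelˡ (swapˡ-inverse 1 size m)) ⟨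
        (⋆ ⊗ idₜ m) ⨾ Tr size (fan (swapˡ 1 size m) ⨾ fan (swapˡ size 1 m) ⨾ fan (knot-wiring {S} c out))
          ≈⟨ Tr-⋆ size _ ⟨
        Tr size ((⋆ ⊗ idₜ (size + m)) ⨾ fan (swapˡ size 1 m) ⨾ fan (knot-wiring {S} c out))
          ≈⟨ Tr-cong (_ ⨾⟩ ≈-trans (fan-⨾ _ _) (fan-cong ψ-suc)) ⟩
        Tr size ((⋆ ⊗ idₜ (size + m)) ⨾ fan (ψ ∘ suc)) ≈⟨ Tr-cong (Tr₁-fan-zero ψ refl) ⟨
        Tr size (Tr 1 (fan ψ)) ≈⟨ Tr-vanishing₊ 1 size (fan ψ) ⟨
        Tr (suc size) (fan ψ) ∎
        where
        ψ : Fin (suc size + _) → Fin (suc size + m)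
        ψ = knot-wiring {S} dropComplement out

        ψ-suc : swapˡ size 1 m ∘ knot-wiring {S} c out ≗ ψ ∘ suc
        ψ-suc = split-∀ size
          (λ i → trans (cong (swapˡ size 1 m) (++-↑ˡ (_↑ˡ suc m) _ i)) (trans (swapˡ₁ size 1 m i) (sym (++-↑ˡ {m = suc size} _ _ (suc i)))))
          (λ b → trans (cong (swapˡ size 1 m) (++-↑ʳ {m = size} _ _ b)) (sym (++-↑ʳ {m = suc size} _ _ b)))

  ⋆-reify : (N : Net S k V (suc m) n) (ss : SingleSource N) (ss′ : SingleSource (dropInput N)) →
            (⋆ ⊗ idₜ m) ⨾ reify N ss ≈ reify (dropInput N) ss′
  ⋆-reify {zero} N ss ss′ = ≈-trans (knot-drop (complementOf (inp-inj ss)) (out N)) (knot-irrelevant (dropComplement (complementOf (inp-inj ss))) (complementOf (inp-inj ss′)) (out N))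
  ⋆-reify {suc k} {V} {m} {n} N ss ss′ = begin
    (⋆ ⊗ idₜ m) ⨾ pull (gen φ) (reify (cut zero N) (cut-single zero ss)) ≈⟨ pull-pre _ _ _ ⟩
    pull (gen φ) ((idₜ cφ ⊗ (⋆ ⊗ idₜ m)) ⨾ reify (cut zero N) (cut-single zero ss)) ≈⟨ pull-cong (begin
      (idₜ cφ ⊗ (⋆ ⊗ idₜ m)) ⨾ reify (cut zero N) (cut-single zero ss)
        ≈⟨ ≈-trans (⋆⊗-shift cφ m ⟨⨾ _) (≈-trans ⨾-assoc′ (_ ⨾⟩ cancelˡ (swapˡ-inverse 1 cφ m))) ⟨
      (⋆ ⊗ idₜ (cφ + m)) ⨾ fan (swapˡ cφ 1 m) ⨾ reify (cut zero N) (cut-single zero ss)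
        ≈⟨ _ ⨾⟩ _ ⨾⟩ ≈-trans (_ ⨾⟩ fan-id) (⨾-identityʳ _) ⟨
      (⋆ ⊗ idₜ (cφ + m)) ⨾ fan (swapˡ cφ 1 m) ⨾ reify (cut zero N) (cut-single zero ss) ⨾ fan id
        ≈⟨ _ ⨾⟩ reify-rewire R (cut-single zero ss) N′-single ⟨
      (⋆ ⊗ idₜ (cφ + m)) ⨾ reify N′ N′-single ≈⟨ ⋆-reify N′ N′-single (cut-single zero ss′) ⟩
      reify (cut zero (dropInput N)) (cut-single zero ss′) ∎) ⟩
    reify (dropInput N) ss′ ∎
    where
    φ : Gen
    φ = lab N zero

    cφ : ℕ
    cφ = cod φ

    inp′ : Fin (suc (cφ + m)) → Fin V
    inp′ zero    = inp N zero
    inp′ (suc i) = (tgt N zero ++ inp N ∘ suc) i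

    N′ : Net S k V (suc (cφ + m)) (dom φ + n)
    N′ = record { Net (cut zero N) ; inp = inp′ }

    inp′-swap : inp′ ≗ inp (cut zero N) ∘ swapˡ 1 cφ m
    inp′-swap zero = sym (trans (cong (tgt N zero ++ inp N) (swapˡ₁ 1 cφ m zero)) (++-↑ʳ (tgt N zero) _ zero))
    inp′-swap (suc i) = split-∀ cφ {P = λ i → (tgt N zero ++ inp N ∘ suc) i ≡ (tgt N zero ++ inp N) (swapˡ 1 cφ m (suc i))}
      (λ i → trans (++-↑ˡ (tgt N zero) _ i) (sym (trans (cong (tgt N zero ++ inp N) (swapˡ₂ 1 cφ m i)) (++-↑ˡ _ _ i))))
      (λ i → trans (++-↑ʳ (tgt N zero) _ i) (sym (trans (cong (tgt N zero ++ inp N) (swapˡ₃ 1 cφ m i)) (++-↑ʳ (tgt N zero) _ (suc i))))) i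

    R : Rewiring id (cut zero N) N′
    R = legs-rewiring (cut zero N) (swapˡ 1 cφ m) (swapˡ cφ 1 m) (swapˡ-swapˡ 1 cφ m) (swapˡ-swapˡ cφ 1 m) id inp′-swap (λ _ → refl)

    N′-single : SingleSource N′
    N′-single = record
      { inp-inj  = λ {x} {y} eq → trans (sym (swapˡ-swapˡ 1 cφ m x)) (trans (cong (swapˡ cφ 1 m)
                     (inp-inj (cut-single zero ss) (trans (sym (inp′-swap x)) (trans eq (inp′-swap y))))) (swapˡ-swapˡ 1 cφ m y))
      ; tgt-inj  = tgt-inj (cut-single zero ss)
      ; tgt-edge = tgt-edge (cut-single zero ss)
      ; inp≢tgt  = λ a e b eq → inp≢tgt (cut-single zero ss) (swapˡ 1 cφ m a) e b (trans (sym (inp′-swap a)) eq)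
      }

  fanNet : (Fin n → Fin m) → Net S 0 m m n
  fanNet ψ = record { lab = λ () ; src = λ () ; tgt = λ () ; inp = id ; out = ψ }

  fanNet-single : (ψ : Fin n → Fin m) → SingleSource (fanNet ψ)
  fanNet-single ψ = record { inp-inj = id ; tgt-inj = λ () ; tgt-edge = λ { {()} } ; inp≢tgt = λ _ () }

  reify-fanNet : (ψ : Fin n → Fin m) → reify (fanNet ψ) (fanNet-single ψ) ≈ fan ψ
  reify-fanNet {m = m} ψ = ≈-trans (knot-irrelevant (complementOf (inp-inj (fanNet-single ψ))) trivial ψ) (Tr-vanishing₀ _)
    where
    trivial : Complement (id {A = Fin m})
    trivial = record { size = 0 ; lone = λ () ; index = id ; at-index = λ _ → refl ; index-lone = λ () ; index-inp = λ _ → refl }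

  module _ (φ : Gen) (N : Net S k V (cod φ + m) (dom φ + n)) where
    private
      lab⁺ : Fin (suc k) → Gen
      lab⁺ zero    = φ
      lab⁺ (suc e) = lab N e

      src⁺ : ∀ e → Fin (dom (lab⁺ e)) → Fin V
      src⁺ zero    = out N ∘ (_↑ˡ n)
      src⁺ (suc e) = src N e

      tgt⁺ : ∀ e → Fin (cod (lab⁺ e)) → Fin V
      tgt⁺ zero    = inp N ∘ (_↑ˡ m)
      tgt⁺ (suc e) = tgt N e

    addEdge : Net S (suc k) V m n
    addEdge = record { lab = lab⁺ ; src = src⁺ ; tgt = tgt⁺ ; inp = inp N ∘ (cod φ ↑ʳ_) ; out = out N ∘ (dom φ ↑ʳ_) }

    addEdge-single : SingleSource N → SingleSource addEdge
    addEdge-single ss = record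
      { inp-inj  = λ eq → ↑ʳ-inj (inp-inj ss eq)
      ; tgt-inj  = λ where
          zero    eq → Fin.↑ˡ-injective m _ _ (inp-inj ss eq)
          (suc e) eq → tgt-inj ss e eq
      ; tgt-edge = λ {e} {e′} → same-edge e e′
      ; inp≢tgt  = λ where
          a zero    b eq → ↑ˡ≢↑ʳ b a (sym (inp-inj ss eq))
          a (suc e) b eq → inp≢tgt ss _ e b eq
      }
      where
      ↑ʳ-inj : ∀ {x y : Fin m} → cod φ ↑ʳ x ≡ cod φ ↑ʳ y → x ≡ y
      ↑ʳ-inj = Fin.↑ʳ-injective (cod φ) _ _

      same-edge : ∀ e e′ {b b′} → tgt⁺ e b ≡ tgt⁺ e′ b′ → e ≡ e′
      same-edge zero    zero     eq = refl
      same-edge zero    (suc e′) eq = contradiction eq (inp≢tgt ss _ e′ _)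
      same-edge (suc e) zero     eq = contradiction (sym eq) (inp≢tgt ss _ e _)
      same-edge (suc e) (suc e′) eq = cong suc (tgt-edge ss eq)

    reify-addEdge : (ss : SingleSource N) (ss′ : SingleSource addEdge) →
                    reify addEdge ss′ ≈ pull (gen φ) (reify N ss)
    reify-addEdge ss ss′ = pull-cong (≈-sym (reify-legs N (++-η {m = cod φ} (inp N)) (++-η {m = dom φ} (out N)) ss (cut-single zero ss′)))

  record Reification (f : Term S m n) : Set where
    constructor reification
    field
      {edges vertices} : ℕ
      {net}    : Net S edges vertices m n
      single   : SingleSource net
      ≈-reify  : f ≈ reify net single

  private
    form-reification : {f : Term S m n} → Form f → Reification f
    form-reification (fan-form ψ eq) =
      reification (fanNet-single ψ) (≈-trans eq (≈-sym (reify-fanNet ψ)))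
    form-reification (loop-form F eq) =
      let reification ss eq′ = form-reification F in
      reification (dropInput-single ss) (≈-trans eq (≈-trans (_ ⨾⟩ eq′) (⋆-reify _ ss (dropInput-single ss))))
    form-reification (pull-form φ F eq) =
      let reification {net = N} ss eq′ = form-reification F in
      reification (addEdge-single φ N ss)
        (≈-trans eq (≈-trans (pull-cong eq′) (≈-sym (reify-addEdge φ N ss (addEdge-single φ N ss)))))

  toReification : (f : Term S m n) → Reification f
  toReification f = form-reification (form f)

-- Homomorphisms out of an interpretation

module _ {S : Signature} where
  open Signature S
  open Hypergraph

  record Region (H : Hypergraph S) : Set₁ where
    field
      vertices : Vertex H → Set
      edges    : Edge H → Set

  open Region

  -- The homomorphisms from ⟦ f ⟧ to H restricting to u and w on the legs.
  Φ : (H : Hypergraph S) → Term S m n → (Fin m → Vertex H) → (Fin n → Vertex H) → Set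
  Φ H (gen φ)  u w = Σ[ e ∈ Edge H ] Σ[ eq ∈ φ ≡ label H e ]
                     (∀ a → u a ≡ source H e (Fin.cast (cong dom eq) a)) ×
                     (∀ b → w b ≡ target H e (Fin.cast (cong cod eq) b))
  Φ H δ        u w = ∀ b → w b ≡ u zero
  Φ H ε        u w = ⊤
  Φ H (idₜ n)  u w = w ≗ u
  Φ H (σ m n)  u w = w ≗ u ∘ swap m n
  Φ H (f ⨾ g)  u w = Σ[ v ∈ _ ] Φ H f u v × Φ H g v w
  Φ H (_⊗_ {m} {n} f g) u w = Φ H f (u ∘ (_↑ˡ _)) (w ∘ (_↑ˡ _)) × Φ H g (u ∘ (m ↑ʳ_)) (w ∘ (n ↑ʳ_))
  Φ H (Tr x f) u w = Σ[ t ∈ (Fin x → Vertex H) ] Φ H f (t ++ u) (t ++ w)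

  private variable
    H : Hypergraph S
    f g h : Term S m n

  -- The image of the homomorphism lies in K.
  All : (K : Region H) (f : Term S m n) {u : Fin m → Vertex H} {w : Fin n → Vertex H} → Φ H f u w → Set
  All K (gen φ) {u} {w} (e , _) = edges K e × (∀ a → vertices K (u a)) × (∀ b → vertices K (w b))
  All K δ {u} _           = vertices K (u zero)
  All K ε {u} _           = vertices K (u zero)
  All K (idₜ n) {u} _           = ∀ a → vertices K (u a)
  All K (σ m n) {u} _           = ∀ a → vertices K (u a)
  All K (f ⨾ g)  (_ , p , q) = All K f p × All K g q
  All K (f ⊗ g)  (p , q)     = All K f p × All K g q
  All K (Tr x f) (_ , p)     = All K f p

  All-boundary : (K : Region H) (f : Term S m n) {u : Fin m → Vertex H} {w : Fin n → Vertex H} (p : Φ H f u w) → All K f p →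
                 (∀ a → vertices K (u a)) × (∀ b → vertices K (w b))
  All-boundary K (gen φ) _ (_ , Ku , Kw) = Ku , Kw
  All-boundary K δ p Ku = (λ { zero → Ku }) , λ b → subst (vertices K) (sym (p b)) Ku
  All-boundary K ε p Ku = (λ { zero → Ku }) , λ ()
  All-boundary K (idₜ n) p Ku = Ku , λ b → subst (vertices K) (sym (p b)) (Ku b)
  All-boundary K (σ m n) p Ku = Ku , λ b → subst (vertices K) (sym (p b)) (Ku _)
  All-boundary K (f ⨾ g) (_ , p , q) (Kp , Kq) =
    proj₁ (All-boundary K f p Kp) , proj₂ (All-boundary K g q Kq)
  All-boundary K (_⊗_ {m} {n} f g) (p , q) (Kp , Kq) =
    let Kpu , Kpw = All-boundary K f p Kp
        Kqu , Kqw = All-boundary K g q Kq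
    in split-∀ m Kpu Kqu , split-∀ n Kpw Kqw
  All-boundary K (Tr x f) {u} {w} (t , p) Kp =
    let Ku , Kw = All-boundary K f p Kp
    in (λ a → subst (vertices K) (++-↑ʳ t u a) (Ku _)) , λ b → subst (vertices K) (++-↑ʳ t w b) (Kw _)

  All-inputs : (K : Region H) (f : Term S m n) {u : Fin m → Vertex H} {w : Fin n → Vertex H} {p : Φ H f u w} → All K f p → ∀ a → vertices K (u a)
  All-inputs K f {p = p} Kp = proj₁ (All-boundary K f p Kp)

  All-outputs : (K : Region H) (f : Term S m n) {u : Fin m → Vertex H} {w : Fin n → Vertex H} {p : Φ H f u w} → All K f p → ∀ b → vertices K (w b)
  All-outputs K f {p = p} Kp = proj₂ (All-boundary K f p Kp)

  module _ {H : Hypergraph S} {K K′ : Region H}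
           (V⊆ : ∀ {v} → vertices K v → vertices K′ v) (E⊆ : ∀ {e} → edges K e → edges K′ e) where

    All-mono : {u : Fin m → Vertex H} {w : Fin n → Vertex H} (f : Term S m n) (p : Φ H f u w) → All K f p → All K′ f p
    All-mono (gen φ)  _ (Ke , Ku , Kw)      = E⊆ Ke , V⊆ ∘ Ku , V⊆ ∘ Kw
    All-mono δ        _ Ku                  = V⊆ Ku
    All-mono ε        _ Ku                  = V⊆ Ku
    All-mono (idₜ n)  _ Ku                  = V⊆ ∘ Ku
    All-mono (σ m n)  _ Ku                  = V⊆ ∘ Ku
    All-mono (f ⨾ g)  (_ , p , q) (Kp , Kq) = All-mono f p Kp , All-mono g q Kq
    All-mono (f ⊗ g)  (p , q) (Kp , Kq)     = All-mono f p Kp , All-mono g q Kq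
    All-mono (Tr x f) (_ , p) Kp            = All-mono f p Kp

  Φ-resp : (f : Term S m n) {u u′ : Fin m → Vertex H} {w w′ : Fin n → Vertex H} → u ≗ u′ → w ≗ w′ → Φ H f u w → Φ H f u′ w′
  Φ-resp (gen φ) u≗ w≗ (e , eq , us , ws) =
    e , eq , (λ a → trans (sym (u≗ a)) (us a)) , λ b → trans (sym (w≗ b)) (ws b)
  Φ-resp δ u≗ w≗ p = λ b → trans (sym (w≗ b)) (trans (p b) (u≗ zero))
  Φ-resp ε u≗ w≗ p = tt
  Φ-resp (idₜ n) u≗ w≗ p = λ b → trans (sym (w≗ b)) (trans (p b) (u≗ b))
  Φ-resp (σ m n) u≗ w≗ p = λ b → trans (sym (w≗ b)) (trans (p b) (u≗ _))
  Φ-resp (f ⨾ g) u≗ w≗ (v , p , q) = v , Φ-resp f u≗ (λ _ → refl) p , Φ-resp g (λ _ → refl) w≗ q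
  Φ-resp (_⊗_ {m} {n} f g) u≗ w≗ (p , q) = Φ-resp f (λ a → u≗ _) (λ b → w≗ _) p , Φ-resp g (λ a → u≗ _) (λ b → w≗ _) q
  Φ-resp (Tr x f) u≗ w≗ (t , p) = t , Φ-resp f (++-cong (λ _ → refl) u≗) (++-cong (λ _ → refl) w≗) p

  All-resp : (K : Region H) (f : Term S m n) {u u′ : Fin m → Vertex H} {w w′ : Fin n → Vertex H} (u≗ : u ≗ u′) (w≗ : w ≗ w′) (p : Φ H f u w) →
             All K f (Φ-resp f u≗ w≗ p) → All K f p
  All-resp K (gen φ) u≗ w≗ p (Ke , Ku , Kw) =
    Ke , (λ a → subst (vertices K) (sym (u≗ a)) (Ku a)) , λ b → subst (vertices K) (sym (w≗ b)) (Kw b)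
  All-resp K δ u≗ w≗ p Ku = subst (vertices K) (sym (u≗ zero)) Ku
  All-resp K ε u≗ w≗ p Ku = subst (vertices K) (sym (u≗ zero)) Ku
  All-resp K (idₜ n) u≗ w≗ p Ku = λ a → subst (vertices K) (sym (u≗ a)) (Ku a)
  All-resp K (σ m n) u≗ w≗ p Ku = λ a → subst (vertices K) (sym (u≗ a)) (Ku a)
  All-resp K (f ⨾ g) u≗ w≗ (_ , p , q) (Kp , Kq) = All-resp K f _ _ p Kp , All-resp K g _ _ q Kq
  All-resp K (f ⊗ g) u≗ w≗ (p , q) (Kp , Kq) = All-resp K f _ _ p Kp , All-resp K g _ _ q Kq
  All-resp K (Tr x f) u≗ w≗ (_ , p) Kp = All-resp K f _ _ p Kp

  infix 4 _⊑_

  _⊑_ : Term S m n → Term S m n → Set₁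
  _⊑_ {m} {n} f g = ∀ H (u : Fin m → Vertex H) (w : Fin n → Vertex H) (p : Φ H f u w) →
    Σ[ q ∈ Φ H g u w ] (∀ K → All K g q → All K f p)

  module _ {H : Hypergraph S} where

    castΦ : (eq : m ≡ m′) (eq′ : n ≡ n′) (f : Term S m n) {u : Fin m′ → Vertex H} {w : Fin n′ → Vertex H} →
            Φ H (cast eq eq′ f) u w → Φ H f (u ∘ Fin.cast eq) (w ∘ Fin.cast eq′)
    castΦ refl refl f {u} {w} = Φ-resp f (λ a → cong u (sym (cast-is-id refl a))) (λ b → cong w (sym (cast-is-id refl b)))

    castΦ-All : (K : Region H) (eq : m ≡ m′) (eq′ : n ≡ n′) (f : Term S m n) {u : Fin m′ → Vertex H} {w : Fin n′ → Vertex H}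
                (p : Φ H (cast eq eq′ f) u w) → All K f (castΦ eq eq′ f p) → All K (cast eq eq′ f) p
    castΦ-All K refl refl f {u} {w} p = All-resp K f {u} {_} {w} _ _ p

    uncastΦ : (eq : m ≡ m′) (eq′ : n ≡ n′) (f : Term S m n) {u : Fin m′ → Vertex H} {w : Fin n′ → Vertex H} →
              Φ H f (u ∘ Fin.cast eq) (w ∘ Fin.cast eq′) → Φ H (cast eq eq′ f) u w
    uncastΦ refl refl f {u} {w} = Φ-resp f (λ a → cong u (cast-is-id refl a)) (λ b → cong w (cast-is-id refl b))

    uncastΦ-All : (K : Region H) (eq : m ≡ m′) (eq′ : n ≡ n′) (f : Term S m n) {u : Fin m′ → Vertex H} {w : Fin n′ → Vertex H}
                  (p : Φ H f (u ∘ Fin.cast eq) (w ∘ Fin.cast eq′)) →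
                  All K (cast eq eq′ f) (uncastΦ eq eq′ f {u} {w} p) → All K f p
    uncastΦ-All K refl refl f {u} {w} p = All-resp K f {_} {u} {_} {w} _ _ p

  record Wiring (f : Term S m n) (φ : Fin n → Fin m) : Set₁ where
    field
      to   : {u : Fin m → Vertex H} {w : Fin n → Vertex H} → Φ H f u w → w ≗ u ∘ φ
      from : {u : Fin m → Vertex H} {w : Fin n → Vertex H} → w ≗ u ∘ φ → Φ H f u w
      all  : (K : Region H) {u : Fin m → Vertex H} {w : Fin n → Vertex H} (p : Φ H f u w) →
             (∀ a → vertices K (u a)) → All K f p

  open Wiring

  Wiring-≗ : {φ ψ : Fin n → Fin m} → φ ≗ ψ → Wiring f φ → Wiring f ψ
  Wiring-≗ eq F = record
    { to   = λ {u = u} p b → trans (to F p b) (cong u (eq b))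
    ; from = λ {u = u} p → from F (λ b → trans (p b) (cong u (sym (eq b))))
    ; all  = all F
    }

  Wiring-⊑ : {φ ψ : Fin n → Fin m} → Wiring f φ → Wiring g ψ → φ ≗ ψ → f ⊑ g
  Wiring-⊑ {g = g} F G eq _ u w p =
    from G (λ b → trans (to F p b) (cong u (eq b))) , λ K Kq → all F K p (All-inputs K g Kq)

  Wiring-id : Wiring (idₜ n) id
  Wiring-id = record { to = id ; from = id ; all = λ K p → id }

  Wiring-σ : ∀ m n → Wiring (σ m n) (swap m n)
  Wiring-σ m n = record { to = id ; from = id ; all = λ K p → id }

  Wiring-δ : Wiring δ (λ _ → zero)
  Wiring-δ = record { to = id ; from = id ; all = λ K p Ku → Ku zero }

  Wiring-ε : Wiring ε (λ ())
  Wiring-ε = record { to = λ _ () ; from = λ _ → tt ; all = λ K p Ku → Ku zero }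

  Wiring-⨾ : {φ : Fin n → Fin m} {ψ : Fin p → Fin n} → Wiring f φ → Wiring g ψ → Wiring (f ⨾ g) (φ ∘ ψ)
  Wiring-⨾ {f = f} {φ = φ} {ψ} F G = record
    { to   = λ { (v , p , q) b → trans (to G q b) (to F p (ψ b)) }
    ; from = λ {u = u} eq → u ∘ φ , from F (λ _ → refl) , from G eq
    ; all  = λ { K (v , p , q) Ku → let Kp = all F K p Ku in Kp , all G K q (All-outputs K f Kp) }
    }

  Wiring-⊗ : {φ : Fin n → Fin m} {ψ : Fin q → Fin p} → Wiring f φ → Wiring g ψ → Wiring (f ⊗ g) (φ ⊞ ψ)
  Wiring-⊗ {n} {m} {q} {p} {φ = φ} {ψ} F G = record
    { to   = λ { {u = u} {w = w} (p , q) → split-∀ n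
        (λ b → trans (to F p b) (cong u (sym (++-↑ˡ _ _ b))))
        (λ b → trans (to G q b) (cong u (sym (++-↑ʳ {m = n} _ _ b)))) }
    ; from = λ {u = u} eq →
        from F (λ b → trans (eq _) (cong u (++-↑ˡ _ _ b))) ,
        from G (λ b → trans (eq _) (cong u (++-↑ʳ {m = n} _ _ b)))
    ; all  = λ { K (p , q) Ku → all F K p (λ a → Ku _) , all G K q (λ a → Ku _) }
    }

  Wiring-cast : (eq : m ≡ m′) (eq′ : n ≡ n′) {φ : Fin n → Fin m} → Wiring f φ →
                Wiring (cast eq eq′ f) (Fin.cast eq ∘ φ ∘ Fin.cast (sym eq′))
  Wiring-cast refl refl {φ} = Wiring-≗ λ b → sym (trans (cast-is-id refl _) (cong φ (cast-is-id refl b)))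

  opaque
    unfolding fan

    Wiring-discard : ∀ m → Wiring (discard m) (λ ())
    Wiring-discard zero    = Wiring-≗ (λ ()) Wiring-id
    Wiring-discard (suc m) = Wiring-≗ (λ ()) (Wiring-⊗ Wiring-ε (Wiring-discard m))

    Wiring-dup : (a : Fin m) → Wiring (dup a) λ { zero → a ; (suc b) → b }
    Wiring-dup {suc m} zero = Wiring-≗ (λ { zero → refl ; (suc zero) → refl ; (suc (suc b)) → refl }) (Wiring-⊗ Wiring-δ (Wiring-id {m}))
    Wiring-dup {suc m} (suc a) = Wiring-≗ (λ { zero → refl ; (suc zero) → refl ; (suc (suc b)) → refl })
      (Wiring-⨾ (Wiring-⊗ (Wiring-id {1}) (Wiring-dup a)) (Wiring-⊗ (Wiring-σ 1 1) (Wiring-id {m})))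

    Wiring-fan : (φ : Fin n → Fin m) → Wiring (fan φ) φ
    Wiring-fan {zero}  φ = Wiring-≗ (λ ()) (Wiring-discard _)
    Wiring-fan {suc n} φ = Wiring-≗ (λ { zero → refl ; (suc b) → refl })
      (Wiring-⨾ (Wiring-dup (φ zero)) (Wiring-⊗ (Wiring-id {1}) (Wiring-fan (φ ∘ suc))))

  private
    ⊑-resp : (f : Term S m n) {u u′ : Fin m → Vertex H} {w w′ : Fin n → Vertex H} → u ≗ u′ → w ≗ w′ → (p : Φ H f u w) →
             Σ[ q ∈ Φ H f u′ w′ ] (∀ K → All K f q → All K f p)
    ⊑-resp f u≗ w≗ p = Φ-resp f u≗ w≗ p , λ K → All-resp K f u≗ w≗ p

    ⊗-identityʳ-⊑ : (f : Term S m n) → cast (+-identityʳ m) (+-identityʳ n) (f ⊗ idₜ 0) ⊑ f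
    ⊗-identityʳ-⊑ {m} {n} f H u w p =
      let p₁ , p₂ = castΦ {H} (+-identityʳ m) (+-identityʳ n) (f ⊗ idₜ 0) {u} {w} p
          q , ref = ⊑-resp f (λ a → cong u (unit a)) (λ b → cong w (unit b)) p₁
      in q , λ K Kq → castΦ-All K (+-identityʳ m) (+-identityʳ n) (f ⊗ idₜ 0) {u} {w} p (ref K Kq , λ ())
      where
      unit : ∀ {m} (a : Fin m) → Fin.cast (+-identityʳ m) (a ↑ˡ 0) ≡ a
      unit a = toℕ-injective (trans (toℕ-cast _ _) (toℕ-↑ˡ a 0))

    ⊗-identityʳ-⊒ : (f : Term S m n) → f ⊑ cast (+-identityʳ m) (+-identityʳ n) (f ⊗ idₜ 0)
    ⊗-identityʳ-⊒ {m} {n} f H u w p =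
      let p₁ , ref = ⊑-resp f (λ a → cong u (unit a)) (λ b → cong w (unit b)) p
          p₂ = p₁ , λ ()
      in uncastΦ {H} (+-identityʳ m) (+-identityʳ n) (f ⊗ idₜ 0) {u} {w} p₂ , λ K Kq →
         ref K (proj₁ (uncastΦ-All K (+-identityʳ m) (+-identityʳ n) (f ⊗ idₜ 0) {u} {w} p₂ Kq))
      where
      unit : ∀ {m} (a : Fin m) → a ≡ Fin.cast (+-identityʳ m) (a ↑ˡ 0)
      unit a = sym (toℕ-injective (trans (toℕ-cast _ _) (toℕ-↑ˡ a 0)))

    ⊗-assoc-⊑ : (f : Term S m n) (g : Term S p q) (h : Term S r s) →
                cast (+-assoc m p r) (+-assoc n q s) ((f ⊗ g) ⊗ h) ⊑ f ⊗ (g ⊗ h)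
    ⊗-assoc-⊑ {m} {n} {p} {q} {r} {s} f g h H u w P =
      let e₁ = +-assoc m p r
          e₂ = +-assoc n q s
          F = (f ⊗ g) ⊗ h
          (a , b) , c = castΦ {H} e₁ e₂ F {u} {w} P
          a′ , ra = ⊑-resp f (λ i → cong u (assoc-↑ˡ↑ˡ p r i)) (λ i → cong w (assoc-↑ˡ↑ˡ q s i)) a
          b′ , rb = ⊑-resp g (λ i → cong u (assoc-↑ʳ↑ˡ m r i)) (λ i → cong w (assoc-↑ʳ↑ˡ n s i)) b
          c′ , rc = ⊑-resp h (λ i → cong u (assoc-↑ʳ m p i)) (λ i → cong w (assoc-↑ʳ n q i)) c
      in (a′ , b′ , c′) , λ K (Ka , Kb , Kc) →
         castΦ-All K e₁ e₂ F {u} {w} P ((ra K Ka , rb K Kb) , rc K Kc)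

    ⊗-assoc-⊒ : (f : Term S m n) (g : Term S p q) (h : Term S r s) →
                f ⊗ (g ⊗ h) ⊑ cast (+-assoc m p r) (+-assoc n q s) ((f ⊗ g) ⊗ h)
    ⊗-assoc-⊒ {m} {n} {p} {q} {r} {s} f g h H u w (a , b , c) =
      let e₁ = +-assoc m p r
          e₂ = +-assoc n q s
          F = (f ⊗ g) ⊗ h
          a′ , ra = ⊑-resp f (λ i → cong u (sym (assoc-↑ˡ↑ˡ p r i))) (λ i → cong w (sym (assoc-↑ˡ↑ˡ q s i))) a
          b′ , rb = ⊑-resp g (λ i → cong u (sym (assoc-↑ʳ↑ˡ m r i))) (λ i → cong w (sym (assoc-↑ʳ↑ˡ n s i))) b
          c′ , rc = ⊑-resp h (λ i → cong u (sym (assoc-↑ʳ m p i))) (λ i → cong w (sym (assoc-↑ʳ n q i))) c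
          P = (a′ , b′) , c′
      in uncastΦ {H} e₁ e₂ F {u} {w} P , λ K KP →
         let (Ka , Kb) , Kc = uncastΦ-All K e₁ e₂ F {u} {w} P KP
         in ra K Ka , rb K Kb , rc K Kc

    interchange-⊑ : (f : Term S m n) (g : Term S n p) (h : Term S q r) (k : Term S r s) →
                    (f ⨾ g) ⊗ (h ⨾ k) ⊑ (f ⊗ h) ⨾ (g ⊗ k)
    interchange-⊑ {n = n} f g h k H u w ((v , a , b) , (v′ , c , d)) =
      let inl = λ i → sym (++-↑ˡ v v′ i)
          inr = λ i → sym (++-↑ʳ v v′ i)
          a′ , ra = ⊑-resp f (λ _ → refl) inl a
          b′ , rb = ⊑-resp g inl (λ _ → refl) b
          c′ , rc = ⊑-resp h (λ _ → refl) inr c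
          d′ , rd = ⊑-resp k inr (λ _ → refl) d
      in (v ++ v′ , (a′ , c′) , (b′ , d′)) , λ K ((Ka , Kc) , (Kb , Kd)) →
         (ra K Ka , rb K Kb) , (rc K Kc , rd K Kd)

    σ-natural-⊑ : (f : Term S m n) (g : Term S p q) → (f ⊗ g) ⨾ σ n q ⊑ σ m p ⨾ (g ⊗ f)
    σ-natural-⊑ {m} {n} {p} {q} f g H u w (v , (a , b) , eq) =
      let a′ , ra = ⊑-resp f (λ i → cong u (sym (++-↑ʳ (m ↑ʳ_) (_↑ˡ p) i)))
                             (λ i → sym (trans (eq _) (cong v (++-↑ʳ (n ↑ʳ_) (_↑ˡ q) i)))) a
          b′ , rb = ⊑-resp g (λ i → cong u (sym (++-↑ˡ (m ↑ʳ_) (_↑ˡ p) i)))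
                             (λ i → sym (trans (eq _) (cong v (++-↑ˡ (n ↑ʳ_) (_↑ˡ q) i)))) b
      in (u ∘ swap m p , (λ _ → refl) , b′ , a′) , λ K (_ , Kb , Ka) →
         let Ka′ = ra K Ka
             Kb′ = rb K Kb
         in (Ka′ , Kb′) , split-∀ n (All-outputs K f Ka′) (All-outputs K g Kb′)

    σ-natural-⊒ : (f : Term S m n) (g : Term S p q) → σ m p ⨾ (g ⊗ f) ⊑ (f ⊗ g) ⨾ σ n q
    σ-natural-⊒ {m} {n} {p} {q} f g H u w (v , eq , (b , a)) =
      let a′ , ra = ⊑-resp f (λ i → trans (eq _) (cong u (++-↑ʳ (m ↑ʳ_) (_↑ˡ p) i)))
                             (λ i → cong w (sym (++-↑ˡ (q ↑ʳ_) (_↑ˡ n) i))) a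
          b′ , rb = ⊑-resp g (λ i → trans (eq _) (cong u (++-↑ˡ (m ↑ʳ_) (_↑ˡ p) i)))
                             (λ i → cong w (sym (++-↑ʳ (q ↑ʳ_) (_↑ˡ n) i))) b
      in (w ∘ swap q n , (a′ , b′) , λ i → cong w (sym (swap-swap q n i))) , λ K ((Ka , Kb) , _) →
         split-∀ m (All-inputs K f Ka) (All-inputs K g Kb) , rb K Kb , ra K Ka

    tightening-⊑ : (f : Term S m n) (g : Term S (x + n) (x + p)) (h : Term S p q) →
                   Tr x ((idₜ x ⊗ f) ⨾ g ⨾ (idₜ x ⊗ h)) ⊑ f ⨾ Tr x g ⨾ h
    tightening-⊑ {x = x} f g h H u w (t , v , (eq , a) , v′ , b , (eq′ , c)) =
      let a′ , ra = ⊑-resp f (λ i → ++-↑ʳ t u i) (λ _ → refl) a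
          b′ , rb = ⊑-resp g (λ i → sym (++-unique {h = v} (λ i → sym (trans (eq i) (++-↑ˡ t u i))) (λ _ → refl) i))
                             (λ i → sym (++-unique {h = v′} (λ i → trans (sym (++-↑ˡ t w i)) (eq′ i)) (λ _ → refl) i)) b
          c′ , rc = ⊑-resp h (λ _ → refl) (λ i → ++-↑ʳ t w i) c
      in (v ∘ (x ↑ʳ_) , a′ , v′ ∘ (x ↑ʳ_) , (t , b′) , c′) , λ K (Ka , Kb , Kc) →
         let Kb′ = rb K Kb
         in ((λ i → subst (vertices K) (eq i) (All-inputs K g Kb′ _)) , ra K Ka) , Kb′ ,
            (λ i → All-outputs K g Kb′ _) , rc K Kc

    tightening-⊒ : (f : Term S m n) (g : Term S (x + n) (x + p)) (h : Term S p q) →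
                   f ⨾ Tr x g ⨾ h ⊑ Tr x ((idₜ x ⊗ f) ⨾ g ⨾ (idₜ x ⊗ h))
    tightening-⊒ {x = x} f g h H u w (v , a , v′ , (t , b) , c) =
      let a′ , ra = ⊑-resp f (λ i → sym (++-↑ʳ t u i)) (λ i → sym (++-↑ʳ t v i)) a
          c′ , rc = ⊑-resp h (λ i → sym (++-↑ʳ t v′ i)) (λ i → sym (++-↑ʳ t w i)) c
      in (t , t ++ v , ((λ i → trans (++-↑ˡ t v i) (sym (++-↑ˡ t u i))) , a′) , t ++ v′ , b ,
          ((λ i → trans (++-↑ˡ t w i) (sym (++-↑ˡ t v′ i))) , c′)) ,
         λ K ((_ , Ka) , Kb , (_ , Kc)) → ra K Ka , Kb , rc K Kc

    sliding-⊑ : (f : Term S (x + m) (y + n)) (g : Term S y x) → Tr x (f ⨾ (g ⊗ idₜ n)) ⊑ Tr y ((g ⊗ idₜ m) ⨾ f)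
    sliding-⊑ {x} {m} {y} {n} f g H u w (t , v , a , (b , eq)) =
      let t′ = v ∘ (_↑ˡ n)
          a′ , ra = ⊑-resp f (λ _ → refl) (λ i → sym (++-unique {f = t′} {g = w} {h = v} (λ _ → refl) (λ j → trans (sym (++-↑ʳ t w j)) (eq j)) i)) a
          b′ , rb = ⊑-resp g (λ i → sym (++-↑ˡ t′ u i)) (λ i → trans (++-↑ˡ t w i) (sym (++-↑ˡ t u i))) b
      in (t′ , t ++ u , (b′ , (λ i → trans (++-↑ʳ t u i) (sym (++-↑ʳ t′ u i)))) , a′) , λ K ((Kb , _) , Ka) →
         let Ka′ = ra K Ka in Ka′ , rb K Kb , λ i → All-outputs K f Ka′ _

    sliding-⊒ : (f : Term S (x + m) (y + n)) (g : Term S y x) → Tr y ((g ⊗ idₜ m) ⨾ f) ⊑ Tr x (f ⨾ (g ⊗ idₜ n))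
    sliding-⊒ {x} {m} {y} {n} f g H u w (t , v , (b , eq) , a) =
      let t′ = v ∘ (_↑ˡ m)
          a′ , ra = ⊑-resp f (λ i → sym (++-unique {f = t′} {g = u} {h = v} (λ _ → refl) (λ j → sym (trans (eq j) (++-↑ʳ t u j))) i)) (λ _ → refl) a
          b′ , rb = ⊑-resp g (λ i → trans (++-↑ˡ t u i) (sym (++-↑ˡ t w i))) (λ i → sym (++-↑ˡ t′ w i)) b
      in (t′ , t ++ w , a′ , (b′ , λ i → trans (++-↑ʳ t′ w i) (sym (++-↑ʳ t w i)))) , λ K (Ka , (Kb , _)) →
         let Ka′ = ra K Ka in (rb K Kb , λ i → subst (vertices K) (eq i) (All-inputs K f Ka′ _)) , Ka′

    ++-assoc : ∀ {A : Set} x y (t : Fin x → A) (t′ : Fin y → A) (u : Fin m → A) →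
               (t ++ t′ ++ u) ∘ Fin.cast (+-assoc x y m) ≗ (t ++ t′) ++ u
    ++-assoc {m} x y t t′ u = split-∀ (x + y) (split-∀ x
      (λ i → trans (cong (t ++ t′ ++ u) (assoc-↑ˡ↑ˡ y m i)) (trans (++-↑ˡ t _ i)
               (sym (trans (++-↑ˡ (t ++ t′) u (i ↑ˡ y)) (++-↑ˡ t t′ i)))))
      (λ i → trans (cong (t ++ t′ ++ u) (assoc-↑ʳ↑ˡ x m i)) (trans (++-↑ʳ t _ (i ↑ˡ m)) (trans (++-↑ˡ t′ u i)
               (sym (trans (++-↑ˡ (t ++ t′) u (x ↑ʳ i)) (++-↑ʳ t t′ i)))))))
      (λ i → trans (cong (t ++ t′ ++ u) (assoc-↑ʳ x y i)) (trans (++-↑ʳ t _ (y ↑ʳ i)) (trans (++-↑ʳ t′ u i)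
               (sym (++-↑ʳ (t ++ t′) u i)))))

    vanishing-⊑ : ∀ x y (f : Term S ((x + y) + m) ((x + y) + n)) →
                  Tr (x + y) f ⊑ Tr y (Tr x (cast (+-assoc x y m) (+-assoc x y n) f))
    vanishing-⊑ {m} {n} x y f H u w (t , p) =
      let t₁ = t ∘ (_↑ˡ y)
          t₂ = t ∘ (x ↑ʳ_)
          regroup = λ {k} (v : Fin k → _) i → trans (++-cong {g = v} (λ j → sym (++-η {m = x} t j)) (λ _ → refl) i) (sym (++-assoc x y t₁ t₂ v i))
          p′ , ref = ⊑-resp f (regroup u) (regroup w) p
      in (t₂ , t₁ , uncastΦ (+-assoc x y m) (+-assoc x y n) f {t₁ ++ t₂ ++ u} {t₁ ++ t₂ ++ w} p′) , λ K Kq →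
         ref K (uncastΦ-All K (+-assoc x y m) (+-assoc x y n) f {t₁ ++ t₂ ++ u} {t₁ ++ t₂ ++ w} p′ Kq)

    vanishing-⊒ : ∀ x y (f : Term S ((x + y) + m) ((x + y) + n)) →
                  Tr y (Tr x (cast (+-assoc x y m) (+-assoc x y n) f)) ⊑ Tr (x + y) f
    vanishing-⊒ {m} {n} x y f H u w (t₂ , t₁ , p) =
      let p′ , ref = ⊑-resp f (++-assoc x y t₁ t₂ u) (++-assoc x y t₁ t₂ w) (castΦ (+-assoc x y m) (+-assoc x y n) f p)
      in (t₁ ++ t₂ , p′) , λ K Kq → castΦ-All K (+-assoc x y m) (+-assoc x y n) f p (ref K Kq)

    module _ {A : Set} {x m p : ℕ} (t : Fin x → A) (u : Fin (m + p) → A) where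

      superpose₁ : (t ++ u) ∘ Fin.cast (+-assoc x m p) ∘ (_↑ˡ p) ≗ t ++ (u ∘ (_↑ˡ p))
      superpose₁ i = sym (++-unique {f = t} {g = u ∘ (_↑ˡ p)} {h = (t ++ u) ∘ Fin.cast (+-assoc x m p) ∘ (_↑ˡ p)}
        (λ j → sym (trans (cong (t ++ u) (assoc-↑ˡ↑ˡ m p j)) (++-↑ˡ t u j)))
        (λ j → sym (trans (cong (t ++ u) (assoc-↑ʳ↑ˡ x p j)) (++-↑ʳ t u (j ↑ˡ p)))) i)

      superpose₂ : (t ++ u) ∘ Fin.cast (+-assoc x m p) ∘ ((x + m) ↑ʳ_) ≗ u ∘ (m ↑ʳ_)
      superpose₂ i = trans (cong (t ++ u) (assoc-↑ʳ x m i)) (++-↑ʳ t u (m ↑ʳ i))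

    superposing-⊑ : (f : Term S (x + m) (x + n)) (g : Term S p q) →
                    Tr x (cast (+-assoc x m p) (+-assoc x n q) (f ⊗ g)) ⊑ Tr x f ⊗ g
    superposing-⊑ {x} {m} {n} {p} {q} f g H u w (t , P) =
      let e₁ = +-assoc x m p
          e₂ = +-assoc x n q
          F = f ⊗ g
          a , b = castΦ {H} e₁ e₂ F {t ++ u} {t ++ w} P
          a′ , ra = ⊑-resp f (superpose₁ t u) (superpose₁ t w) a
          b′ , rb = ⊑-resp g (superpose₂ t u) (superpose₂ t w) b
      in ((t , a′) , b′) , λ K (Ka , Kb) →
         castΦ-All K e₁ e₂ F {t ++ u} {t ++ w} P (ra K Ka , rb K Kb)

    superposing-⊒ : (f : Term S (x + m) (x + n)) (g : Term S p q) →
                    Tr x f ⊗ g ⊑ Tr x (cast (+-assoc x m p) (+-assoc x n q) (f ⊗ g))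
    superposing-⊒ {x} {m} {n} {p} {q} f g H u w ((t , a) , b) =
      let e₁ = +-assoc x m p
          e₂ = +-assoc x n q
          F = f ⊗ g
          a′ , ra = ⊑-resp f (λ i → sym (superpose₁ t u i)) (λ i → sym (superpose₁ t w i)) a
          b′ , rb = ⊑-resp g (λ i → sym (superpose₂ t u i)) (λ i → sym (superpose₂ t w i)) b
          P = a′ , b′
      in (t , uncastΦ {H} e₁ e₂ F {t ++ u} {t ++ w} P) , λ K KP →
         let Ka , Kb = uncastΦ-All K e₁ e₂ F {t ++ u} {t ++ w} P KP in ra K Ka , rb K Kb

    yanking-⊑ : ∀ x → Tr x (σ x x) ⊑ idₜ x
    yanking-⊑ x H u w (t , eq) =
      (λ i → trans (sym (++-↑ʳ t w i)) (trans (eq _) (trans (cong (t ++ u) (++-↑ʳ (x ↑ʳ_) (_↑ˡ x) i))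
               (trans (++-↑ˡ t u i) (t≗u i))))) ,
      λ K Ku → split-∀ x (λ i → subst (vertices K) (sym (trans (++-↑ˡ t u i) (t≗u i))) (Ku i))
                         (λ i → subst (vertices K) (sym (++-↑ʳ t u i)) (Ku i))
      where
      t≗u : t ≗ u
      t≗u i = trans (sym (++-↑ˡ t w i)) (trans (eq _) (trans (cong (t ++ u) (++-↑ˡ (x ↑ʳ_) (_↑ˡ x) i)) (++-↑ʳ t u i)))

    yanking-⊒ : ∀ x → idₜ x ⊑ Tr x (σ x x)
    yanking-⊒ x H u w eq =
      (u , split-∀ x
        (λ i → trans (++-↑ˡ u w i) (sym (trans (cong (u ++ u) (++-↑ˡ (x ↑ʳ_) (_↑ˡ x) i)) (++-↑ʳ u u i))))
        (λ i → trans (++-↑ʳ u w i) (trans (eq i) (sym (trans (cong (u ++ u) (++-↑ʳ (x ↑ʳ_) (_↑ˡ x) i)) (++-↑ˡ u u i)))))) ,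
      λ K Ku i → subst (vertices K) (++-↑ˡ u u i) (Ku (i ↑ˡ x))

    ⊑-trans : f ⊑ g → g ⊑ h → f ⊑ h
    ⊑-trans f⊑g g⊑h H u w p =
      let q , ref = f⊑g H u w p
          r , ref′ = g⊑h H u w q
      in r , λ K → ref K ∘ ref′ K

    ⨾-mono : {f f′ : Term S m n} {g g′ : Term S n p} → f ⊑ f′ → g ⊑ g′ → f ⨾ g ⊑ f′ ⨾ g′
    ⨾-mono F G H u w (v , p , q) =
      let p′ , rp = F H u v p
          q′ , rq = G H v w q
      in (v , p′ , q′) , λ K (Kp , Kq) → rp K Kp , rq K Kq

    ⊗-mono : {f f′ : Term S m n} {g g′ : Term S p q} → f ⊑ f′ → g ⊑ g′ → f ⊗ g ⊑ f′ ⊗ g′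
    ⊗-mono F G H u w (p , q) =
      let p′ , rp = F H _ _ p
          q′ , rq = G H _ _ q
      in (p′ , q′) , λ K (Kp , Kq) → rp K Kp , rq K Kq

    Tr-mono : {f f′ : Term S (x + m) (x + n)} → f ⊑ f′ → Tr x f ⊑ Tr x f′
    Tr-mono F H u w (t , p) = let p′ , rp = F H _ _ p in (t , p′) , rp

    ⊗-id-pointwise : id {A = Fin m} ⊞ id {A = Fin n} ≗ id
    ⊗-id-pointwise {m} {n} = ⊞-id {m} {n}

    σ-unit-wiring : ∀ m → Wiring (cast (+-identityʳ m) refl (σ m 0)) id
    σ-unit-wiring m = Wiring-≗ (λ i → toℕ-injective (trans (toℕ-cast _ _) (trans (toℕ-↑ˡ (Fin.cast refl i) 0) (toℕ-cast refl i))))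
      (Wiring-cast (+-identityʳ m) refl (Wiring-σ m 0))

    hexagon-wiring : ∀ m n p → Wiring
      (cast (+-assoc m n p) (+-assoc n m p) (σ m n ⊗ idₜ p) ⨾ cast refl (sym (+-assoc n p m)) (idₜ n ⊗ σ m p)) _
    hexagon-wiring m n p = Wiring-⨾
      (Wiring-cast (+-assoc m n p) (+-assoc n m p) (Wiring-⊗ (Wiring-σ m n) Wiring-id))
      (Wiring-cast refl (sym (+-assoc n p m)) (Wiring-⊗ Wiring-id (Wiring-σ m p)))

  sound  : {f g : Term S m n} → f ≈ g → f ⊑ g
  sound⁻ : {f g : Term S m n} → f ≈ g → g ⊑ f

  sound ≈-refl H u w p = p , λ K → id
  sound (≈-sym eq) = sound⁻ eq
  sound (≈-trans eq eq′) = ⊑-trans (sound eq) (sound eq′)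
  sound (⨾-cong eq eq′) = ⨾-mono (sound eq) (sound eq′)
  sound (⊗-cong eq eq′) = ⊗-mono (sound eq) (sound eq′)
  sound (Tr-cong eq) = Tr-mono (sound eq)
  sound (⨾-identityˡ f) H u w (v , eq , p) =
    let p′ , ref = ⊑-resp f eq (λ _ → refl) p
    in p′ , λ K Kp → All-inputs K f Kp , ref K Kp
  sound (⨾-identityʳ f) H u w (v , p , eq) =
    let p′ , ref = ⊑-resp f (λ _ → refl) (λ b → sym (eq b)) p
    in p′ , λ K Kp → ref K Kp , All-outputs K f (ref K Kp)
  sound (⨾-assoc f g h) H u w (v , (v′ , p , q) , r) = (v′ , p , v , q , r) , λ K (Kp , Kq , Kr) → (Kp , Kq) , Kr
  sound (⊗-id m n) = Wiring-⊑ (Wiring-⊗ Wiring-id Wiring-id) Wiring-id (⊗-id-pointwise {m} {n})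
  sound (⊗-interchange f g h k) = interchange-⊑ f g h k
  sound (⊗-identityˡ f) H u w (_ , p) = p , λ K Kp → (λ ()) , Kp
  sound (⊗-identityʳ f) = ⊗-identityʳ-⊑ f
  sound (⊗-assoc f g h) = ⊗-assoc-⊑ f g h
  sound (σ-natural f g) = σ-natural-⊑ f g
  sound (σ-involutive m n) = Wiring-⊑ (Wiring-⨾ (Wiring-σ m n) (Wiring-σ n m)) Wiring-id (swap-swap m n)
  sound (σ-unit m) = Wiring-⊑ (σ-unit-wiring m) Wiring-id (λ _ → refl)
  sound (σ-hexagon m n p) = Wiring-⊑ (Wiring-σ m (n + p)) (hexagon-wiring m n p) (hexagon m n p)
  sound (Tr-tightening f g h) = tightening-⊑ f g h
  sound (Tr-sliding f g) = sliding-⊑ f g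
  sound (Tr-vanishing₀ f) H u w (_ , p) = p , λ K → id
  sound (Tr-vanishing₊ x y f) = vanishing-⊑ x y f
  sound (Tr-superposing f g) = superposing-⊑ f g
  sound (Tr-yanking x) = yanking-⊑ x
  sound δ-counitˡ = Wiring-⊑ (Wiring-⨾ Wiring-δ (Wiring-⊗ Wiring-ε Wiring-id)) Wiring-id λ { zero → refl }
  sound δ-counitʳ = Wiring-⊑ (Wiring-⨾ Wiring-δ (Wiring-⊗ Wiring-id Wiring-ε)) Wiring-id λ { zero → refl }
  sound δ-coassoc = Wiring-⊑ (Wiring-⨾ Wiring-δ (Wiring-⊗ Wiring-δ Wiring-id)) (Wiring-⨾ Wiring-δ (Wiring-⊗ Wiring-id Wiring-δ)) λ _ → refl
  sound δ-cocomm = Wiring-⊑ (Wiring-⨾ Wiring-δ (Wiring-σ 1 1)) Wiring-δ λ _ → refl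

  sound⁻ ≈-refl H u w p = p , λ K → id
  sound⁻ (≈-sym eq) = sound eq
  sound⁻ (≈-trans eq eq′) = ⊑-trans (sound⁻ eq′) (sound⁻ eq)
  sound⁻ (⨾-cong eq eq′) = ⨾-mono (sound⁻ eq) (sound⁻ eq′)
  sound⁻ (⊗-cong eq eq′) = ⊗-mono (sound⁻ eq) (sound⁻ eq′)
  sound⁻ (Tr-cong eq) = Tr-mono (sound⁻ eq)
  sound⁻ (⨾-identityˡ f) H u w p = (u , (λ _ → refl) , p) , λ K → proj₂
  sound⁻ (⨾-identityʳ f) H u w p = (w , p , λ _ → refl) , λ K → proj₁
  sound⁻ (⨾-assoc f g h) H u w (v , p , v′ , q , r) = (v′ , (v , p , q) , r) , λ K ((Kp , Kq) , Kr) → Kp , Kq , Kr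
  sound⁻ (⊗-id m n) = Wiring-⊑ Wiring-id (Wiring-⊗ Wiring-id Wiring-id) (λ i → sym (⊗-id-pointwise {m} {n} i))
  sound⁻ (⊗-interchange f g h k) H u w (v , (p , p′) , (q , q′)) =
    ((_ , p , q) , (_ , p′ , q′)) , λ K ((Kp , Kq) , (Kp′ , Kq′)) → (Kp , Kp′) , (Kq , Kq′)
  sound⁻ (⊗-identityˡ f) H u w p = ((λ ()) , p) , λ K → proj₂
  sound⁻ (⊗-identityʳ f) = ⊗-identityʳ-⊒ f
  sound⁻ (⊗-assoc f g h) = ⊗-assoc-⊒ f g h
  sound⁻ (σ-natural f g) = σ-natural-⊒ f g
  sound⁻ (σ-involutive m n) = Wiring-⊑ Wiring-id (Wiring-⨾ (Wiring-σ m n) (Wiring-σ n m)) (λ i → sym (swap-swap m n i))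
  sound⁻ (σ-unit m) = Wiring-⊑ Wiring-id (σ-unit-wiring m) (λ _ → refl)
  sound⁻ (σ-hexagon m n p) = Wiring-⊑ (hexagon-wiring m n p) (Wiring-σ m (n + p)) (λ i → sym (hexagon m n p i))
  sound⁻ (Tr-tightening f g h) = tightening-⊒ f g h
  sound⁻ (Tr-sliding f g) = sliding-⊒ f g
  sound⁻ (Tr-vanishing₀ f) H u w p = ((λ ()) , p) , λ K → id
  sound⁻ (Tr-vanishing₊ x y f) = vanishing-⊒ x y f
  sound⁻ (Tr-superposing f g) = superposing-⊒ f g
  sound⁻ (Tr-yanking x) = yanking-⊒ x
  sound⁻ δ-counitˡ = Wiring-⊑ Wiring-id (Wiring-⨾ Wiring-δ (Wiring-⊗ Wiring-ε Wiring-id)) λ { zero → refl }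
  sound⁻ δ-counitʳ = Wiring-⊑ Wiring-id (Wiring-⨾ Wiring-δ (Wiring-⊗ Wiring-id Wiring-ε)) λ { zero → refl }
  sound⁻ δ-coassoc = Wiring-⊑ (Wiring-⨾ Wiring-δ (Wiring-⊗ Wiring-id Wiring-δ)) (Wiring-⨾ Wiring-δ (Wiring-⊗ Wiring-δ Wiring-id)) λ _ → refl
  sound⁻ δ-cocomm = Wiring-⊑ Wiring-δ (Wiring-⨾ Wiring-δ (Wiring-σ 1 1)) λ _ → refl

-- Representing cospans

Surj : {A B : Set} → (A → B) → Set
Surj f = ∀ y → ∃[ x ] f x ≡ y

injective⇒surjective : {f : Fin m → Fin n} → Inj f → n ≤ m → Surj f
injective⇒surjective {m} {suc n} {f} f-inj n≤m y with any? (λ x → f x ≟ y)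
... | yes hit = hit
... | no miss = contradiction (ℕ.≤-trans n≤m (injective⇒≤ {f = λ x → punchOut (y≢ x)}
                  λ eq → f-inj (punchOut-injective (y≢ _) (y≢ _) eq))) (ℕ.<-irrefl refl)
  where
  y≢ : ∀ x → y ≢ f x
  y≢ x eq = miss (x , sym eq)

surjective⇒≤ : {f : Fin m → Fin n} → Surj f → n ≤ m
surjective⇒≤ {f = f} surj = injective⇒≤ {f = proj₁ ∘ surj} λ {x} {y} eq →
  trans (sym (proj₂ (surj x))) (trans (cong f eq) (proj₂ (surj y)))

mutually-surjective⇒injective : {f : Fin m → Fin n} {g : Fin n → Fin m} → Surj f → Surj g → Inj f
mutually-surjective⇒injective {m} {n} {f} f-surj g-surj {x} {y} eq =
  let x′ , x-eq = section-surj x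
      y′ , y-eq = section-surj y
      x′≡y′ = trans (sym (proj₂ (f-surj x′))) (trans (cong f x-eq) (trans eq (trans (cong f (sym y-eq)) (proj₂ (f-surj y′)))))
  in trans (sym x-eq) (trans (cong section x′≡y′) y-eq)
  where
  section : Fin n → Fin m
  section y = proj₁ (f-surj y)

  section-surj : Surj section
  section-surj = injective⇒surjective
    (λ {x} {y} eq → trans (sym (proj₂ (f-surj x))) (trans (cong f eq) (proj₂ (f-surj y))))
    (surjective⇒≤ g-surj)

module _ {S : Signature} where
  open Signature S
  open Hypergraph
  open Hom
  open Coequaliser using (proj; commutes; factor; factor-proj; proj-surjective)
  open Region

  private variable
    F G H : Hypergraph S

  idₕ : Hom F F
  idₕ {F} = record
    { onV = id ; onE = id ; onLabel = λ _ → refl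
    ; onSource = λ e a → cong (source F e) (sym (cast-is-id refl a))
    ; onTarget = λ e b → cong (target F e) (sym (cast-is-id refl b))
    }

  module _ {F G : Hypergraph S} where
    private
      label-inj : (s : Edge F ⊎ Edge G) {s′ : Edge F ⊎ Edge G} → s ≡ s′ → ⊕-label F G s ≡ ⊕-label F G s′
      label-inj s refl = refl

      source-inj : (s : Edge F ⊎ Edge G) {s′ : Edge F ⊎ Edge G} (eq : s ≡ s′) (a : Fin (dom (⊕-label F G s))) →
                   ⊕-source F G s a ≡ ⊕-source F G s′ (Fin.cast (cong dom (label-inj s eq)) a)
      source-inj s refl a = cong (⊕-source F G s) (sym (cast-is-id refl a))

      target-inj : (s : Edge F ⊎ Edge G) {s′ : Edge F ⊎ Edge G} (eq : s ≡ s′) (b : Fin (cod (⊕-label F G s))) →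
                   ⊕-target F G s b ≡ ⊕-target F G s′ (Fin.cast (cong cod (label-inj s eq)) b)
      target-inj s refl b = cong (⊕-target F G s) (sym (cast-is-id refl b))

    inlₕ : Hom F (F ⊕ G)
    inlₕ = record
      { onV = _↑ˡ #V G ; onE = _↑ˡ #E G
      ; onLabel  = λ e → label-inj (inj₁ e) (sym (splitAt-↑ˡ (#E F) e (#E G)))
      ; onSource = λ e → source-inj (inj₁ e) (sym (splitAt-↑ˡ (#E F) e (#E G)))
      ; onTarget = λ e → target-inj (inj₁ e) (sym (splitAt-↑ˡ (#E F) e (#E G)))
      }

    inrₕ : Hom G (F ⊕ G)
    inrₕ = record
      { onV = #V F ↑ʳ_ ; onE = #E F ↑ʳ_
      ; onLabel  = λ e → label-inj (inj₂ e) (sym (splitAt-↑ʳ (#E F) (#E G) e))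
      ; onSource = λ e → source-inj (inj₂ e) (sym (splitAt-↑ʳ (#E F) (#E G) e))
      ; onTarget = λ e → target-inj (inj₂ e) (sym (splitAt-↑ʳ (#E F) (#E G) e))
      }

    copairₕ : Hom F H → Hom G H → Hom (F ⊕ G) H
    copairₕ {H} k l = record
      { onV = onV k ++ onV l ; onE = onE k ++ onE l
      ; onLabel = λ e → labels (splitAt (#E F) e)
      ; onSource = λ e → sources (splitAt (#E F) e)
      ; onTarget = λ e → targets (splitAt (#E F) e)
      }
      where
      labels : ∀ s → ⊕-label F G s ≡ label H ([ onE k , onE l ]′ s)
      labels (inj₁ e) = onLabel k e
      labels (inj₂ e) = onLabel l e

      sources : ∀ s a → (onV k ++ onV l) (⊕-source F G s a) ≡ source H ([ onE k , onE l ]′ s) (Fin.cast (cong dom (labels s)) a)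
      sources (inj₁ e) a = trans (++-↑ˡ (onV k) (onV l) _) (onSource k e a)
      sources (inj₂ e) a = trans (++-↑ʳ (onV k) (onV l) _) (onSource l e a)

      targets : ∀ s b → (onV k ++ onV l) (⊕-target F G s b) ≡ target H ([ onE k , onE l ]′ s) (Fin.cast (cong cod (labels s)) b)
      targets (inj₁ e) b = trans (++-↑ˡ (onV k) (onV l) _) (onTarget k e b)
      targets (inj₂ e) b = trans (++-↑ʳ (onV k) (onV l) _) (onTarget l e b)

  module _ {F : Hypergraph S} {f g : Fin k → Vertex F} (Q : Coequaliser f g) where

    projₕ : Hom F (F / Q)
    projₕ = record
      { onV = proj Q ; onE = id ; onLabel = λ _ → refl
      ; onSource = λ e a → cong (proj Q ∘ source F e) (sym (cast-is-id refl a))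
      ; onTarget = λ e b → cong (proj Q ∘ target F e) (sym (cast-is-id refl b))
      }

    factorₕ : (h : Hom F H) → onV h ∘ f ≗ onV h ∘ g → Hom (F / Q) H
    factorₕ h eq = record
      { onV = factor Q (onV h) eq ; onE = onE h ; onLabel = onLabel h
      ; onSource = λ e a → trans (factor-proj Q (onV h) eq _) (onSource h e a)
      ; onTarget = λ e b → trans (factor-proj Q (onV h) eq _) (onTarget h e b)
      }

  image : Hom F H → Region H
  image k = record { vertices = λ v → ∃[ x ] onV k x ≡ v ; edges = λ e → ∃[ x ] onE k x ≡ e }

  preimage : Hom F H → Region H → Region F
  preimage k K = record { vertices = vertices K ∘ onV k ; edges = edges K ∘ onE k }

  mapΦ : (k : Hom F H) (f : Term S m n) {u : Fin m → Vertex F} {w : Fin n → Vertex F} →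
         Φ F f u w → Φ H f (onV k ∘ u) (onV k ∘ w)
  mapΦ {H = H} k (gen φ) (e , eq , us , ws) = onE k e , trans eq (onLabel k e) ,
    (λ a → trans (cong (onV k) (us a)) (trans (onSource k e _) (cong (source H _) (Fin.cast-trans (cong dom eq) (cong dom (onLabel k e)) a)))) ,
    (λ b → trans (cong (onV k) (ws b)) (trans (onTarget k e _) (cong (target H _) (Fin.cast-trans (cong cod eq) (cong cod (onLabel k e)) b))))
  mapΦ k δ p = cong (onV k) ∘ p
  mapΦ k ε p = tt
  mapΦ k (idₜ n) p = cong (onV k) ∘ p
  mapΦ k (σ m n) p = cong (onV k) ∘ p
  mapΦ k (f ⨾ g) (v , p , q) = onV k ∘ v , mapΦ k f p , mapΦ k g q
  mapΦ k (f ⊗ g) (p , q) = mapΦ k f p , mapΦ k g q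
  mapΦ k (Tr x f) {u} {w} (t , p) = onV k ∘ t ,
    Φ-resp f (λ i → sym (++-∘ (onV k) t u i)) (λ i → sym (++-∘ (onV k) t w i)) (mapΦ k f p)

  mapΦ-All : (k : Hom F H) (K : Region H) (f : Term S m n) {u : Fin m → Vertex F} {w : Fin n → Vertex F}
             (p : Φ F f u w) → All K f (mapΦ k f p) → All (preimage k K) f p
  mapΦ-All k K (gen φ)  _ Kp = Kp
  mapΦ-All k K δ        _ Kp = Kp
  mapΦ-All k K ε        _ Kp = Kp
  mapΦ-All k K (idₜ n)  _ Kp = Kp
  mapΦ-All k K (σ m n)  _ Kp = Kp
  mapΦ-All k K (f ⨾ g)  (v , p , q) (Kp , Kq) = mapΦ-All k K f p Kp , mapΦ-All k K g q Kq
  mapΦ-All k K (f ⊗ g)  (p , q) (Kp , Kq) = mapΦ-All k K f p Kp , mapΦ-All k K g q Kq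
  mapΦ-All k K (Tr x f) (t , p) Kp = mapΦ-All k K f p (All-resp K f _ _ (mapΦ k f p) Kp)

  -- c represents H ↦ Φ H f, with surjectivity in place of the uniqueness of hom: surjections
  -- both ways between finite sets are bijections, so c is still determined up to isomorphism.
  record Rep (f : Term S m n) (c : Cospan S m n) : Set₁ where
    open Cospan c
    field
      elem     : Φ apex f (onV inputs) (onV outputs)
      elem-all : ∀ K → All K f elem → (∀ v → vertices K v) × (∀ e → edges K e)
      hom      : {u : Fin m → Vertex H} {w : Fin n → Vertex H} → Φ H f u w → Hom apex H
      hom-in   : {u : Fin m → Vertex H} {w : Fin n → Vertex H} (p : Φ H f u w) → onV (hom p) ∘ onV inputs ≗ u
      hom-out  : {u : Fin m → Vertex H} {w : Fin n → Vertex H} (p : Φ H f u w) → onV (hom p) ∘ onV outputs ≗ w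
      hom-all  : {u : Fin m → Vertex H} {w : Fin n → Vertex H} (p : Φ H f u w) → All (image (hom p)) f p

  open Rep

  rep-≈ : {f g : Term S m n} {c : Cospan S m n} → f ≈ g → Rep f c → Rep g c
  rep-≈ {f = f} {g} {c} eq R = record
    { elem = proj₁ e
    ; elem-all = λ K Kp → elem-all R K (proj₂ e K Kp)
    ; hom = λ p → hom R (back p) ; hom-in = λ p → hom-in R (back p) ; hom-out = λ p → hom-out R (back p)
    ; hom-all = λ {H} {u} {w} p → proj₂ (sound⁻ eq H u w p) _ (hom-all R (back p))
    }
    where
    e = sound eq _ _ _ (elem R)
    back : ∀ {H} {u : Fin _ → Vertex H} {w : Fin _ → Vertex H} → Φ H g u w → Φ H f u w
    back {H} {u} {w} p = proj₁ (sound⁻ eq H u w p)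

  rep-⨾ : {f : Term S m n} {g : Term S n p} {c : Cospan S m n} {d : Cospan S n p} →
          Rep f c → Rep g d → Rep (f ⨾ g) (c ⨾ᶜ d)
  rep-⨾ {f = f} {g} {cospan {F} a b} {cospan {G} c d} R T = record
    { elem = proj Q ∘ inl ∘ onV b , mapΦ (projₕ Q ∘ₕ inlₕ) f (elem R) , eG
    ; elem-all = λ K (Kp , Kq) →
        let KF = elem-all R (preimage (projₕ Q ∘ₕ inlₕ) K) (mapΦ-All (projₕ Q ∘ₕ inlₕ) K f (elem R) Kp)
            KG = elem-all T (preimage (projₕ Q ∘ₕ inrₕ) K)
                   (mapΦ-All (projₕ Q ∘ₕ inrₕ) K g (elem T) (All-resp K g _ _ (mapΦ (projₕ Q ∘ₕ inrₕ) g (elem T)) Kq))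
        in (λ w → let v , eq = proj-surjective Q w in subst (vertices K) eq
                  (split-∀ (#V F) {P = vertices K ∘ proj Q} (proj₁ KF) (proj₁ KG) v)) ,
           split-∀ (#E F) (proj₂ KF) (proj₂ KG)
    ; hom = λ (v , p , q) → med (v , p , q)
    ; hom-in = λ P@(v , p , q) i → trans (med-inl P (onV a i)) (hom-in R p i)
    ; hom-out = λ P@(v , p , q) i → trans (med-inr P (onV d i)) (hom-out T q i)
    ; hom-all = λ P@(v , p , q) →
        All-mono (λ (x , eq) → proj Q (inl x) , trans (med-inl P x) eq) (λ (x , eq) → x ↑ˡ #E G , trans (++-↑ˡ (onE (hom R p)) (onE (hom T q)) x) eq) f p (hom-all R p) ,
        All-mono (λ (x , eq) → proj Q (inr x) , trans (med-inr P x) eq) (λ (x , eq) → #E F ↑ʳ x , trans (++-↑ʳ (onE (hom R p)) (onE (hom T q)) x) eq) g q (hom-all T q)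
    }
    where
    inl : Vertex F → Vertex (F ⊕ G)
    inl = _↑ˡ #V G

    inr : Vertex G → Vertex (F ⊕ G)
    inr = #V F ↑ʳ_

    Q : Coequaliser (inl ∘ onV b) (inr ∘ onV c)
    Q = coequaliser (inl ∘ onV b) (inr ∘ onV c)

    eG : Φ ((F ⊕ G) / Q) g (proj Q ∘ inl ∘ onV b) (proj Q ∘ inr ∘ onV d)
    eG = Φ-resp g (λ i → sym (commutes Q i)) (λ _ → refl) (mapΦ (projₕ Q ∘ₕ inrₕ) g (elem T))

    module _ {H} {u : Fin _ → Vertex H} {w : Fin _ → Vertex H} (P : Φ H (f ⨾ g) u w) where
      kF : Hom F H
      kF = hom R (proj₁ (proj₂ P))

      kG : Hom G H
      kG = hom T (proj₂ (proj₂ P))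

      agree : onV (copairₕ kF kG) ∘ inl ∘ onV b ≗ onV (copairₕ kF kG) ∘ inr ∘ onV c
      agree i = trans (++-↑ˡ (onV kF) (onV kG) (onV b i)) (trans (hom-out R (proj₁ (proj₂ P)) i)
        (sym (trans (++-↑ʳ (onV kF) (onV kG) (onV c i)) (hom-in T (proj₂ (proj₂ P)) i))))

      med : Hom ((F ⊕ G) / Q) H
      med = factorₕ Q (copairₕ kF kG) agree

      med-inl : ∀ x → onV med (proj Q (inl x)) ≡ onV kF x
      med-inl x = trans (factor-proj Q (onV (copairₕ kF kG)) agree (inl x)) (++-↑ˡ (onV kF) (onV kG) x)

      med-inr : ∀ x → onV med (proj Q (inr x)) ≡ onV kG x
      med-inr x = trans (factor-proj Q (onV (copairₕ kF kG)) agree (inr x)) (++-↑ʳ (onV kF) (onV kG) x)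

  rep-⊗ : {f : Term S m n} {g : Term S p q} {c : Cospan S m n} {d : Cospan S p q} →
          Rep f c → Rep g d → Rep (f ⊗ g) (c ⊗ᶜ d)
  rep-⊗ {m} {n} {f = f} {g} {cospan {F} a b} {cospan {G} c d} R T = record
    { elem = eF , eG
    ; elem-all = λ K (Kp , Kq) →
        let KF = elem-all R (preimage inlₕ K) (mapΦ-All inlₕ K f (elem R) (All-resp K f _ _ (mapΦ inlₕ f (elem R)) Kp))
            KG = elem-all T (preimage inrₕ K) (mapΦ-All inrₕ K g (elem T) (All-resp K g _ _ (mapΦ inrₕ g (elem T)) Kq))
        in split-∀ (#V F) (proj₁ KF) (proj₁ KG) , split-∀ (#E F) (proj₂ KF) (proj₂ KG)
    ; hom = λ (p , q) → copairₕ (hom R p) (hom T q)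
    ; hom-in = λ (p , q) → split-∀ m
        (λ i → trans (cong (onV (hom R p) ++ onV (hom T q)) (++-↑ˡ _ _ i)) (trans (++-↑ˡ (onV (hom R p)) (onV (hom T q)) (onV a i)) (hom-in R p i)))
        (λ i → trans (cong (onV (hom R p) ++ onV (hom T q)) (++-↑ʳ {m = m} _ _ i)) (trans (++-↑ʳ (onV (hom R p)) (onV (hom T q)) (onV c i)) (hom-in T q i)))
    ; hom-out = λ (p , q) → split-∀ n
        (λ i → trans (cong (onV (hom R p) ++ onV (hom T q)) (++-↑ˡ _ _ i)) (trans (++-↑ˡ (onV (hom R p)) (onV (hom T q)) (onV b i)) (hom-out R p i)))
        (λ i → trans (cong (onV (hom R p) ++ onV (hom T q)) (++-↑ʳ {m = n} _ _ i)) (trans (++-↑ʳ (onV (hom R p)) (onV (hom T q)) (onV d i)) (hom-out T q i)))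
    ; hom-all = λ (p , q) →
        All-mono (λ (x , eq) → x ↑ˡ #V G , trans (++-↑ˡ (onV (hom R p)) (onV (hom T q)) x) eq)
                 (λ (x , eq) → x ↑ˡ #E G , trans (++-↑ˡ (onE (hom R p)) (onE (hom T q)) x) eq) f p (hom-all R p) ,
        All-mono (λ (x , eq) → #V F ↑ʳ x , trans (++-↑ʳ (onV (hom R p)) (onV (hom T q)) x) eq)
                 (λ (x , eq) → #E F ↑ʳ x , trans (++-↑ʳ (onE (hom R p)) (onE (hom T q)) x) eq) g q (hom-all T q)
    }
    where
    ins : Fin _ → Vertex (F ⊕ G)
    ins = (_↑ˡ #V G) ∘ onV a ++ (#V F ↑ʳ_) ∘ onV c

    outs : Fin _ → Vertex (F ⊕ G)
    outs = (_↑ˡ #V G) ∘ onV b ++ (#V F ↑ʳ_) ∘ onV d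

    eF : Φ (F ⊕ G) f (ins ∘ (_↑ˡ _)) (outs ∘ (_↑ˡ _))
    eF = Φ-resp f (λ i → sym (++-↑ˡ _ _ i)) (λ i → sym (++-↑ˡ _ _ i)) (mapΦ inlₕ f (elem R))

    eG : Φ (F ⊕ G) g (ins ∘ (m ↑ʳ_)) (outs ∘ (n ↑ʳ_))
    eG = Φ-resp g (λ i → sym (++-↑ʳ {m = m} _ _ i)) (λ i → sym (++-↑ʳ {m = n} _ _ i)) (mapΦ inrₕ g (elem T))

  rep-Tr : ∀ x {f : Term S (x + m) (x + n)} {c : Cospan S (x + m) (x + n)} → Rep f c → Rep (Tr x f) (Trᶜ x c)
  rep-Tr {m} {n} x {f} {cospan {F} a b} R = record
    { elem = traced , e
    ; elem-all = λ K Kp →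
        let KF = elem-all R (preimage (projₕ Q) K) (mapΦ-All (projₕ Q) K f (elem R) (All-resp K f _ _ (mapΦ (projₕ Q) f (elem R)) Kp))
        in (λ w → let v , eq = proj-surjective Q w in subst (vertices K) eq (proj₁ KF v)) , proj₂ KF
    ; hom = λ P → med P
    ; hom-in = λ P i → trans (med-proj P _) (trans (hom-in R (proj₂ P) _) (++-↑ʳ (proj₁ P) _ i))
    ; hom-out = λ P i → trans (med-proj P _) (trans (hom-out R (proj₂ P) _) (++-↑ʳ (proj₁ P) _ i))
    ; hom-all = λ P → All-mono (λ (y , eq) → proj Q y , trans (med-proj P y) eq) id f (proj₂ P) (hom-all R (proj₂ P))
    }
    where
    Q : Coequaliser (onV a ∘ (_↑ˡ m)) (onV b ∘ (_↑ˡ n))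
    Q = coequaliser (onV a ∘ (_↑ˡ m)) (onV b ∘ (_↑ˡ n))

    traced : Fin x → Vertex (F / Q)
    traced i = proj Q (onV a (i ↑ˡ m))

    e : Φ (F / Q) f (traced ++ (proj Q ∘ onV a ∘ (x ↑ʳ_))) (traced ++ (proj Q ∘ onV b ∘ (x ↑ʳ_)))
    e = Φ-resp f (λ i → sym (++-η {m = x} (proj Q ∘ onV a) i))
      (λ i → sym (++-unique {f = traced} {g = proj Q ∘ onV b ∘ (x ↑ʳ_)} {h = proj Q ∘ onV b} (commutes Q) (λ _ → refl) i)) (mapΦ (projₕ Q) f (elem R))

    module _ {H} {u : Fin m → Vertex H} {w : Fin n → Vertex H} (P : Φ H (Tr x f) u w) where
      kF : Hom F H
      kF = hom R (proj₂ P)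

      agree : onV kF ∘ onV a ∘ (_↑ˡ m) ≗ onV kF ∘ onV b ∘ (_↑ˡ n)
      agree i = trans (trans (hom-in R (proj₂ P) _) (++-↑ˡ (proj₁ P) u i))
        (sym (trans (hom-out R (proj₂ P) _) (++-↑ˡ (proj₁ P) w i)))

      med : Hom (F / Q) H
      med = factorₕ Q kF agree

      med-proj : ∀ y → onV med (proj Q y) ≡ onV kF y
      med-proj = factor-proj Q (onV kF) agree

  rep : (f : Term S m n) → Rep f ⟦ f ⟧
  rep (gen φ) = record
    { elem = zero , refl , (λ a → cong (_↑ˡ cod φ) (sym (cast-is-id refl a))) , λ b → cong (dom φ ↑ʳ_) (sym (cast-is-id refl b))
    ; elem-all = λ K (Ke , Ku , Kw) → split-∀ (dom φ) Ku Kw , λ { zero → Ke }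
    ; hom = λ {H} {u} {w} (e , eq , us , ws) → record
        { onV = u ++ w ; onE = λ _ → e ; onLabel = λ _ → eq
        ; onSource = λ _ a → trans (++-↑ˡ u w a) (us a) ; onTarget = λ _ b → trans (++-↑ʳ u w b) (ws b) }
    ; hom-in = λ {H} {u} {w} _ → ++-↑ˡ u w
    ; hom-out = λ {H} {u} {w} _ → ++-↑ʳ u w
    ; hom-all = λ {H} {u} {w} _ → (zero , refl) , (λ a → a ↑ˡ cod φ , ++-↑ˡ u w a) , λ b → dom φ ↑ʳ b , ++-↑ʳ u w b
    }
  rep δ = record
    { elem = λ _ → refl ; elem-all = λ K Kv → (λ { zero → Kv }) , λ ()
    ; hom = λ {H} {u} _ → pick u
    ; hom-in = λ { {u = u} _ zero → refl } ; hom-out = λ p b → sym (p b) ; hom-all = λ _ → zero , refl }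
  rep ε = record
    { elem = tt ; elem-all = λ K Kv → (λ { zero → Kv }) , λ ()
    ; hom = λ {H} {u} _ → pick u
    ; hom-in = λ { {u = u} _ zero → refl } ; hom-out = λ p () ; hom-all = λ _ → zero , refl }
  rep (idₜ n) = record
    { elem = λ _ → refl ; elem-all = λ K Kv → Kv , λ ()
    ; hom = λ {H} {u} _ → pick u ; hom-in = λ _ _ → refl ; hom-out = λ p b → sym (p b) ; hom-all = λ _ a → a , refl }
  rep (σ m n) = record
    { elem = λ _ → refl ; elem-all = λ K Kv → Kv , λ ()
    ; hom = λ {H} {u} _ → pick u ; hom-in = λ _ _ → refl ; hom-out = λ p b → sym (p b) ; hom-all = λ _ a → a , refl }
  rep (f ⨾ g)  = rep-⨾ (rep f) (rep g)
  rep (f ⊗ g)  = rep-⊗ (rep f) (rep g)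
  rep (Tr x f) = rep-Tr x (rep f)

  open Net

  toHypergraph : Net S k x m n → Hypergraph S
  toHypergraph {k} {x} N = record { #V = x ; #E = k ; label = lab N ; source = src N ; target = tgt N }

  toCospan : Net S k x m n → Cospan S m n
  toCospan N = cospan {apex = toHypergraph N} (pick (inp N)) (pick (out N))

  private
    rep-knot : (N : Net S 0 x m n) (c : Complement (inp N)) → Rep (knot c (out N)) (toCospan N)
    rep-knot {x} {m} {n} N c = record
      { elem = lone , Wiring.from W (split-∀ size
          (λ i → trans (++-↑ˡ lone (out N) i) (sym (trans (cong (lone ++ inp N) (++-↑ˡ _ _ i)) (++-↑ˡ lone (inp N) i))))
          (λ b → trans (++-↑ʳ lone (out N) b) (sym (trans (cong (lone ++ inp N) (++-↑ʳ {m = size} _ _ b)) (at-index (out N b))))))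
      ; elem-all = λ K Kp → (λ v → subst (vertices K) (at-index v) (All-inputs K (fan (knot-wiring {S} c (out N))) Kp (index v))) , λ ()
      ; hom = λ {H} {u} {w} (t , p) → h t u
      ; hom-in = λ {H} {u} {w} (t , p) i → trans (cong (t ++ u) (index-inp i)) (++-↑ʳ t u i)
      ; hom-out = λ {H} {u} {w} (t , p) b → trans (cong (t ++ u) (sym (++-↑ʳ {m = size} _ _ b)))
          (trans (sym (Wiring.to W p (size ↑ʳ b))) (++-↑ʳ t w b))
      ; hom-all = λ {H} {u} {w} (t , p) → Wiring.all W _ p λ i → (lone ++ inp N) i , cong (t ++ u) (index-at i)
      }
      where
      open Complement c

      W : Wiring (fan (knot-wiring {S} c (out N))) (knot-wiring {S} c (out N))
      W = Wiring-fan _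

      h : ∀ {H : Hypergraph S} (t : Fin size → Vertex H) (u : Fin m → Vertex H) → Hom (toHypergraph N) H
      h t u = record { onV = (t ++ u) ∘ index ; onE = λ () ; onLabel = λ () ; onSource = λ () ; onTarget = λ () }

      index-at : ∀ i → index ((lone ++ inp N) i) ≡ i
      index-at = split-∀ size
        (λ i → trans (cong index (++-↑ˡ lone (inp N) i)) (index-lone i))
        (λ a → trans (cong index (++-↑ʳ lone (inp N) a)) (index-inp a))

    rep-pull : (N : Net S (suc k) x m n) {f : Term S (cod (lab N zero) + m) (dom (lab N zero) + n)} →
               Rep f (toCospan (cut zero N)) → Rep (pull (gen (lab N zero)) f) (toCospan N)
    rep-pull {k} {x} {m} {n} N {f} R = record
      { elem = tgt N zero , src N zero ++ out N , mapΦ incl f (elem R) ,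
          (zero , refl , (λ a → trans (++-↑ˡ (src N zero) (out N) a) (cong (src N zero) (sym (cast-is-id refl a)))) ,
                         (λ b → trans (++-↑ˡ (tgt N zero) (out N) b) (cong (tgt N zero) (sym (cast-is-id refl b))))) ,
          λ i → trans (++-↑ʳ (tgt N zero) (out N) i) (sym (++-↑ʳ (src N zero) (out N) i))
      ; elem-all = λ K (Kp , (Ke , _) , _) →
          let KV , KE = elem-all R (preimage incl K) (mapΦ-All incl K f (elem R) Kp)
          in KV , λ { zero → Ke ; (suc e) → KE e }
      ; hom = λ P → h P
      ; hom-in = λ {H} {u} (t , v , q , _) i → trans (sym (cong (onV (hom R q)) (++-↑ʳ (tgt N zero) (inp N) i))) (trans (hom-in R q _) (++-↑ʳ t u i))
      ; hom-out = λ {H} {u} {w} (t , v , q , _ , eq) i → trans (sym (cong (onV (hom R q)) (++-↑ʳ (src N zero) (out N) i)))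
          (trans (hom-out R q _) (trans (sym (eq i)) (++-↑ʳ t w i)))
      ; hom-all = λ P@(t , v , q , (e , _) , eq) →
          All-mono {K = image (hom R q)} {K′ = image (h P)} id (λ (x , eq) → suc x , eq) f q (hom-all R q) ,
          ((zero , refl) , (λ a → _ , hom-out R q _) ,
            λ b → tgt N zero b , trans (cong (onV (hom R q)) (sym (++-↑ˡ (tgt N zero) (inp N) b))) (trans (hom-in R q _) (trans (++-↑ˡ t _ b) (sym (++-↑ˡ t _ b))))) ,
          λ i → _ , hom-out R q _
      }
      where
      incl : Hom (toHypergraph (cut zero N)) (toHypergraph N)
      incl = record
        { onV = id ; onE = suc ; onLabel = λ _ → refl
        ; onSource = λ e a → cong (src N (suc e)) (sym (cast-is-id refl a))
        ; onTarget = λ e b → cong (tgt N (suc e)) (sym (cast-is-id refl b)) }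

      h : ∀ {H : Hypergraph S} {u : Fin m → Vertex H} {w : Fin n → Vertex H} →
          Φ H (pull (gen (lab N zero)) f) u w → Hom (toHypergraph N) H
      h {H} {u} {w} (t , v , q , (e , eq , us , ws) , _) = record
        { onV = onV (hom R q)
        ; onE = onE⁺
        ; onLabel = λ { zero → eq ; (suc e) → onLabel (hom R q) e }
        ; onSource = λ where
            zero a → trans (cong (onV (hom R q)) (sym (++-↑ˡ (src N zero) (out N) a))) (trans (hom-out R q _) (us a))
            (suc e) a → onSource (hom R q) e a
        ; onTarget = λ where
            zero b → trans (cong (onV (hom R q)) (sym (++-↑ˡ (tgt N zero) (inp N) b)))
                       (trans (hom-in R q _) (trans (++-↑ˡ t u b) (trans (sym (++-↑ˡ t w b)) (ws b))))
            (suc e) b → onTarget (hom R q) e b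
        }
        where
        onE⁺ : Fin (suc k) → Edge H
        onE⁺ zero    = e
        onE⁺ (suc x) = onE (hom R q) x

  rep-reify : (N : Net S k x m n) (ss : SingleSource N) → Rep (reify N ss) (toCospan N)
  rep-reify {zero}  N ss = rep-knot N (complementOf (SingleSource.inp-inj ss))
  rep-reify {suc k} N ss = rep-pull N (rep-reify (cut zero N) (cut-single zero ss))

  record CospanIso (c d : Cospan S m n) : Set where
    private
      module C = Cospan c
      module D = Cospan d
    field
      to      : Hom C.apex D.apex
      from    : Hom D.apex C.apex
      from-to : from ∘ₕ to ≈ₕ idₕ
      to-from : to ∘ₕ from ≈ₕ idₕ
      to-in   : onV to ∘ onV C.inputs ≗ onV D.inputs
      to-out  : onV to ∘ onV C.outputs ≗ onV D.outputs

  open CospanIso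

  iso-sym : {c d : Cospan S m n} → CospanIso c d → CospanIso d c
  iso-sym {c = c} {d} I = record
    { to = from I ; from = to I ; from-to = to-from I ; to-from = from-to I
    ; to-in  = λ i → trans (cong (onV (from I)) (sym (to-in I i))) (_≈ₕ_.≈V (from-to I) _)
    ; to-out = λ i → trans (cong (onV (from I)) (sym (to-out I i))) (_≈ₕ_.≈V (from-to I) _)
    }

  iso-trans : {c d e : Cospan S m n} → CospanIso c d → CospanIso d e → CospanIso c e
  iso-trans I J = record
    { to = to J ∘ₕ to I ; from = from I ∘ₕ from J
    ; from-to = (λ v → trans (cong (onV (from I)) (_≈ₕ_.≈V (from-to J) _)) (_≈ₕ_.≈V (from-to I) v)) ,
                λ e → trans (cong (onE (from I)) (_≈ₕ_.≈E (from-to J) _)) (_≈ₕ_.≈E (from-to I) e)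
    ; to-from = (λ v → trans (cong (onV (to J)) (_≈ₕ_.≈V (to-from I) _)) (_≈ₕ_.≈V (to-from J) v)) ,
                λ e → trans (cong (onE (to J)) (_≈ₕ_.≈E (to-from I) _)) (_≈ₕ_.≈E (to-from J) e)
    ; to-in  = λ i → trans (cong (onV (to J)) (to-in I i)) (to-in J i)
    ; to-out = λ i → trans (cong (onV (to J)) (to-out I i)) (to-out J i)
    }

  private
    inverseₕ : (k : Hom F H) (v : Vertex H → Vertex F) (e : Edge H → Edge F) →
               v ∘ onV k ≗ id → onE k ∘ e ≗ id → Hom H F
    inverseₕ {F} {H} k v e v-k k-e = record
      { onV = v ; onE = e
      ; onLabel = λ x → labels (k-e x)
      ; onSource = λ x → sources (k-e x)
      ; onTarget = λ x → targets (k-e x)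
      }
      where
      labels : ∀ {x y} → onE k y ≡ x → label H x ≡ label F y
      labels refl = sym (onLabel k _)

      sources : ∀ {x y} (eq : onE k y ≡ x) a → v (source H x a) ≡ source F y (Fin.cast (cong dom (labels eq)) a)
      sources {y = y} refl a = trans (cong (v ∘ source H (onE k y)) (sym (cast-involutive (cong dom (onLabel k y)) (cong dom (sym (onLabel k y))) a)))
        (trans (cong v (sym (onSource k y _))) (v-k _))

      targets : ∀ {x y} (eq : onE k y ≡ x) b → v (target H x b) ≡ target F y (Fin.cast (cong cod (labels eq)) b)
      targets {y = y} refl b = trans (cong (v ∘ target H (onE k y)) (sym (cast-involutive (cong cod (onLabel k y)) (cong cod (sym (onLabel k y))) b)))
        (trans (cong v (sym (onTarget k y _))) (v-k _))

  rep-unique : {f : Term S m n} {c d : Cospan S m n} → Rep f c → Rep f d → CospanIso c d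
  rep-unique {c = c} {d} R T = record
    { to = α₁ ; from = inverseₕ α₁ (proj₁ ∘ V-surj) (proj₁ ∘ E-surj) (λ v → V-inj (proj₂ (V-surj _))) (proj₂ ∘ E-surj)
    ; from-to = (λ v → V-inj (proj₂ (V-surj _))) , λ e → E-inj (proj₂ (E-surj _))
    ; to-from = proj₂ ∘ V-surj , proj₂ ∘ E-surj
    ; to-in = hom-in R (elem T) ; to-out = hom-out R (elem T)
    }
    where
    α₁ : Hom (Cospan.apex c) (Cospan.apex d)
    α₁ = hom R (elem T)

    β₁ : Hom (Cospan.apex d) (Cospan.apex c)
    β₁ = hom T (elem R)

    V-surj : Surj (onV α₁)
    V-surj = proj₁ (elem-all T (image α₁) (hom-all R (elem T)))

    E-surj : Surj (onE α₁)
    E-surj = proj₂ (elem-all T (image α₁) (hom-all R (elem T)))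

    V-inj : Inj (onV α₁)
    V-inj = mutually-surjective⇒injective {f = onV α₁} {onV β₁} V-surj (proj₁ (elem-all R (image β₁) (hom-all T (elem R))))

    E-inj : Inj (onE α₁)
    E-inj = mutually-surjective⇒injective {f = onE α₁} {onE β₁} E-surj (proj₂ (elem-all R (image β₁) (hom-all T (elem R))))

  private
    reify-≅ : ∀ {k k′ x x′} → k ≡ k′ → (N : Net S k x m n) (N′ : Net S k′ x′ m n) →
              CospanIso (toCospan N) (toCospan N′) → (ss : SingleSource N) (ss′ : SingleSource N′) →
              reify N ss ≈ reify N′ ss′
    reify-≅ {m = m} {n} refl N N′ I ss ss′ = ≈-sym (≈-trans (reify-iso {η = onE (to I)} η-inj R ss ss′)
      (≈-trans (⨾-cong fan-id (≈-trans (_ ⨾⟩ fan-id) (⨾-identityʳ _))) (⨾-identityˡ _)))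
      where
      η-inj : Inj (onE (to I))
      η-inj eq = trans (sym (_≈ₕ_.≈E (from-to I) _)) (trans (cong (onE (from I)) eq) (_≈ₕ_.≈E (from-to I) _))

      lab-eq : ∀ {e e′} → onE (to I) e ≡ e′ → lab N′ e′ ≡ lab N e
      lab-eq refl = sym (onLabel (to I) _)

      R : Rewiring (onE (to I)) N N′
      R = record
        { θ = onV (to I) ; θ⁻¹ = onV (from I) ; θ⁻¹-θ = _≈ₕ_.≈V (from-to I) ; θ-θ⁻¹ = _≈ₕ_.≈V (to-from I)
        ; π = id ; π⁻¹ = id ; π⁻¹-π = λ _ → refl ; π-π⁻¹ = λ _ → refl ; ρ = id
        ; lab-eq = lab-eq
        ; src-eq = λ { {e} refl a → sym (trans (onSource (to I) e _) (cong (src N′ _)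
            (cast-involutive (cong dom (onLabel (to I) e)) (cong dom (sym (onLabel (to I) e))) a))) }
        ; tgt-eq = λ { {e} refl b → sym (trans (onTarget (to I) e _) (cong (tgt N′ _)
            (cast-involutive (cong cod (onLabel (to I) e)) (cong cod (sym (onLabel (to I) e))) b))) }
        ; inp-eq = λ a → sym (to-in I a) ; out-eq = λ b → sym (to-out I b)
        }

  iso-edges : {c d : Cospan S m n} → CospanIso c d → #E (Cospan.apex c) ≡ #E (Cospan.apex d)
  iso-edges I = Fin.cantor-schröder-bernstein {f = onE (to I)} {onE (from I)}
    (λ eq → trans (sym (_≈ₕ_.≈E (from-to I) _)) (trans (cong (onE (from I)) eq) (_≈ₕ_.≈E (from-to I) _)))
    (λ eq → trans (sym (_≈ₕ_.≈E (to-from I) _)) (trans (cong (onE (to I)) eq) (_≈ₕ_.≈E (to-from I) _)))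

  open Reification

  reification-iso : {f : Term S m n} (r : Reification f) → CospanIso (toCospan (net r)) ⟦ f ⟧
  reification-iso {f = f} r = rep-unique (rep-≈ (≈-sym (≈-reify r)) (rep-reify (net r) (single r))) (rep f)

  faithful : {f g : Term S m n} → CospanIso ⟦ f ⟧ ⟦ g ⟧ → f ≈ g
  faithful {f = f} {g} I =
    ≈-trans (≈-reify ρf) (≈-trans (reify-≅ (iso-edges J) (net ρf) (net ρg) J (single ρf) (single ρg)) (≈-sym (≈-reify ρg)))
    where
    ρf : Reification f
    ρf = toReification f

    ρg : Reification g
    ρg = toReification g

    J : CospanIso (toCospan (net ρf)) (toCospan (net ρg))
    J = iso-trans (reification-iso ρf) (iso-trans I (iso-sym (reification-iso ρg)))

-- Degrees and pushouts

∑ : (Fin k → ℕ) → ℕ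
∑ g = sum (List.tabulate g)

∑-zero : (g : Fin k → ℕ) → (∀ e → g e ≡ 0) → ∑ g ≡ 0
∑-zero {zero}  g eq = refl
∑-zero {suc k} g eq = cong₂ _+_ (eq zero) (∑-zero (g ∘ suc) (eq ∘ suc))

∑-term : (g : Fin k → ℕ) (e : Fin k) → g e ≤ ∑ g
∑-term g zero    = ℕ.m≤m+n _ _
∑-term g (suc e) = ℕ.≤-trans (∑-term (g ∘ suc) e) (ℕ.m≤n+m _ (g zero))

∑-two-terms : (g : Fin k → ℕ) {e e′ : Fin k} → e ≢ e′ → g e + g e′ ≤ ∑ g
∑-two-terms g {zero}  {zero}   e≢ = contradiction refl e≢
∑-two-terms g {zero}  {suc e′} e≢ = ℕ.+-monoʳ-≤ (g zero) (∑-term (g ∘ suc) e′)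
∑-two-terms g {suc e} {zero}   e≢ =
  ℕ.≤-trans (ℕ.≤-reflexive (ℕ.+-comm (g (suc e)) (g zero))) (ℕ.+-monoʳ-≤ (g zero) (∑-term (g ∘ suc) e))
∑-two-terms g {suc e} {suc e′} e≢ =
  ℕ.≤-trans (∑-two-terms (g ∘ suc) (e≢ ∘ cong suc)) (ℕ.m≤n+m _ (g zero))

∑-positive : (g : Fin k → ℕ) → 1 ≤ ∑ g → ∃[ e ] 1 ≤ g e
∑-positive {suc k} g pos with g zero in eq
... | suc _ = zero , subst (1 ≤_) (sym eq) (s≤s z≤n)
... | zero  = let e , pos′ = ∑-positive (g ∘ suc) pos in suc e , pos′

∑-≤1 : (g : Fin k → ℕ) → (∀ e → g e ≤ 1) → (∀ {e e′} → 1 ≤ g e → 1 ≤ g e′ → e ≡ e′) → ∑ g ≤ 1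
∑-≤1 {zero}  g g≤1 uniq = z≤n
∑-≤1 {suc k} g g≤1 uniq with g zero in eq
... | zero  = ∑-≤1 (g ∘ suc) (g≤1 ∘ suc) λ p q → suc-injective (uniq p q)
... | suc c = subst (λ s → suc c + s ≤ 1) (sym (∑-zero (g ∘ suc) rest)) (subst (_≤ 1) (trans eq (sym (ℕ.+-identityʳ (suc c)))) (g≤1 zero))
  where
  rest : ∀ e → g (suc e) ≡ 0
  rest e with g (suc e) in eq′
  ... | zero  = refl
  ... | suc _ with () ← uniq {zero} {suc e} (subst (1 ≤_) (sym eq) (s≤s z≤n)) (subst (1 ≤_) (sym eq′) (s≤s z≤n))

indicator : {A : Set} → Dec A → ℕ
indicator d = if does d then 1 else 0

indicator-yes : {A : Set} (d : Dec A) → A → indicator d ≡ 1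
indicator-yes (yes _) a = refl
indicator-yes (no ¬a) a = contradiction a ¬a

indicator-no : {A : Set} (d : Dec A) → ¬ A → indicator d ≡ 0
indicator-no (yes a) ¬a = contradiction a ¬a
indicator-no (no _)  ¬a = refl

indicator-≤1 : {A : Set} (d : Dec A) → indicator d ≤ 1
indicator-≤1 (yes _) = ℕ.≤-refl
indicator-≤1 (no _)  = z≤n

indicator-positive : {A : Set} (d : Dec A) → 1 ≤ indicator d → A
indicator-positive (yes a) _ = a

count-∑ : (v : Fin n) (t : Fin k → Fin n) →
          Vec.count (v ≟_) (Vec.tabulate t) ≡ ∑ (λ b → indicator (v ≟ t b))
count-∑ {k = zero}  v t = refl
count-∑ {k = suc k} v t with v ≟ t zero
... | yes _ = cong suc (count-∑ v (t ∘ suc))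
... | no _  = count-∑ v (t ∘ suc)

module _ {S : Signature} where
  open Signature S
  open Hypergraph
  open Hom

  private
    occurrences : (F : Hypergraph S) → Vertex F → Edge F → ℕ
    occurrences F v e = Vec.count (v ≟_) (Vec.tabulate (target F e))

    inDegree-∑ : (F : Hypergraph S) (v : Vertex F) → inDegree F v ≡ ∑ (occurrences F v)
    inDegree-∑ F v = cong sum (map-tabulate id (occurrences F v))

    occurs : (F : Hypergraph S) {v : Vertex F} {e : Edge F} {b : Fin (cod (label F e))} →
             target F e b ≡ v → 1 ≤ occurrences F v e
    occurs F {v} {e} {b} eq = subst (1 ≤_) (sym (count-∑ v (target F e)))
      (ℕ.≤-trans (ℕ.≤-reflexive (sym (indicator-yes (v ≟ target F e b) (sym eq)))) (∑-term _ b))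

    occurs⁻¹ : (F : Hypergraph S) (v : Vertex F) (e : Edge F) → 1 ≤ occurrences F v e → ∃[ b ] target F e b ≡ v
    occurs⁻¹ F v e pos =
      let b , pos′ = ∑-positive _ (subst (1 ≤_) (count-∑ v (target F e)) pos)
      in b , sym (indicator-positive (v ≟ target F e b) pos′)

    1≰0 : ∀ {a b : ℕ} → a ≤ b → 1 ≤ a → b ≢ 0
    1≰0 a≤b 1≤a refl with () ← ℕ.≤-trans 1≤a a≤b

    2≰ : ∀ {a b c : ℕ} → b + c ≤ a → 1 ≤ b → 1 ≤ c → ¬ (a ≡ 0 ⊎ a ≡ 1)
    2≰ le 1≤b 1≤c (inj₁ refl) with () ← ℕ.≤-trans (ℕ.+-mono-≤ 1≤b 1≤c) le
    2≰ le 1≤b 1≤c (inj₂ refl) with s≤s () ← ℕ.≤-trans (ℕ.+-mono-≤ 1≤b 1≤c) le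

    ≤1⇒ : ∀ {a} → a ≤ 1 → a ≡ 0 ⊎ a ≡ 1
    ≤1⇒ z≤n       = inj₁ refl
    ≤1⇒ (s≤s z≤n) = inj₂ refl

  Mono⇒Inj : {F : Hypergraph S} {f : Hom (discrete n) F} → Mono f → Inj (onV f)
  Mono⇒Inj mono {x} {y} eq = _≈ₕ_.≈V (mono {A = discrete 1} (pick λ _ → x) (pick λ _ → y) ((λ _ → eq) , λ ())) zero

  Inj⇒Mono : {F : Hypergraph S} {f : Hom (discrete n) F} → Inj (onV f) → Mono f
  Inj⇒Mono inj g h eq = (λ v → inj (_≈ₕ_.≈V eq v)) , λ e → contradiction (onE g e) Fin.¬Fin0

  fromCospan : (c : Cospan S m n) → Net S (#E (Cospan.apex c)) (#V (Cospan.apex c)) m n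
  fromCospan c = record
    { lab = label apex ; src = source apex ; tgt = target apex ; inp = onV inputs ; out = onV outputs }
    where open Cospan c

  open SingleSource

  plm⇒single : {c : Cospan S m n} → PartialLeftMonogamous c → SingleSource (fromCospan c)
  plm⇒single {c = c} plm = record
    { inp-inj  = Mono⇒Inj {f = inputs} inputs-mono
    ; tgt-inj  = λ e {b} {b′} eq → same-position e eq (b ≟ b′)
    ; tgt-edge = λ {e} {e′} eq → same-edge eq (e ≟ e′)
    ; inp≢tgt  = λ a e b eq →
        1≰0 (subst (occurrences F (onV inputs a) e ≤_) (sym (inDegree-∑ F _)) (∑-term _ e)) (occurs F (sym eq))
            (cong proj₁ (proj₂ (degree-in (onV inputs a) (a , refl))))
    }
    where
    open Cospan c
    open PartialLeftMonogamous plm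

    F : Hypergraph S
    F = apex

    not-two : ∀ {e b} → ¬ ¬ (inDegree F (target F e b) ≡ 0 ⊎ inDegree F (target F e b) ≡ 1)
    not-two {e} {b} not = not-input λ in-image → not (inj₁ (cong proj₁ (proj₂ (degree-in _ in-image))))
      where
      not-input : ¬ ¬ Image inputs (target F e b)
      not-input ∉ with degree-out _ ∉
      ... | _ , inj₁ eq = not (inj₁ (cong proj₁ eq))
      ... | _ , inj₂ eq = not (inj₂ (cong proj₁ eq))

    same-edge : ∀ {e e′ b b′} → target F e b ≡ target F e′ b′ → Dec (e ≡ e′) → e ≡ e′
    same-edge eq (yes e≡) = e≡
    same-edge {e} {e′} {b} {b′} eq (no e≢) = contradiction
      (2≰ (subst (occurrences F v e + occurrences F v e′ ≤_) (sym (inDegree-∑ F v)) (∑-two-terms _ e≢))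
          (occurs F refl) (occurs F (sym eq)))
      not-two
      where
      v : Vertex F
      v = target F e b

    same-position : ∀ e {b b′} → target F e b ≡ target F e b′ → Dec (b ≡ b′) → b ≡ b′
    same-position e eq (yes b≡) = b≡
    same-position e {b} {b′} eq (no b≢) = contradiction
      (2≰ (ℕ.≤-trans (∑-two-terms (λ b → indicator (v ≟ target F e b)) b≢)
            (subst₂ _≤_ (count-∑ v (target F e)) (sym (inDegree-∑ F v)) (∑-term _ e)))
          (ℕ.≤-reflexive (sym (indicator-yes (v ≟ target F e b) refl)))
          (ℕ.≤-reflexive (sym (indicator-yes (v ≟ target F e b′) eq))))
      not-two
      where
      v : Vertex F
      v = target F e b

  single⇒plm : {F : Hypergraph S} (I : Hom (discrete m) F) (O : Hom (discrete n) F) →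
               SingleSource (fromCospan (cospan I O)) → PartialLeftMonogamous (cospan I O)
  single⇒plm {F = F} I O ss = record
    { inputs-mono = Inj⇒Mono {f = I} (inp-inj ss)
    ; degree-in   = λ v (a , eq) → outDegree F v , cong (_, outDegree F v)
        (trans (inDegree-∑ F v) (∑-zero _ λ e → trans (count-∑ v (target F e)) (∑-zero _ λ b →
          indicator-no (v ≟ target F e b) λ eq′ → inp≢tgt ss a e b (trans eq eq′))))
    ; degree-out  = λ v _ → outDegree F v , [ (λ eq → inj₁ (cong (_, outDegree F v) eq)) , (λ eq → inj₂ (cong (_, outDegree F v) eq)) ]′ (≤1⇒ (in≤1 v))
    }
    where
    in≤1 : ∀ v → inDegree F v ≤ 1
    in≤1 v = subst (_≤ 1) (sym (inDegree-∑ F v)) (∑-≤1 _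
      (λ e → subst (_≤ 1) (sym (count-∑ v (target F e))) (∑-≤1 _ (λ b → indicator-≤1 (v ≟ target F e b))
        λ {b} {b′} p q → tgt-inj ss e (trans (sym (indicator-positive (v ≟ _) p)) (indicator-positive (v ≟ _) q))))
      λ {e} {e′} p q → tgt-edge ss (trans (proj₂ (occurs⁻¹ F v e p)) (sym (proj₂ (occurs⁻¹ F v e′ q)))))

  open CospanIso
  open _≈ₕ_

  single-iso : {N : Net S k x m n} {c : Cospan S m n} → CospanIso (toCospan N) c →
               SingleSource N → SingleSource (fromCospan c)
  single-iso {N = N} {c} I ss = record
    { inp-inj  = λ eq → inp-inj ss (trans (sym (from-in _)) (trans (cong (onV (from I)) eq) (from-in _)))
    ; tgt-inj  = λ e eq → cast-injective (cong cod (onLabel (from I) e)) (tgt-inj ss _ (from-eq eq))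
    ; tgt-edge = λ {e} {e′} eq → trans (sym (≈E (to-from I) e)) (trans (cong (onE (to I)) (tgt-edge ss (from-eq eq))) (≈E (to-from I) e′))
    ; inp≢tgt  = λ a e b eq → inp≢tgt ss a _ _ (trans (sym (from-in a)) (trans (cong (onV (from I)) eq) (onTarget (from I) e b)))
    }
    where
    open Cospan c

    from-in : ∀ a → onV (from I) (onV inputs a) ≡ Net.inp N a
    from-in = to-in (iso-sym I)

    from-eq : ∀ {e b e′ b′} → target apex e b ≡ target apex e′ b′ →
              Net.tgt N (onE (from I) e) (Fin.cast (cong cod (onLabel (from I) e)) b) ≡
              Net.tgt N (onE (from I) e′) (Fin.cast (cong cod (onLabel (from I) e′)) b′)
    from-eq eq = trans (sym (onTarget (from I) _ _)) (trans (cong (onV (from I)) eq) (onTarget (from I) _ _))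

    cast-injective : ∀ {p q} (eq : p ≡ q) {a b : Fin p} → Fin.cast eq a ≡ Fin.cast eq b → a ≡ b
    cast-injective eq h = trans (sym (cast-involutive (sym eq) eq _)) (trans (cong (Fin.cast (sym eq)) h) (cast-involutive (sym eq) eq _))

  open Reification

  single-⟦⟧ : (f : Term S m n) → SingleSource (fromCospan ⟦ f ⟧)
  single-⟦⟧ f = single-iso (reification-iso (toReification f)) (single (toReification f))

  full : {c : Cospan S m n} → PartialLeftMonogamous c → ∃[ f ] CospanIso ⟦ f ⟧ c
  full {c = c} plm = reify N ss , rep-unique (rep (reify N ss)) record { Rep (rep-reify N ss) }
    where
    N : Net S _ _ _ _
    N = fromCospan c

    ss : SingleSource N
    ss = plm⇒single plm

  -- The apex of d is the pushout of those of l and c along i + j.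
  record Plugging (l : Cospan S i j) (c : Cospan S (j + m) (i + n)) (d : Cospan S m n) : Set where
    private
      module L = Cospan l
      module C = Cospan c
      module D = Cospan d

    Agree : {Q : Hypergraph S} → Hom L.apex Q → Hom C.apex Q → Set
    Agree h k = (∀ a → onV h (onV L.inputs a) ≡ onV k (onV C.outputs (a ↑ˡ n))) ×
                (∀ b → onV h (onV L.outputs b) ≡ onV k (onV C.inputs (b ↑ˡ m)))

    field
      ιˡ        : Hom L.apex D.apex
      ιᶜ        : Hom C.apex D.apex
      agree     : Agree ιˡ ιᶜ
      universal : {Q : Hypergraph S} (h : Hom L.apex Q) (k : Hom C.apex Q) → Agree h k →
                  ∃[ u ] (u ∘ₕ ιˡ ≈ₕ h) × (u ∘ₕ ιᶜ ≈ₕ k)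
      unique    : {Q : Hypergraph S} (u v : Hom D.apex Q) → u ∘ₕ ιˡ ≈ₕ v ∘ₕ ιˡ → u ∘ₕ ιᶜ ≈ₕ v ∘ₕ ιᶜ → u ≈ₕ v
      ιᶜ-in     : ∀ a → onV D.inputs a ≡ onV ιᶜ (onV C.inputs (j ↑ʳ a))
      ιᶜ-out    : ∀ b → onV D.outputs b ≡ onV ιᶜ (onV C.outputs (i ↑ʳ b))

  open Plugging

  module _ {l : Cospan S i j} {c c′ : Cospan S (j + m) (i + n)} {d d′ : Cospan S m n} where

    private
      transport-to : (I : CospanIso c c′) (P : Plugging l c d) (P′ : Plugging l c′ d′) →
                     ∃[ u ] (u ∘ₕ ιˡ P ≈ₕ ιˡ P′) × (u ∘ₕ ιᶜ P ≈ₕ ιᶜ P′ ∘ₕ to I)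
      transport-to I P P′ = universal P (ιˡ P′) (ιᶜ P′ ∘ₕ to I)
        ( (λ a → trans (proj₁ (agree P′) a) (cong (onV (ιᶜ P′)) (sym (to-out I _))))
        , (λ b → trans (proj₂ (agree P′) b) (cong (onV (ιᶜ P′)) (sym (to-in I _)))))

    plugging-to : CospanIso c c′ → Plugging l c d → Plugging l c′ d′ → Hom (Cospan.apex d) (Cospan.apex d′)
    plugging-to I P P′ = proj₁ (transport-to I P P′)

    plugging-to-ιˡ : (I : CospanIso c c′) (P : Plugging l c d) (P′ : Plugging l c′ d′) →
                     plugging-to I P P′ ∘ₕ ιˡ P ≈ₕ ιˡ P′
    plugging-to-ιˡ I P P′ = proj₁ (proj₂ (transport-to I P P′))

    plugging-to-ιᶜ : (I : CospanIso c c′) (P : Plugging l c d) (P′ : Plugging l c′ d′) →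
                     plugging-to I P P′ ∘ₕ ιᶜ P ≈ₕ ιᶜ P′ ∘ₕ to I
    plugging-to-ιᶜ I P P′ = proj₂ (proj₂ (transport-to I P P′))

  plugging-inverse : {l : Cospan S i j} {c c′ : Cospan S (j + m) (i + n)} {d d′ : Cospan S m n}
                     (I : CospanIso c c′) (J : CospanIso c′ c) → to J ∘ₕ to I ≈ₕ idₕ →
                     (P : Plugging l c d) (P′ : Plugging l c′ d′) →
                     plugging-to J P′ P ∘ₕ plugging-to I P P′ ≈ₕ idₕ
  plugging-inverse I J eq P P′ = unique P (g ∘ₕ f) idₕ
    ((λ v → trans (cong (onV g) (≈V fl v)) (≈V gl v)) , λ e → trans (cong (onE g) (≈E fl e)) (≈E gl e))
    ((λ v → trans (cong (onV g) (≈V fc v)) (trans (≈V gc _) (cong (onV (ιᶜ P)) (≈V eq v)))) ,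
      λ e → trans (cong (onE g) (≈E fc e)) (trans (≈E gc _) (cong (onE (ιᶜ P)) (≈E eq e))))
    where
    f = plugging-to I P P′
    g = plugging-to J P′ P
    fl = plugging-to-ιˡ I P P′
    gl = plugging-to-ιˡ J P′ P
    fc = plugging-to-ιᶜ I P P′
    gc = plugging-to-ιᶜ J P′ P

  plugging-unique : {l : Cospan S i j} {c c′ : Cospan S (j + m) (i + n)} {d d′ : Cospan S m n} →
                    CospanIso c c′ → Plugging l c d → Plugging l c′ d′ → CospanIso d d′
  plugging-unique I P P′ = record
    { to = plugging-to I P P′ ; from = plugging-to (iso-sym I) P′ P
    ; from-to = plugging-inverse I (iso-sym I) (from-to I) P P′
    ; to-from = plugging-inverse (iso-sym I) I (to-from I) P′ P
    ; to-in  = λ a → trans (cong (onV (plugging-to I P P′)) (ιᶜ-in P a))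
        (trans (≈V (plugging-to-ιᶜ I P P′) _) (trans (cong (onV (ιᶜ P′)) (to-in I _)) (sym (ιᶜ-in P′ a))))
    ; to-out = λ b → trans (cong (onV (plugging-to I P P′)) (ιᶜ-out P b))
        (trans (≈V (plugging-to-ιᶜ I P P′) _) (trans (cong (onV (ιᶜ P′)) (to-out I _)) (sym (ιᶜ-out P′ b))))
    }

  plugging-iso : {l : Cospan S i j} {c : Cospan S (j + m) (i + n)} {d d′ : Cospan S m n} →
                 CospanIso d d′ → Plugging l c d → Plugging l c d′
  plugging-iso I P = record
    { ιˡ = to I ∘ₕ ιˡ P ; ιᶜ = to I ∘ₕ ιᶜ P
    ; agree = (λ a → cong (onV (to I)) (proj₁ (agree P) a)) , λ b → cong (onV (to I)) (proj₂ (agree P) b)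
    ; universal = λ h k eq → let u , ul , uc = universal P h k eq in u ∘ₕ from I ,
        ((λ v → trans (cong (onV u) (≈V (from-to I) _)) (≈V ul v)) , λ e → trans (cong (onE u) (≈E (from-to I) _)) (≈E ul e)) ,
        ((λ v → trans (cong (onV u) (≈V (from-to I) _)) (≈V uc v)) , λ e → trans (cong (onE u) (≈E (from-to I) _)) (≈E uc e))
    ; unique = λ u v (lV , lE) (cV , cE) → let (V , E) = unique P (u ∘ₕ to I) (v ∘ₕ to I) (lV , lE) (cV , cE) in
        (λ x → trans (cong (onV u) (sym (≈V (to-from I) x))) (trans (V _) (cong (onV v) (≈V (to-from I) x)))) ,
        (λ x → trans (cong (onE u) (sym (≈E (to-from I) x))) (trans (E _) (cong (onE v) (≈E (to-from I) x))))
    ; ιᶜ-in  = λ a → trans (sym (to-in I a)) (cong (onV (to I)) (ιᶜ-in P a))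
    ; ιᶜ-out = λ b → trans (sym (to-out I b)) (cong (onV (to I)) (ιᶜ-out P b))
    }

  open Coequaliser using (proj; commutes; factor; factor-proj; proj-surjective)

  plugging-⟦⟧ : ∀ m n (l : Cospan S i j) (c : Cospan S (j + m) (i + n)) →
                Plugging l c (Trᶜ i ((l ⊗ᶜ idᶜ m) ⨾ᶜ c))
  plugging-⟦⟧ {i} {j} m n (cospan {L} a b) (cospan {C} c d) = record
    { ιˡ = projₕ Q₂ ∘ₕ projₕ Q₁ ∘ₕ inlₕ {G = C} ∘ₕ inlₕ
    ; ιᶜ = projₕ Q₂ ∘ₕ projₕ Q₁ ∘ₕ inrₕ
    ; agree = (λ x → trans (cong (λ v → proj Q₂ (proj Q₁ (inl v))) (sym (++-↑ˡ _ _ x))) (commutes Q₂ x)) ,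
              (λ y → trans (cong (λ v → proj Q₂ (proj Q₁ (inl v))) (sym (++-↑ˡ _ _ y))) (cong (proj Q₂) (commutes Q₁ (y ↑ˡ m))))
    ; universal = λ h k (eq , eq′) → mediate h k eq eq′ ,
        ((λ v → trans (mediate-proj h k eq eq′ _) (trans (++-↑ˡ _ _ (v ↑ˡ m)) (++-↑ˡ _ _ v))) ,
          λ e → trans (++-↑ˡ {m = #E L + 0} (onE (copairₕ h (middle h k eq eq′))) (onE k) (e ↑ˡ 0)) (++-↑ˡ (onE h) (onE (middle h k eq eq′)) e)) ,
        ((λ v → trans (mediate-proj h k eq eq′ _) (++-↑ʳ {m = #V L + m} _ _ v)) ,
          λ e → ++-↑ʳ {m = #E L + 0} (onE (copairₕ h (middle h k eq eq′))) (onE k) e)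
    ; unique = λ u v (lV , lE) (cV , cE) →
        (λ w → let w₁ , eq₁ = proj-surjective Q₂ w
                   w₂ , eq₂ = proj-surjective Q₁ w₁
               in subst (λ w → onV u w ≡ onV v w) (trans (cong (proj Q₂) eq₂) eq₁)
                    (split-∀ (#V L + m) {P = λ w → onV u (proj Q₂ (proj Q₁ w)) ≡ onV v (proj Q₂ (proj Q₁ w))}
                      (split-∀ (#V L) lV (λ y → subst (λ w → onV u (proj Q₂ w) ≡ onV v (proj Q₂ w)) (sym (middle-wire y)) (cV _)))
                      cV w₂)) ,
        split-∀ (#E L + 0) (split-∀ (#E L) lE λ ()) cE
    ; ιᶜ-in = λ y → cong (proj Q₂) (trans (cong (proj Q₁ ∘ inl) (++-↑ʳ {m = i} _ _ y)) (middle-wire y))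
    ; ιᶜ-out = λ y → refl
    }
    where
    inl : Fin (#V L + m) → Fin ((#V L + m) + #V C)
    inl = _↑ˡ #V C

    inr : Fin (#V C) → Fin ((#V L + m) + #V C)
    inr = (#V L + m) ↑ʳ_

    ins : Fin (i + m) → Fin (#V L + m)
    ins = (_↑ˡ m) ∘ onV a ++ (#V L ↑ʳ_) ∘ id

    outs : Fin (j + m) → Fin (#V L + m)
    outs = (_↑ˡ m) ∘ onV b ++ (#V L ↑ʳ_) ∘ id

    Q₁ : Coequaliser (inl ∘ outs) (inr ∘ onV c)
    Q₁ = coequaliser (inl ∘ outs) (inr ∘ onV c)

    Q₂ : Coequaliser (proj Q₁ ∘ inl ∘ ins ∘ (_↑ˡ m)) (proj Q₁ ∘ inr ∘ onV d ∘ (_↑ˡ n))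
    Q₂ = coequaliser (proj Q₁ ∘ inl ∘ ins ∘ (_↑ˡ m)) (proj Q₁ ∘ inr ∘ onV d ∘ (_↑ˡ n))

    middle-wire : ∀ y → proj Q₁ (inl (#V L ↑ʳ y)) ≡ proj Q₁ (inr (onV c (j ↑ʳ y)))
    middle-wire y = trans (cong (proj Q₁ ∘ inl) (sym (++-↑ʳ {m = j} _ _ y))) (commutes Q₁ (j ↑ʳ y))

    module _ {Q : Hypergraph S} (h : Hom L Q) (k : Hom C Q)
             (eq : ∀ x → onV h (onV a x) ≡ onV k (onV d (x ↑ˡ n)))
             (eq′ : ∀ y → onV h (onV b y) ≡ onV k (onV c (y ↑ˡ m))) where

      middle : Hom (discrete m) Q
      middle = pick (λ y → onV k (onV c (j ↑ʳ y)))

      all-three : Hom ((L ⊕ discrete m) ⊕ C) Q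
      all-three = copairₕ (copairₕ h middle) k

      agree₁ : onV all-three ∘ inl ∘ outs ≗ onV all-three ∘ inr ∘ onV c
      agree₁ x = trans (++-↑ˡ _ _ (outs x)) (trans (split-∀ j {P = λ x → (onV h ++ onV middle) (outs x) ≡ onV k (onV c x)}
        (λ y → trans (cong (onV h ++ onV middle) (++-↑ˡ _ _ y)) (trans (++-↑ˡ _ _ (onV b y)) (eq′ y)))
        (λ y → trans (cong (onV h ++ onV middle) (++-↑ʳ {m = j} _ _ y)) (++-↑ʳ (onV h) (onV middle) y)) x)
        (sym (++-↑ʳ {m = #V L + m} _ _ (onV c x))))

      glued : Hom (((L ⊕ discrete m) ⊕ C) / Q₁) Q
      glued = factorₕ Q₁ all-three agree₁

      glued-proj : ∀ x → onV glued (proj Q₁ x) ≡ onV all-three x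
      glued-proj = factor-proj Q₁ (onV all-three) agree₁

      agree₂ : onV glued ∘ proj Q₁ ∘ inl ∘ ins ∘ (_↑ˡ m) ≗ onV glued ∘ proj Q₁ ∘ inr ∘ onV d ∘ (_↑ˡ n)
      agree₂ x = trans (glued-proj _) (trans (++-↑ˡ _ _ (ins (x ↑ˡ m))) (trans (cong (onV h ++ onV middle) (++-↑ˡ _ _ x))
        (trans (++-↑ˡ _ _ (onV a x)) (trans (eq x) (sym (trans (glued-proj _) (++-↑ʳ {m = #V L + m} _ _ (onV d (x ↑ˡ n)))))))))

      mediate : Hom ((((L ⊕ discrete m) ⊕ C) / Q₁) / Q₂) Q
      mediate = factorₕ Q₂ glued agree₂

      mediate-proj : ∀ x → onV mediate (proj Q₂ (proj Q₁ x)) ≡ onV all-three x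
      mediate-proj x = trans (factor-proj Q₂ (onV glued) agree₂ (proj Q₁ x)) (glued-proj x)

  IsPushout-flip : {A B C P : Hypergraph S} {f : Hom A B} {g : Hom A C} {p : Hom B P} {q : Hom C P} →
                   IsPushout f g p q → IsPushout g f q p
  IsPushout-flip po = record
    { commutes  = (λ v → sym (≈V PO.commutes v)) , λ e → sym (≈E PO.commutes e)
    ; universal = λ h k (V , E) → let u , up , uq = PO.universal k h (sym ∘ V , sym ∘ E) in u , uq , up
    ; unique    = λ u v eq eq′ → PO.unique u v eq′ eq
    }
    where module PO = IsPushout po

  module _ {L C G : Hypergraph S} {a : Hom (discrete i) L} {b : Hom (discrete j) L}
           {x : Hom (discrete m) G} {y : Hom (discrete n) G}
           (c₁ : Hom (discrete i) C) (c₂ : Hom (discrete j) C) (d₁ : Hom (discrete m) C) (d₂ : Hom (discrete n) C) where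

    pushout⇒plugging : {p : Hom L G} {q : Hom C G} → IsPushout [ a , b ]ₕ [ c₁ , c₂ ]ₕ p q →
                       [ x , y ]ₕ ≈ₕ q ∘ₕ [ d₁ , d₂ ]ₕ →
                       Plugging (cospan a b) (cospan [ c₂ , d₁ ]ₕ [ c₁ , d₂ ]ₕ) (cospan x y)
    pushout⇒plugging {p} {q} po legs = record
      { ιˡ = p ; ιᶜ = q
      ; agree =
          (λ v → trans (cong (onV p) (sym (++-↑ˡ (onV a) (onV b) v))) (trans (≈V (IsPushout.commutes po) (v ↑ˡ j))
                   (cong (onV q) (trans (++-↑ˡ (onV c₁) (onV c₂) v) (sym (++-↑ˡ (onV c₁) (onV d₂) v)))))) ,
          (λ v → trans (cong (onV p) (sym (++-↑ʳ (onV a) (onV b) v))) (trans (≈V (IsPushout.commutes po) (i ↑ʳ v))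
                   (cong (onV q) (trans (++-↑ʳ (onV c₁) (onV c₂) v) (sym (++-↑ˡ (onV c₂) (onV d₁) v))))))
      ; universal = λ h k (eq , eq′) → IsPushout.universal po h k (split-∀ i
          (λ v → trans (cong (onV h) (++-↑ˡ (onV a) (onV b) v)) (trans (eq v)
                   (cong (onV k) (trans (++-↑ˡ (onV c₁) (onV d₂) v) (sym (++-↑ˡ (onV c₁) (onV c₂) v))))))
          (λ v → trans (cong (onV h) (++-↑ʳ (onV a) (onV b) v)) (trans (eq′ v)
                   (cong (onV k) (trans (++-↑ˡ (onV c₂) (onV d₁) v) (sym (++-↑ʳ (onV c₁) (onV c₂) v)))))) , λ ())
      ; unique = IsPushout.unique po
      ; ιᶜ-in  = λ v → trans (sym (++-↑ˡ (onV x) (onV y) v)) (trans (≈V legs (v ↑ˡ n))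
                   (cong (onV q) (trans (++-↑ˡ (onV d₁) (onV d₂) v) (sym (++-↑ʳ (onV c₂) (onV d₁) v)))))
      ; ιᶜ-out = λ v → trans (sym (++-↑ʳ (onV x) (onV y) v)) (trans (≈V legs (m ↑ʳ v))
                   (cong (onV q) (trans (++-↑ʳ (onV d₁) (onV d₂) v) (sym (++-↑ʳ (onV c₁) (onV d₂) v)))))
      }

  module _ {C : Hypergraph S} (I : Hom (discrete (j + m)) C) (O : Hom (discrete (i + n)) C) where

    cᵢ : Hom (discrete i) C
    cᵢ = pick (onV O ∘ (_↑ˡ n))

    cⱼ : Hom (discrete j) C
    cⱼ = pick (onV I ∘ (_↑ˡ m))

    dₘ : Hom (discrete m) C
    dₘ = pick (onV I ∘ (j ↑ʳ_))

    dₙ : Hom (discrete n) C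
    dₙ = pick (onV O ∘ (i ↑ʳ_))

    complement-⟦⟧ : SingleSource (fromCospan (cospan I O)) → TracedLeftBoundaryComplement cᵢ cⱼ dₘ dₙ
    complement-⟦⟧ ss = record
      { c₂-mono = Inj⇒Mono {f = cⱼ} λ eq → Fin.↑ˡ-injective m _ _ (inp-inj ss eq)
      ; partialLeftMonogamous = single⇒plm [ cⱼ , dₘ ]ₕ [ cᵢ , dₙ ]ₕ (single-iso restore ss)
      }
      where
      restore : CospanIso (toCospan (fromCospan (cospan I O))) (cospan [ cⱼ , dₘ ]ₕ [ cᵢ , dₙ ]ₕ)
      restore = record
        { to = idₕ ; from = idₕ
        ; from-to = (λ _ → refl) , (λ _ → refl) ; to-from = (λ _ → refl) , (λ _ → refl)
        ; to-in = λ v → sym (++-η {m = j} (onV I) v) ; to-out = λ v → sym (++-η {m = i} (onV O) v)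
        }

    module _ {L G : Hypergraph S} {a : Hom (discrete i) L} {b : Hom (discrete j) L}
             {x : Hom (discrete m) G} {y : Hom (discrete n) G}
             (P : Plugging (cospan a b) (cospan I O) (cospan x y)) where

      plugging⇒pushout : IsPushout [ a , b ]ₕ [ cᵢ , cⱼ ]ₕ (ιˡ P) (ιᶜ P)
      plugging⇒pushout = record
        { commutes = split-∀ i
            (λ v → trans (cong (onV (ιˡ P)) (++-↑ˡ (onV a) (onV b) v)) (trans (proj₁ (agree P) v)
                     (cong (onV (ιᶜ P)) (sym (++-↑ˡ (onV cᵢ) (onV cⱼ) v)))))
            (λ v → trans (cong (onV (ιˡ P)) (++-↑ʳ (onV a) (onV b) v)) (trans (proj₂ (agree P) v)
                     (cong (onV (ιᶜ P)) (sym (++-↑ʳ (onV cᵢ) (onV cⱼ) v))))) , λ ()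
        ; universal = λ h k (eq , _) → universal P h k
            ( (λ v → trans (cong (onV h) (sym (++-↑ˡ (onV a) (onV b) v))) (trans (eq (v ↑ˡ j)) (cong (onV k) (++-↑ˡ (onV cᵢ) (onV cⱼ) v))))
            , (λ v → trans (cong (onV h) (sym (++-↑ʳ (onV a) (onV b) v))) (trans (eq (i ↑ʳ v)) (cong (onV k) (++-↑ʳ (onV cᵢ) (onV cⱼ) v)))))
        ; unique = unique P
        }

      plugging-legs : [ x , y ]ₕ ≈ₕ ιᶜ P ∘ₕ [ dₘ , dₙ ]ₕ
      plugging-legs = split-∀ m
        (λ v → trans (++-↑ˡ (onV x) (onV y) v) (trans (ιᶜ-in P v) (cong (onV (ιᶜ P)) (sym (++-↑ˡ (onV dₘ) (onV dₙ) v)))))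
        (λ v → trans (++-↑ʳ (onV x) (onV y) v) (trans (ιᶜ-out P v) (cong (onV (ιᶜ P)) (sym (++-↑ʳ (onV dₘ) (onV dₙ) v))))) , λ ()

theorem9p53 : (S : Signature) {i j m n : ℕ} (r : RewriteRule S i j) (g h : Term S m n) →
    (g ⇒[ r ] h) ⇔ (⌜ ⟦ g ⟧ ⌝ ⇝[ ⟪ r ⟫ ] ⌜ ⟦ h ⟧ ⌝)
theorem9p53 S {i} {j} {m} {n} r g h = mk⇔ rewrite⇒dpo dpo⇒rewrite
  where
  open RewriteRule r

  plugging : (l : Term S i j) (c : Term S (j + m) (i + n)) {f : Term S m n} →
             f ≈ Tr i ((l ⊗ idₜ m) ⨾ c) → Plugging ⟦ l ⟧ ⟦ c ⟧ ⟦ f ⟧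
  plugging l c {f} eq = plugging-iso (rep-unique (rep-≈ (≈-sym eq) (rep _)) (rep f)) (plugging-⟦⟧ m n ⟦ l ⟧ ⟦ c ⟧)

  rewrite⇒dpo : g ⇒[ r ] h → ⌜ ⟦ g ⟧ ⌝ ⇝[ ⟪ r ⟫ ] ⌜ ⟦ h ⟧ ⌝
  rewrite⇒dpo (c , g≈ , h≈) = record
    { c₁ = cᵢ {j = j} {m = m} {i = i} {n = n} I O ; c₂ = cⱼ {j = j} {m = m} {i = i} {n = n} I O
    ; d₁ = dₘ {j = j} {m = m} {i = i} {n = n} I O ; d₂ = dₙ {j = j} {m = m} {i = i} {n = n} I O
    ; L→G = Plugging.ιˡ Pg ; C→G = Plugging.ιᶜ Pg ; C→H = Plugging.ιᶜ Ph ; R→H = Plugging.ιˡ Ph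
    ; pushout-G = plugging⇒pushout I O Pg
    ; pushout-H = IsPushout-flip (plugging⇒pushout I O Ph)
    ; factor-G = plugging-legs I O Pg
    ; factor-H = plugging-legs I O Ph
    ; complement = complement-⟦⟧ I O (single-⟦⟧ c)
    }
    where
    I = Cospan.inputs ⟦ c ⟧
    O = Cospan.outputs ⟦ c ⟧

    Pg : Plugging ⟦ lhs ⟧ ⟦ c ⟧ ⟦ g ⟧
    Pg = plugging lhs c g≈

    Ph : Plugging ⟦ rhs ⟧ ⟦ c ⟧ ⟦ h ⟧
    Ph = plugging rhs c h≈

  dpo⇒rewrite : ⌜ ⟦ g ⟧ ⌝ ⇝[ ⟪ r ⟫ ] ⌜ ⟦ h ⟧ ⌝ → g ⇒[ r ] h
  dpo⇒rewrite step =
    let c , iso = full partialLeftMonogamous in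
    c , faithful (plugging-unique (iso-sym iso) (pushout⇒plugging c₁ c₂ d₁ d₂ pushout-G factor-G)
                                                (plugging-⟦⟧ m n ⟦ lhs ⟧ ⟦ c ⟧)) ,
        faithful (plugging-unique (iso-sym iso) (pushout⇒plugging c₁ c₂ d₁ d₂ (IsPushout-flip pushout-H) factor-H)
                                                (plugging-⟦⟧ m n ⟦ rhs ⟧ ⟦ c ⟧))
    where
    open _⇝[_]_ step
    open TracedLeftBoundaryComplement complement
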